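{- Let $\vec{H}$ be a (fixed) directed acyclic graph and let $\vec{H}'$ be a directed subdivision of $\vec{H}$. If $\textsc{w-hom-cnt}_{\vec{H}}$ can be solved in time $O(n^\alpha)$ in $n$-vertex weighted degenerate digraphs, then $\textsc{hom-cnt}_{\vec{H}'}$ can be solved in time $O(n^\alpha)$ in $n$-vertex degenerate digraphs.
   Context: A homomorphism from a digraph $\vec H$ to a digraph $\vec G$ is a map $\varphi:V(\vec H)\to V(\vec G)$ with $(\varphi(u),\varphi(v))\in E(\vec G)$ whenever $(u,v)\in E(\vec H)$; $\mathrm{Hom}(\vec H,\vec G)$ is the set of these and $\hom(\vec H,\vec G)$ their number. $\textsc{hom-cnt}_{\vec H}$ is the problem of computing $\hom(\vec H,\vec G)$ for an input digraph $\vec G$. A weighted digraph is a digraph $\vec G$ with a weight function $w_{\vec G}:E(\vec G)\to\mathbb R_{\ge 0}$. The weight of a homomorphism $\varphi:\vec H\to\vec G$ is $W(\varphi)=\prod_{(u,v)\in E(\vec H)}w_{\vec G}((\varphi(u),\varphi(v)))$, and $\hom(\vec H,\vec G,w_{\vec G})=\sum_{\varphi\in \mathrm{Hom}(\vec H,\vec G)}W(\varphi)$. $\textsc{w-hom-cnt}_{\vec H}$ is the problem of computing $\hom(\vec H,\vec G,w_{\vec G})$ for an input weighted digraph $\vec G$. Degenerate digraphs are digraphs in which all out-degrees are bounded by a constant; "solved in time $O(n^\alpha)$ in degenerate digraphs" means that for every constant $\kappa$ the problem restricted to digraphs with all out-degrees at most $\kappa$ is solved in time $O(n^\alpha)$,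 where the implicit constant may depend on $\kappa$ (and on the fixed pattern digraph). If $E(\vec H)=\{e_1,\dots,e_t\}$ and $(x_1,\dots,x_t)$ is a sequence of positive integers, the directed $(x_1,\dots,x_t)$-subdivision of $\vec H$ is obtained from $\vec H$ by replacing each edge $e_i$ with a directed path with $x_i$ edges (from the tail to the head of $e_i$), where paths replacing different edges are internally disjoint. A directed subdivision of $\vec H$ is a digraph of this form for some $(x_1,\dots,x_t)$. -}

module Defs where

open import Level using (Level; _⊔_) renaming (suc to lsuc)
open import Algebra.Bundles using (CommutativeRing)
import Algebra.Definitions.RawMonoid as RawMonoidDefinitions
open import Data.Bool.Base using (if_then_else_; _∧_)
open import Data.Fin.Base using (Fin; toℕ; finToFun)
import Data.Fin.Properties as Fin
open import Data.List.Base
  using (List; []; _∷_; _++_; map; concatMap; filter; foldr; length; lookup; tabulate; allFin; zip; drop)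
open import Data.List.Membership.Propositional using (_∈_)
import Data.List.Membership.DecPropositional as DecMembership
open import Data.List.Relation.Unary.Unique.Propositional using (Unique)
open import Data.Nat.Base as ℕ using (ℕ; zero; suc)
import Data.Nat.DivMod as ℕ
import Data.Nat.Properties as ℕ
open import Data.Product.Base using (Σ; Σ-syntax; ∃; ∃-syntax; _×_; _,_; proj₁; proj₂)
open import Data.Sum.Base using (_⊎_; inj₁; inj₂)
open import Function.Base using (_∘_)
open import Function.Bundles using (_↔_; _⇔_; Inverse)
open import Relation.Binary.Core using (Rel)
open import Relation.Binary.Construct.Closure.Transitive using (TransClosure)
open import Relation.Binary.Structures using (IsStrictPartialOrder)
open import Relation.Nullary using (¬_; Dec; does)
open import Relation.Nullary.Decidable using (_→-dec_)

-- The library has no ℝ, so it is given by its axioms: a Cauchy-complete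
-- Archimedean ordered field, which determines it up to isomorphism.  The
-- order axioms are the constructive ones (cotransitivity and tightness in
-- place of trichotomy); classically they say that _<_ is a strict total order.

record Reals (c ℓ : Level) : Set (lsuc (c ⊔ ℓ)) where
  infix 4 _<_ _≤_ _#_
  field
    commutativeRing : CommutativeRing c ℓ
  open CommutativeRing commutativeRing public
  open RawMonoidDefinitions +-rawMonoid using () renaming (_×_ to _·_)
  field
    _<_ : Rel Carrier ℓ

  _≤_ : Rel Carrier ℓ
  x ≤ y = ¬ (y < x)

  _#_ : Rel Carrier ℓ
  x # y = x < y ⊎ y < x

  fromℕ : ℕ → Carrier
  fromℕ n = n · 1#

  Cauchy : (ℕ → Carrier) → Set ℓ
  Cauchy s = ∀ k → ∃[ N ] ∀ i j → N ℕ.≤ i → N ℕ.≤ j →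
    fromℕ (suc k) * (s i - s j) < 1#

  ConvergesTo : (ℕ → Carrier) → Carrier → Set ℓ
  ConvergesTo s x = ∀ k → ∃[ N ] ∀ i → N ℕ.≤ i →
    fromℕ (suc k) * (s i - x) < 1# × fromℕ (suc k) * (x - s i) < 1#

  field
    isStrictPartialOrder : IsStrictPartialOrder _≈_ _<_
    <-cotrans     : ∀ {x y} z → x < y → x < z ⊎ z < y
    <-tight       : ∀ {x y} → x ≤ y → y ≤ x → x ≈ y
    +-monoˡ-<     : ∀ {x y} z → x < y → x + z < y + z
    *-positive    : ∀ {x y} → 0# < x → 0# < y → 0# < x * y
    0<1           : 0# < 1#
    recip         : ∀ x → x # 0# → Carrier
    recip-inverse : ∀ x (x#0 : x # 0#) → x * recip x x#0 ≈ 1#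
    archimedean   : ∀ x → ∃[ n ] x < fromℕ n
    complete      : ∀ s → Cauchy s → ∃[ x ] ConvergesTo s x

-- E ⊆ V × V is held as duplicate-free out-neighbour lists.  Loops are allowed.

record Digraph : Set where
  field
    order      : ℕ
    adj        : Fin order → List (Fin order)
    adj-unique : ∀ u → Unique (adj u)

  Vertex : Set
  Vertex = Fin order

  Edge : Vertex → Vertex → Set
  Edge u v = v ∈ adj u

  edge? : ∀ u v → Dec (Edge u v)
  edge? u v = v ∈? adj u
    where open DecMembership (Fin._≟_ {order}) using (_∈?_)

  edges : List (Vertex × Vertex)
  edges = concatMap (λ u → map (u ,_) (adj u)) (allFin order)

  outDegree : Vertex → ℕ
  outDegree u = length (adj u)

open Digraph using (order; adj; Vertex; Edge; edge?; edges; outDegree)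

Acyclic : Digraph → Set
Acyclic G = ∀ v → ¬ TransClosure (Edge G) v v

OutDegreesAtMost : ℕ → Digraph → Set
OutDegreesAtMost κ G = ∀ v → outDegree G v ℕ.≤ κ

tailOf headOf : ∀ G → Fin (length (edges G)) → Vertex G
tailOf G i = proj₁ (lookup (edges G) i)
headOf G i = proj₂ (lookup (edges G) i)

consecutive : ∀ {a} {A : Set a} → List A → List (A × A)
consecutive xs = zip xs (drop 1 xs)

-- The i-th edge of H becomes a path with x i edges, hence x i ∸ 1 internal
-- vertices.  Internal disjointness is the injectivity of `vertices`.

record IsSubdivision (H : Digraph) (x : Fin (length (edges H)) → ℕ) (H′ : Digraph) : Set where
  field
    positive : ∀ i → 1 ℕ.≤ x i
    vertices : (Vertex H ⊎ (Σ[ i ∈ Fin (length (edges H)) ] Fin (x i ℕ.∸ 1))) ↔ Vertex H′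

  original : Vertex H → Vertex H′
  original v = Inverse.to vertices (inj₁ v)

  internal : ∀ i → Fin (x i ℕ.∸ 1) → Vertex H′
  internal i j = Inverse.to vertices (inj₂ (i , j))

  path : Fin (length (edges H)) → List (Vertex H′)
  path i = original (tailOf H i) ∷ tabulate (internal i) ++ original (headOf H i) ∷ []

  field
    edges⇔ : ∀ a b → Edge H′ a b ⇔ (∃[ i ] (a , b) ∈ consecutive (path i))

IsDirectedSubdivision : Digraph → Digraph → Set
IsDirectedSubdivision H H′ = ∃[ x ] IsSubdivision H x H′

IsHom : (H G : Digraph) → (Vertex H → Vertex G) → Set
IsHom H G φ = ∀ u v → Edge H u v → Edge G (φ u) (φ v)

isHom? : ∀ H G φ → Dec (IsHom H G φ)
isHom? H G φ = Fin.all? λ u → Fin.all? λ v → edge? H u v →-dec edge? G (φ u) (φ v)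

Hom : (H G : Digraph) → List (Vertex H → Vertex G)
Hom H G = filter (isHom? H G) (map finToFun (allFin (order G ℕ.^ order H)))

hom : (H G : Digraph) → ℕ
hom H G = length (Hom H G)

data WordOp : Set where
  add sub mul div mod : WordOp

data RealOp : Set where
  add sub mul : RealOp

data WordExpr : Set where
  lit  : ℕ → WordExpr
  cell : (array : ℕ) (index : WordExpr) → WordExpr
  op   : WordOp → WordExpr → WordExpr → WordExpr

data RealExpr : Set where
  cast : WordExpr → RealExpr
  cell : (array : ℕ) (index : WordExpr) → RealExpr
  op   : RealOp → RealExpr → RealExpr → RealExpr

data Test : Set where
  wordLess : WordExpr → WordExpr → Test
  realLess : RealExpr → RealExpr → Test

-- Programs for a real RAM whose memory consists of word-valued and real-valued
-- arrays.  Arrays are named by numbers fixed in the program text; only the index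
-- within an array is computed.

infixr 5 _∙_

data Program : Set where
  skip       : Program
  assignWord : (array : ℕ) (index : WordExpr) → WordExpr → Program
  assignReal : (array : ℕ) (index : WordExpr) → RealExpr → Program
  divideReal : (array : ℕ) (index : WordExpr) (numerator denominator : RealExpr) → Program
  _∙_        : Program → Program → Program
  branch     : Test → Program → Program → Program
  while      : Test → Program → Program

applyWord : WordOp → ℕ → ℕ → ℕ
applyWord add m n = m ℕ.+ n
applyWord sub m n = m ℕ.∸ n
applyWord mul m n = m ℕ.* n
applyWord div m zero = 0
applyWord div m (suc n) = m ℕ./ suc n
applyWord mod m zero = m
applyWord mod m (suc n) = m ℕ.% suc n

update : ∀ {a} {A : Set a} → (ℕ → ℕ → A) → ℕ → ℕ → A → ℕ → ℕ → A
update M a i x b j = if does (a ℕ.≟ b) ∧ does (i ℕ.≟ j) then x else M b j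

fromList : ∀ {a} {A : Set a} → A → List A → ℕ → A
fromList d []       _       = d
fromList d (x ∷ xs) zero    = x
fromList d (x ∷ xs) (suc i) = fromList d xs i

module Over {c ℓ} (ℝ : Reals c ℓ) where
  open Reals ℝ

  record WeightedDigraph : Set (c ⊔ ℓ) where
    field
      digraph  : Digraph
      -- Only the values on edges are ever used.
      weight   : Vertex digraph → Vertex digraph → Carrier
      weight≥0 : ∀ u v → Edge digraph u v → 0# ≤ weight u v

  open WeightedDigraph

  homWeight : (H : Digraph) (G : WeightedDigraph) → (Vertex H → Vertex (digraph G)) → Carrier
  homWeight H G φ = foldr _*_ 1# (map (λ (u , v) → weight G (φ u) (φ v)) (edges H))

  weightedHom : Digraph → WeightedDigraph → Carrier
  weightedHom H G = foldr _+_ 0# (map (homWeight H G) (Hom H (digraph G)))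

  record Store : Set c where
    constructor store
    field
      words : ℕ → ℕ → ℕ
      reals : ℕ → ℕ → Carrier

  open Store

  applyReal : RealOp → Carrier → Carrier → Carrier
  applyReal add x y = x + y
  applyReal sub x y = x - y
  applyReal mul x y = x * y

  evalWord : WordExpr → Store → ℕ
  evalWord (lit n)    σ = n
  evalWord (cell a e) σ = words σ a (evalWord e σ)
  evalWord (op o d e) σ = applyWord o (evalWord d σ) (evalWord e σ)

  evalReal : RealExpr → Store → Carrier
  evalReal (cast e)   σ = fromℕ (evalWord e σ)
  evalReal (cell a e) σ = reals σ a (evalWord e σ)
  evalReal (op o d e) σ = applyReal o (evalReal d σ) (evalReal e σ)

  Holds : Test → Store → Set ℓ
  Holds (wordLess d e) σ = Level.Lift ℓ (evalWord d σ ℕ.< evalWord e σ)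
  Holds (realLess d e) σ = evalReal d σ < evalReal e σ

  -- Run B P σ t τ: started in σ, P halts in τ after t steps.  The largest word
  -- is B: a run is stuck when it stores a bigger number or writes to a bigger
  -- address.  Expressions in a program have constant size, hence unit cost.

  data Run (B : ℕ) : Program → Store → ℕ → Store → Set (c ⊔ ℓ) where

    skip : ∀ {σ} → Run B skip σ 1 σ

    assignWord : ∀ {σ a d e} → evalWord d σ ℕ.≤ B → evalWord e σ ℕ.≤ B →
      Run B (assignWord a d e) σ 1
        (store (update (words σ) a (evalWord d σ) (evalWord e σ)) (reals σ))

    assignReal : ∀ {σ a d e} → evalWord d σ ℕ.≤ B →
      Run B (assignReal a d e) σ 1
        (store (words σ) (update (reals σ) a (evalWord d σ) (evalReal e σ)))

    divideReal : ∀ {σ a d e f} → evalWord d σ ℕ.≤ B → (f#0 : evalReal f σ # 0#) →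
      Run B (divideReal a d e f) σ 1
        (store (words σ) (update (reals σ) a (evalWord d σ)
          (evalReal e σ * recip (evalReal f σ) f#0)))

    seq : ∀ {P Q ρ σ τ s t} → Run B P ρ s σ → Run B Q σ t τ →
      Run B (P ∙ Q) ρ (s ℕ.+ t) τ

    branch-true : ∀ {b P Q σ τ t} → Holds b σ → Run B P σ t τ →
      Run B (branch b P Q) σ (suc t) τ

    branch-false : ∀ {b P Q σ τ t} → ¬ Holds b σ → Run B Q σ t τ →
      Run B (branch b P Q) σ (suc t) τ

    while-true : ∀ {b P ρ σ τ s t} → Holds b ρ → Run B P ρ s σ → Run B (while b P) σ t τ →
      Run B (while b P) ρ (suc (s ℕ.+ t)) τ

    while-false : ∀ {b P σ} → ¬ Holds b σ → Run B (while b P) σ 1 σ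

  -- T ≤ C · n ^ α for n ≥ 1 and real α.  As n ^ α is the infimum of n ^ r over
  -- the rationals r > α, this says T ≤ C · n ^ ((a - b) / q) for all naturals
  -- a, b, q with q ≥ 1 and (a - b) / q > α.

  _≤_·_^_ : ℕ → ℕ → ℕ → Carrier → Set ℓ
  T ≤ C · n ^ α = ∀ a b q → 1 ℕ.≤ q → fromℕ b + fromℕ q * α < fromℕ a →
    T ℕ.^ q ℕ.* n ℕ.^ b ℕ.≤ C ℕ.^ q ℕ.* n ℕ.^ a

  record Problem (i : Level) : Set (lsuc i ⊔ c) where
    field
      Instance    : Set i
      size        : Instance → ℕ
      inputLength : Instance → ℕ
      input       : Instance → Store
      answer      : Instance → Carrier

  open Problem

  -- Words have O(log n) bits, that is, they are bounded by a polynomial in n.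
  -- The answer is left in cell 0 of real array 1.  Running time includes
  -- loading the input.

  SolvableInTime : ∀ {i} → Carrier → Problem i → Set (c ⊔ ℓ ⊔ i)
  SolvableInTime α Π = ∃[ P ] ∃[ w ] ∃[ C ] ∀ (I : Instance Π) → ∃[ t ] ∃[ σ ]
      Run ((2 ℕ.+ size Π I) ℕ.^ w) P (input Π I) t σ
    × reals σ 1 0 ≈ answer Π I
    × (1 ℕ.≤ size Π I → (inputLength Π I ℕ.+ t) ≤ C · size Π I ^ α)

  -- A digraph is stored by its order, the array of its out-degrees and the
  -- concatenation of its out-neighbour lists (word arrays 0, 1 and 2).  The
  -- weights are stored in the order of the latter, in real array 0.

  digraphWords : Digraph → ℕ → ℕ → ℕ
  digraphWords G 0 = fromList 0 (order G ∷ [])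
  digraphWords G 1 = fromList 0 (map (outDegree G) (allFin (order G)))
  digraphWords G 2 = fromList 0 (map (toℕ ∘ proj₂) (edges G))
  digraphWords G _ = λ _ → 0

  weightReals : WeightedDigraph → ℕ → ℕ → Carrier
  weightReals G 0 = fromList 0# (map (λ (u , v) → weight G u v) (edges (digraph G)))
  weightReals G _ = λ _ → 0#

  digraphLength : Digraph → ℕ
  digraphLength G = 1 ℕ.+ order G ℕ.+ length (edges G)

  HomCnt : Digraph → ℕ → Problem Level.zero
  HomCnt H κ = record
    { Instance    = Σ Digraph (OutDegreesAtMost κ)
    ; size        = λ (G , _) → order G
    ; inputLength = λ (G , _) → digraphLength G
    ; input       = λ (G , _) → store (digraphWords G) (λ _ _ → 0#)
    ; answer      = λ (G , _) → fromℕ (hom H G)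
    }

  WHomCnt : Digraph → ℕ → Problem (c ⊔ ℓ)
  WHomCnt H κ = record
    { Instance    = Σ WeightedDigraph (OutDegreesAtMost κ ∘ digraph)
    ; size        = λ (G , _) → order (digraph G)
    ; inputLength = λ (G , _) → digraphLength (digraph G) ℕ.+ length (edges (digraph G))
    ; input       = λ (G , _) → store (digraphWords (digraph G)) (weightReals G)
    ; answer      = λ (G , _) → weightedHom H G
    }

  SolvableInDegenerate : ∀ {i} → Carrier → (ℕ → Problem i) → Set (c ⊔ ℓ ⊔ i)
  SolvableInDegenerate α Π = ∀ κ → SolvableInTime α (Π κ)

{-# OPTIONS --safe #-}

module Submission where

open import Level using (Level; _⊔_; lift)
open import Algebra.Bundles using (CommutativeRing)
import Algebra.Definitions.RawMonoid as RawMonoidDefinitions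
import Algebra.Properties.CommutativeMonoid.Sum as CommutativeMonoidSum
import Algebra.Properties.Semiring.Sum as SemiringSum
open import Data.Bool.Base using (Bool; true; false; if_then_else_)
open import Data.Fin.Base using (Fin; zero; suc; toℕ; fromℕ<; combine; remQuot; quotient; remainder; finToFun; funToFin; _↑ˡ_; _↑ʳ_; punchOut)
open import Data.Fin.Permutation using (Permutation; permutation; _⟨$⟩ˡ_; _⟨$⟩ʳ_; inverseʳ)
import Data.Fin.Properties as Fin
open import Data.List.Base using (List; []; _∷_; _++_; map; concat; filter; foldr; length; lookup; tabulate; allFin)
open import Data.List.Membership.Propositional using (_∈_; find; lose)
open import Data.List.Membership.Propositional.Properties using (∈-map⁺; ∈-map⁻; ∈-concatMap⁺; ∈-concatMap⁻; ∈-allFin; ∈-lookup)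
import Data.List.Membership.DecPropositional as DecMembership
open import Data.List.Properties using (map-tabulate; map-∘; concat-map; concat-++; tabulate-cong; length-++; length-map; length-tabulate; filter-some)
import Data.List.Relation.Unary.All as All
import Data.List.Relation.Unary.All.Properties as All
import Data.List.Relation.Unary.AllPairs as AllPairs
import Data.List.Relation.Unary.AllPairs.Properties as AllPairs
open import Data.List.Relation.Unary.Any as Any using (here; there)
import Data.List.Relation.Unary.Any.Properties as Any
open import Data.List.Relation.Unary.Unique.Propositional using (Unique; []; _∷_)
import Data.List.Relation.Unary.Unique.Propositional.Properties as Unique
open import Data.Nat.Base as ℕ using (ℕ; zero; suc; z≤n; s≤s; NonZero)
import Data.Nat.Properties as ℕ
open import Data.Nat.Solver using (module +-*-Solver)
open import Data.Product.Base using (∃-syntax; _×_; _,_; proj₁; proj₂)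
import Data.Product.Properties as Product
open import Data.Sum.Base using (_⊎_; inj₁; inj₂; [_,_])
open import Function.Base using (_∘_; id)
open import Function.Bundles using (Inverse; Equivalence; _⇔_; mk⇔)
open import Function.Definitions using (Injective)
open import Relation.Binary.Core using (Rel)
open import Relation.Binary.PropositionalEquality as ≡ using (_≡_; _≢_; _≗_)
open import Relation.Binary.Structures using (IsStrictPartialOrder)
open import Relation.Nullary using (¬_; Dec; yes; no; does; contradiction)
open import Relation.Nullary.Decidable using (_×-dec_; _⊎-dec_; dec-true; dec-false)
open import Defs
open Digraph using (order; adj; adj-unique; Vertex; Edge; edge?; edges; outDegree)

-- For every edge e of H choose a word over the positions in an out-neighbour
-- list, as long as the path replacing e; it names at most one walk from each
-- vertex of the input G. Fixing all words gives a weighted digraph on V(G) ×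
-- V(H) with an edge from (u , a) to (v , b) for every edge e = (a , b) of H,
-- where v ends the walk from u named by the word of e (weight 0 if there is no
-- such walk). It has |V(H)| · |V(G)| vertices and bounded out-degrees. Its
-- weighted homomorphisms from H project to endomorphisms σ of H; summed over all
-- words, those with σ = id count the homomorphisms from the subdivision to G. To
-- isolate them, every word is also used once with the sign -1 and all its walks
-- forbidden: this cancels every σ that misses an edge, and each remaining σ
-- permutes the edges and contributes as much as the identity. So a signed sum of
-- constantly many weighted counts is hom(H′, G) times the number of these σ.

-- One digraph on V(G) whose edge weights count walks would not do: the paths replacing different
-- edges of H may have different lengths, while a single weight function has to serve all of them.
-- Hence the layers V(H), and with them the unwanted endomorphisms. The signs cannot be edge
-- weights, which are nonnegative; they stay outside, as coefficients of whole weighted counts.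
-- Taking one word per edge, instead of all walks at once, avoids merging walks with the same ends
-- into one edge: a vertex (u , a) has exactly as many out-neighbours as `a` has in H, a missing
-- walk included. So the solver is needed only for the out-degree bound `order H`, whatever the
-- bound on G, and every address in the arrays written for it is linear in the loop counter. The
-- number of uncancelled σ depends on H alone and is positive, since the identity is among them;
-- what remains is one division by a literal.

private variable
  a b p q r : Level
  A B : Set a

-- Updates of memory cells

module _ {a} {A : Set a} (M : ℕ → ℕ → A) where

  update-here : ∀ b i {x} → update M b i x b i ≡ x
  update-here b i rewrite dec-true (b ℕ.≟ b) ≡.refl | dec-true (i ℕ.≟ i) ≡.refl = ≡.refl

  update-array : ∀ {b b′} i {x} j → b ≢ b′ → update M b i x b′ j ≡ M b′ j
  update-array {b} {b′} i j b≢b′ rewrite dec-false (b ℕ.≟ b′) b≢b′ = ≡.refl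

  update-index : ∀ b {i} {x} {j} → i ≢ j → update M b i x b j ≡ M b j
  update-index b {i} {x} {j} i≢j rewrite dec-true (b ℕ.≟ b) ≡.refl | dec-false (i ℕ.≟ j) i≢j = ≡.refl

-- Injectivity of `ι` ensures that a write to `ι d` shows up in no other renamed array. The relation
-- `R` is equality for words and `_≈_` for reals.
update-rename : ∀ {a b r} {A : Set a} {B : Set b} (R : A → B → Set r) {ι : ℕ → ℕ} →
  Injective _≡_ _≡_ ι → ∀ (M : ℕ → ℕ → A) (N : ℕ → ℕ → B) →
  (∀ a i → R (M (ι a) i) (N a i)) → ∀ d {i j x y} → i ≡ j → R x y →
  ∀ a k → R (update M (ι d) i x (ι a) k) (update N d j y a k)
update-rename R {ι} ι-inj M N MN d {i} {.i} {x} {y} ≡.refl Rxy a k with d ℕ.≟ a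
... | no d≢a = ≡.subst₂ R (≡.sym (update-array M i k (d≢a ∘ ι-inj))) (≡.sym (update-array N i k d≢a)) (MN a k)
... | yes ≡.refl with i ℕ.≟ k
... | yes ≡.refl = ≡.subst₂ R (≡.sym (update-here M (ι d) i)) (≡.sym (update-here N d i)) Rxy
... | no i≢k = ≡.subst₂ R (≡.sym (update-index M (ι d) i≢k)) (≡.sym (update-index N d i≢k)) (MN d k)

-- Renaming the arrays of a program

renameWord : (ℕ → ℕ) → WordExpr → WordExpr
renameWord ι (lit n)    = lit n
renameWord ι (cell a e) = cell (ι a) (renameWord ι e)
renameWord ι (op o d e) = op o (renameWord ι d) (renameWord ι e)

renameReal : (ℕ → ℕ) → RealExpr → RealExpr
renameReal ι (cast e)   = cast (renameWord ι e)
renameReal ι (cell a e) = cell (ι a) (renameWord ι e)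
renameReal ι (op o d e) = op o (renameReal ι d) (renameReal ι e)

renameTest : (ℕ → ℕ) → Test → Test
renameTest ι (wordLess d e) = wordLess (renameWord ι d) (renameWord ι e)
renameTest ι (realLess d e) = realLess (renameReal ι d) (renameReal ι e)

rename : (ℕ → ℕ) → Program → Program
rename ι skip               = skip
rename ι (assignWord a d e) = assignWord (ι a) (renameWord ι d) (renameWord ι e)
rename ι (assignReal a d e) = assignReal (ι a) (renameWord ι d) (renameReal ι e)
rename ι (divideReal a d e f) = divideReal (ι a) (renameWord ι d) (renameReal ι e) (renameReal ι f)
rename ι (P ∙ Q)            = rename ι P ∙ rename ι Q
rename ι (branch b P Q)     = branch (renameTest ι b) (rename ι P) (rename ι Q)
rename ι (while b P)        = while (renameTest ι b) (rename ι P)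

module Renaming {c ℓ} (ℝ : Reals c ℓ) (ι : ℕ → ℕ) (ι-inj : Injective _≡_ _≡_ ι) where

  open Reals ℝ
  open Over ℝ
  open Store
  open IsStrictPartialOrder isStrictPartialOrder using (<-respʳ-≈; <-respˡ-≈)

  -- Uniqueness of inverses. The apartness proofs may differ, as they do between a run and its
  -- renamed copy.
  recip-cong : ∀ {x y} (x#0 : x # 0#) (y#0 : y # 0#) → x ≈ y → recip x x#0 ≈ recip y y#0
  recip-cong {x} {y} x#0 y#0 x≈y = begin
    recip x x#0                     ≈⟨ *-identityʳ _ ⟨
    recip x x#0 * 1#                ≈⟨ *-congˡ (recip-inverse y y#0) ⟨
    recip x x#0 * (y * recip y y#0) ≈⟨ *-assoc _ _ _ ⟨
    (recip x x#0 * y) * recip y y#0 ≈⟨ *-congʳ (trans (*-comm _ _) (*-congʳ (sym x≈y))) ⟩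
    (x * recip x x#0) * recip y y#0 ≈⟨ *-congʳ (recip-inverse x x#0) ⟩
    1# * recip y y#0                ≈⟨ *-identityˡ _ ⟩
    recip y y#0                     ∎
    where open import Relation.Binary.Reasoning.Setoid setoid

  record _≲_ (τ σ : Store) : Set (c Level.⊔ ℓ) where
    constructor mk
    field
      words≲ : ∀ a i → words τ (ι a) i ≡ words σ a i
      reals≲ : ∀ a i → reals τ (ι a) i ≈ reals σ a i
  open _≲_

  -- The frame condition of a renamed run: whatever lies outside the image of `ι`, such as the step
  -- tables and the accumulator, survives it.
  record _≐_ (τ τ′ : Store) : Set c where
    constructor mk
    field
      words≐ : ∀ b → (∀ a → ι a ≢ b) → ∀ i → words τ′ b i ≡ words τ b i
      reals≐ : ∀ b → (∀ a → ι a ≢ b) → ∀ i → reals τ′ b i ≡ reals τ b i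
  open _≐_ public

  ≐-trans : ∀ {ρ σ τ} → ρ ≐ σ → σ ≐ τ → ρ ≐ τ
  ≐-trans p q = mk (λ b ∉ i → ≡.trans (words≐ q b ∉ i) (words≐ p b ∉ i))
                   (λ b ∉ i → ≡.trans (reals≐ q b ∉ i) (reals≐ p b ∉ i))

  module _ {τ σ} (s : τ ≲ σ) where

    evalWord-rename : ∀ e → evalWord (renameWord ι e) τ ≡ evalWord e σ
    evalWord-rename (lit n)    = ≡.refl
    evalWord-rename (cell a e) = ≡.trans (words≲ s a _) (≡.cong (words σ a) (evalWord-rename e))
    evalWord-rename (op o d e) = ≡.cong₂ (applyWord o) (evalWord-rename d) (evalWord-rename e)

    evalReal-rename : ∀ e → evalReal (renameReal ι e) τ ≈ evalReal e σ
    evalReal-rename (cast e)     = reflexive (≡.cong fromℕ (evalWord-rename e))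
    evalReal-rename (cell a e)   = trans (reals≲ s a _) (reflexive (≡.cong (reals σ a) (evalWord-rename e)))
    evalReal-rename (op add d e) = +-cong (evalReal-rename d) (evalReal-rename e)
    evalReal-rename (op sub d e) = +-cong (evalReal-rename d) (-‿cong (evalReal-rename e))
    evalReal-rename (op mul d e) = *-cong (evalReal-rename d) (evalReal-rename e)

    holds-rename : ∀ b → Holds b σ → Holds (renameTest ι b) τ
    holds-rename (wordLess d e) (lift h) = lift (≡.subst₂ ℕ._<_ (≡.sym (evalWord-rename d)) (≡.sym (evalWord-rename e)) h)
    holds-rename (realLess d e) h = <-respˡ-≈ (sym (evalReal-rename d)) (<-respʳ-≈ (sym (evalReal-rename e)) h)

    holds-unrename : ∀ b → Holds (renameTest ι b) τ → Holds b σ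
    holds-unrename (wordLess d e) (lift h) = lift (≡.subst₂ ℕ._<_ (evalWord-rename d) (evalWord-rename e) h)
    holds-unrename (realLess d e) h = <-respˡ-≈ (evalReal-rename d) (<-respʳ-≈ (evalReal-rename e) h)

    #-rename : ∀ e → evalReal e σ # 0# → evalReal (renameReal ι e) τ # 0#
    #-rename e (inj₁ e<0) = inj₁ (<-respˡ-≈ (sym (evalReal-rename e)) e<0)
    #-rename e (inj₂ 0<e) = inj₂ (<-respʳ-≈ (sym (evalReal-rename e)) 0<e)

  module _ {B B′ : ℕ} (B≤B′ : B ℕ.≤ B′) where

    bounded : ∀ {τ σ} → τ ≲ σ → ∀ e → evalWord e σ ℕ.≤ B → evalWord (renameWord ι e) τ ℕ.≤ B′
    bounded s e e≤B = ℕ.≤-trans (ℕ.≤-reflexive (evalWord-rename s e)) (ℕ.≤-trans e≤B B≤B′)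

    -- Corresponding tests agree, so the control flow and the number of steps are the same. The word
    -- bound enters a run only through upper bounds on stored words and addresses, so it may grow.
    run-rename : ∀ {P σ t σ′ τ} → τ ≲ σ → Run B P σ t σ′ →
      ∃[ τ′ ] Run B′ (rename ι P) τ t τ′ × τ′ ≲ σ′ × τ ≐ τ′
    run-rename s skip = _ , skip , s , mk (λ _ _ _ → ≡.refl) (λ _ _ _ → ≡.refl)
    run-rename {σ = σ} {τ = τ} s (assignWord {a = a} {d} {e} d≤B e≤B) =
      _ , assignWord (bounded s d d≤B) (bounded s e e≤B)
        , mk (update-rename _≡_ ι-inj (words τ) (words σ) (words≲ s) a (evalWord-rename s d) (evalWord-rename s e)) (reals≲ s)
        , mk (λ b ∉ i → update-array (words τ) (evalWord (renameWord ι d) τ) i (∉ a)) (λ _ _ _ → ≡.refl)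
    run-rename {σ = σ} {τ = τ} s (assignReal {a = a} {d} {e} d≤B) =
      _ , assignReal (bounded s d d≤B)
        , mk (words≲ s) (update-rename _≈_ ι-inj (reals τ) (reals σ) (reals≲ s) a (evalWord-rename s d) (evalReal-rename s e))
        , mk (λ _ _ _ → ≡.refl) (λ b ∉ i → update-array (reals τ) (evalWord (renameWord ι d) τ) i (∉ a))
    run-rename {σ = σ} {τ = τ} s (divideReal {a = a} {d} {e} {f} d≤B f#0) =
      _ , divideReal (bounded s d d≤B) (#-rename s f f#0)
        , mk (words≲ s) (update-rename _≈_ ι-inj (reals τ) (reals σ) (reals≲ s) a (evalWord-rename s d)
            (*-cong (evalReal-rename s e) (recip-cong _ _ (evalReal-rename s f))))
        , mk (λ _ _ _ → ≡.refl) (λ b ∉ i → update-array (reals τ) (evalWord (renameWord ι d) τ) i (∉ a))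
    run-rename s (seq r r′) with run-rename s r
    ... | _ , q , s₁ , p with run-rename s₁ r′
    ... | _ , q′ , s₂ , p′ = _ , seq q q′ , s₂ , ≐-trans p p′
    run-rename s (branch-true {b} h r) with run-rename s r
    ... | _ , q , s₁ , p = _ , branch-true (holds-rename s b h) q , s₁ , p
    run-rename s (branch-false {b} h r) with run-rename s r
    ... | _ , q , s₁ , p = _ , branch-false (h ∘ holds-unrename s b) q , s₁ , p
    run-rename s (while-true {b} h r r′) with run-rename s r
    ... | _ , q , s₁ , p with run-rename s₁ r′
    ... | _ , q′ , s₂ , p′ = _ , while-true (holds-rename s b h) q q′ , s₂ , ≐-trans p p′
    run-rename s (while-false {b} h) =
      _ , while-false (h ∘ holds-unrename s b) , s , mk (λ _ _ _ → ≡.refl) (λ _ _ _ → ≡.refl)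

-- Finite sums and products

cons : ∀ {m} {A : Fin (suc m) → Set a} → A zero → (∀ i → A (suc i)) → ∀ i → A i
cons x f zero    = x
cons x f (suc i) = f i

record Listing (A : Set a) : Set a where
  field
    size : ℕ
    at   : Fin size → A

open Listing public

fins : ∀ n → Listing (Fin n)
fins n = record { size = n ; at = id }

functions : ∀ m n → Listing (Fin m → Fin n)
functions m n = record { size = n ℕ.^ m ; at = finToFun }

infixr 2 _⊗_

_⊗_ : Listing A → Listing B → Listing (A × B)
L ⊗ M = record
  { size = size L ℕ.* size M
  ; at   = λ k → at L (quotient (size M) k) , at M (remainder {size L} (size M) k)
  }

Π : ∀ {m} {A : Fin m → Set a} → (∀ i → Listing (A i)) → Listing (∀ i → A i)
Π {m = zero}  L = record { size = 1 ; at = λ _ () }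
Π {m = suc m} L = record
  { size = size (L zero) ℕ.* size (Π (L ∘ suc))
  ; at   = λ k → cons (at (L zero) (quotient (size (Π (L ∘ suc))) k))
                      (at (Π (L ∘ suc)) (remainder {size (L zero)} (size (Π (L ∘ suc))) k))
  }

-- `at-index` makes the listing exhaustive and `index-at` together with `index-cong` makes it free
-- of repetitions. Both are relative to `_~_`, because functions are listed up to pointwise
-- equality.
record Enumerates {A : Set a} (L : Listing A) (_~_ : Rel A r) : Set (a ⊔ r) where
  field
    index      : A → Fin (size L)
    at-index   : ∀ x → at L (index x) ~ x
    index-at   : ∀ k → index (at L k) ≡ k
    index-cong : ∀ {x y} → x ~ y → index x ≡ index y

open Enumerates

fins-enumerates : ∀ n → Enumerates (fins n) _≡_
fins-enumerates n = record { index = id ; at-index = λ _ → ≡.refl ; index-at = λ _ → ≡.refl ; index-cong = id }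

funToFin-cong : ∀ {m n} {f g : Fin m → Fin n} → f ≗ g → funToFin f ≡ funToFin g
funToFin-cong {zero}  f≗g = ≡.refl
funToFin-cong {suc m} f≗g = ≡.cong₂ combine (f≗g zero) (funToFin-cong (f≗g ∘ suc))

functions-enumerates : ∀ m n → Enumerates (functions m n) _≗_
functions-enumerates m n = record
  { index      = funToFin
  ; at-index   = Fin.finToFun-funToFin
  ; index-at   = Fin.funToFin-finToFin {m} {n}
  ; index-cong = funToFin-cong
  }

⊗-enumerates : {L : Listing A} {M : Listing B} {_~_ : Rel A p} {_~′_ : Rel B q} →
  Enumerates L _~_ → Enumerates M _~′_ →
  Enumerates (L ⊗ M) (λ x y → proj₁ x ~ proj₁ y × proj₂ x ~′ proj₂ y)
⊗-enumerates {L = L} {M} {_~_} {_~′_} eL eM = record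
  { index      = λ (x , y) → combine (index eL x) (index eM y)
  ; at-index   = λ (x , y) → ≡.subst (λ (i , j) → at L i ~ x × at M j ~′ y)
      (≡.sym (Fin.remQuot-combine (index eL x) (index eM y))) (at-index eL x , at-index eM y)
  ; index-at   = λ k → ≡.trans (≡.cong₂ combine (index-at eL _) (index-at eM _)) (Fin.combine-remQuot {size L} (size M) k)
  ; index-cong = λ (p , q) → ≡.cong₂ combine (index-cong eL p) (index-cong eM q)
  }

Π-enumerates : ∀ {m} {A : Fin m → Set a} {L : ∀ i → Listing (A i)} {_~_ : ∀ {i} → Rel (A i) r} →
  (∀ i → Enumerates (L i) _~_) → Enumerates (Π L) (λ f g → ∀ i → f i ~ g i)
Π-enumerates {m = zero} e = record
  { index = λ _ → zero ; at-index = λ _ () ; index-at = λ { zero → ≡.refl } ; index-cong = λ _ → ≡.refl }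
Π-enumerates {m = suc m} {A} {L} {_~_} e = record
  { index      = λ f → combine (index (e zero) (f zero)) (index e′ (f ∘ suc))
  ; at-index   = λ f → ≡.subst (λ (j , k) → ∀ i → cons {A = A} (at (L zero) j) (at (Π (L ∘ suc)) k) i ~ f i)
      (≡.sym (Fin.remQuot-combine (index (e zero) (f zero)) (index e′ (f ∘ suc))))
      (λ { zero → at-index (e zero) (f zero) ; (suc i) → at-index e′ (f ∘ suc) i })
  ; index-at   = λ k → ≡.trans (≡.cong₂ combine (index-at (e zero) _) (index-at e′ _))
      (Fin.combine-remQuot {size (L zero)} (size (Π (L ∘ suc))) k)
  ; index-cong = λ f~g → ≡.cong₂ combine (index-cong (e zero) (f~g zero)) (index-cong e′ (f~g ∘ suc))
  }
  where e′ = Π-enumerates {_~_ = _~_} (e ∘ suc)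

-- Pigeonhole: if some `y` were missed, punching it out would inject `Fin n` into a set with one
-- element fewer. The equation `0 ≡ 1` in `avoid` stands for absurdity.
injective⇒permutation : ∀ {n} (s : Fin n → Fin n) → Injective _≡_ _≡_ s → ∃[ π ] (∀ i → π ⟨$⟩ʳ i ≡ s i)
injective⇒permutation {n} s s-inj =
  permutation s s⁻¹ (proj₂ ∘ preimage) (λ i → s-inj (proj₂ (preimage (s i)))) , λ _ → ≡.refl
  where
  preimage : ∀ y → ∃[ x ] s x ≡ y
  preimage y with Fin.any? (λ x → s x Fin.≟ y)
  ... | yes found = found
  ... | no missed = contradiction (avoid n s s-inj y λ x sx≡y → missed (x , sx≡y)) λ ()
    where
    avoid : ∀ n (s : Fin n → Fin n) → Injective _≡_ _≡_ s → ∀ y → (∀ x → s x ≢ y) → 0 ≡ 1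
    avoid (suc n) s s-inj y s≢y = contradiction
      (Fin.injective⇒≤ {f = λ x → punchOut (s≢y x ∘ ≡.sym)} (λ {i} {j} eq → s-inj (Fin.punchOut-injective (s≢y i ∘ ≡.sym) (s≢y j ∘ ≡.sym) eq))) ℕ.1+n≰n

  s⁻¹ : Fin n → Fin n
  s⁻¹ = proj₁ ∘ preimage

module Sums {c ℓ} (R : CommutativeRing c ℓ) where

  open CommutativeRing R hiding (zero)
  private
    module S = SemiringSum semiring
    module P = CommutativeMonoidSum *-commutativeMonoid
  open RawMonoidDefinitions +-rawMonoid using () renaming (_×_ to _·_)
  open import Relation.Binary.Reasoning.Setoid setoid

  ⟦_⟧ : {P : Set p} → Dec P → Carrier
  ⟦ P? ⟧ = if does P? then 1# else 0#

  ⟦⟧-true : {P : Set p} (P? : Dec P) → P → ⟦ P? ⟧ ≈ 1#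
  ⟦⟧-true (yes _) _ = refl
  ⟦⟧-true (no ¬p) p = contradiction p ¬p

  ⟦⟧-false : {P : Set p} (P? : Dec P) → ¬ P → ⟦ P? ⟧ ≈ 0#
  ⟦⟧-false (yes p) ¬p = contradiction p ¬p
  ⟦⟧-false (no _)  _  = refl

  ⟦⟧-cong : {P : Set p} {Q : Set q} (P? : Dec P) (Q? : Dec Q) → (P → Q) → (Q → P) → ⟦ P? ⟧ ≈ ⟦ Q? ⟧
  ⟦⟧-cong (yes p) Q? to from = sym (⟦⟧-true Q? (to p))
  ⟦⟧-cong (no ¬p) Q? to from = sym (⟦⟧-false Q? (¬p ∘ from))

  ⟦⟧-× : {P : Set p} {Q : Set q} {PQ : Set r} (P? : Dec P) (Q? : Dec Q) (PQ? : Dec PQ) →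
    (PQ → P × Q) → (P → Q → PQ) → ⟦ PQ? ⟧ ≈ ⟦ P? ⟧ * ⟦ Q? ⟧
  ⟦⟧-× (yes x) Q? PQ? to from = trans (⟦⟧-cong PQ? Q? (proj₂ ∘ to) (from x)) (sym (*-identityˡ _))
  ⟦⟧-× (no ¬p) Q? PQ? to from = trans (⟦⟧-false PQ? (¬p ∘ proj₁ ∘ to)) (sym (zeroˡ _))

  opaque
    ∏ : ∀ {n} → (Fin n → Carrier) → Carrier
    ∏ = P.sum

    ∏-zero : ∀ (f : Fin 0 → Carrier) → ∏ f ≈ 1#
    ∏-zero f = refl

    ∏-suc : ∀ {n} (f : Fin (suc n) → Carrier) → ∏ f ≈ f zero * ∏ (f ∘ suc)
    ∏-suc f = refl

    ∏-cong : ∀ {n} {f g : Fin n → Carrier} → (∀ i → f i ≈ g i) → ∏ f ≈ ∏ g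
    ∏-cong = P.sum-cong-≋

    ∏-distrib-* : ∀ {n} (f g : Fin n → Carrier) → ∏ (λ i → f i * g i) ≈ ∏ f * ∏ g
    ∏-distrib-* = P.∑-distrib-+

    ∏-permute : ∀ {m n} (f : Fin n → Carrier) (π : Permutation m n) → ∏ f ≈ ∏ (f ∘ (π ⟨$⟩ʳ_))
    ∏-permute = P.sum-permute

    foldr-∏ : ∀ (xs : List A) (w : A → Carrier) → foldr _*_ 1# (map w xs) ≈ ∏ (w ∘ lookup xs)
    foldr-∏ []       w = refl
    foldr-∏ (x ∷ xs) w = *-congˡ (foldr-∏ xs w)

  ∏-one : ∀ {n} {f : Fin n → Carrier} → (∀ i → f i ≈ 1#) → ∏ f ≈ 1#
  ∏-one {zero}  f≈1 = ∏-zero _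
  ∏-one {suc n} f≈1 = trans (∏-suc _) (trans (*-cong (f≈1 zero) (∏-one (f≈1 ∘ suc))) (*-identityˡ 1#))

  -- `Q` is separate from the family `P` because homomorphisms are decided over pairs of vertices,
  -- while the sums need one factor for each edge.
  ⟦⟧-∀ : ∀ {m} {P : Fin m → Set p} {Q : Set q} (P? : ∀ i → Dec (P i)) (Q? : Dec Q) →
    (Q → ∀ i → P i) → ((∀ i → P i) → Q) → ⟦ Q? ⟧ ≈ ∏ (λ i → ⟦ P? i ⟧)
  ⟦⟧-∀ {m = zero}  P? Q? to from = trans (⟦⟧-true Q? (from λ ())) (sym (∏-zero _))
  ⟦⟧-∀ {m = suc m} P? Q? to from = trans
    (⟦⟧-× (P? zero) (Fin.all? (P? ∘ suc)) Q? (λ x → to x zero , to x ∘ suc)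
      (λ p ps → from λ { zero → p ; (suc i) → ps i }))
    (trans (*-congˡ (⟦⟧-∀ (P? ∘ suc) (Fin.all? (P? ∘ suc)) id id)) (sym (∏-suc _)))

  opaque
    ∑ : Listing A → (A → Carrier) → Carrier
    ∑ L f = S.sum (f ∘ at L)

    ∑-cong : ∀ {L : Listing A} {f g} → (∀ x → f x ≈ g x) → ∑ L f ≈ ∑ L g
    ∑-cong {L = L} f≈g = S.sum-cong-≋ (f≈g ∘ at L)

    ∑-zero : ∀ {L : Listing A} {f} → (∀ x → f x ≈ 0#) → ∑ L f ≈ 0#
    ∑-zero {L = L} f≈0 = trans (S.sum-cong-≋ (f≈0 ∘ at L)) (S.sum-replicate-zero (size L))

    ∑-comm : ∀ {L : Listing A} {M : Listing B} (f : A → B → Carrier) →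
      ∑ L (λ x → ∑ M (f x)) ≈ ∑ M (λ y → ∑ L (λ x → f x y))
    ∑-comm {L = L} {M} f = S.∑-comm (λ i j → f (at L i) (at M j))

    ∑-distribˡ : ∀ {L : Listing A} x (f : A → Carrier) → x * ∑ L f ≈ ∑ L (λ y → x * f y)
    ∑-distribˡ {L = L} x f = S.*-distribˡ-sum x (f ∘ at L)

    ∑-distribʳ : ∀ {L : Listing A} x (f : A → Carrier) → ∑ L f * x ≈ ∑ L (λ y → f y * x)
    ∑-distribʳ {L = L} x f = S.*-distribʳ-sum x (f ∘ at L)

    ∑-distrib-+ : ∀ {L : Listing A} (f g : A → Carrier) → ∑ L (λ x → f x + g x) ≈ ∑ L f + ∑ L g
    ∑-distrib-+ {L = L} f g = S.∑-distrib-+ (f ∘ at L) (g ∘ at L)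

    ∑-fins-zero : ∀ (f : Fin 0 → Carrier) → ∑ (fins 0) f ≈ 0#
    ∑-fins-zero f = refl

    ∑-fins-suc : ∀ {n} (f : Fin (suc n) → Carrier) → ∑ (fins (suc n)) f ≈ f zero + ∑ (fins n) (f ∘ suc)
    ∑-fins-suc f = refl

    ∑-at : ∀ (L : Listing A) f → ∑ L f ≈ ∑ (fins (size L)) (f ∘ at L)
    ∑-at L f = refl

    ∑-Π-zero : ∀ {A : Fin 0 → Set a} (L : ∀ i → Listing (A i)) f → ∑ (Π L) f ≈ f (λ ())
    ∑-Π-zero L f = +-identityʳ (f (λ ()))

    private
      sum-+ : ∀ m {n} (f : Fin (m ℕ.+ n) → Carrier) → S.sum f ≈ S.sum (f ∘ (_↑ˡ n)) + S.sum (f ∘ (m ↑ʳ_))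
      sum-+ zero    f = sym (+-identityˡ _)
      sum-+ (suc m) f = trans (+-congˡ (sum-+ m (f ∘ suc))) (sym (+-assoc _ _ _))

      sum-combine : ∀ m {n} (f : Fin (m ℕ.* n) → Carrier) → S.sum f ≈ S.sum (λ i → S.sum (λ j → f (combine {m} i j)))
      sum-combine zero        f = refl
      sum-combine (suc m) {n} f = trans (sum-+ n f) (+-congˡ (sum-combine m (f ∘ (n ↑ʳ_))))

    ∑-⊗ : ∀ (L : Listing A) (M : Listing B) f → ∑ (L ⊗ M) f ≈ ∑ L (λ x → ∑ M (λ y → f (x , y)))
    ∑-⊗ L M f = trans (sum-combine (size L) _) (S.sum-cong-≋ λ i → S.sum-cong-≋ λ j →
      reflexive (≡.cong (λ (i , j) → f (at L i , at M j)) (Fin.remQuot-combine i j)))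

    ∑-Π : ∀ {m} {A : Fin (suc m) → Set a} (L : ∀ i → Listing (A i)) f →
      ∑ (Π L) f ≈ ∑ (L zero) (λ x → ∑ (Π (L ∘ suc)) (λ g → f (cons x g)))
    ∑-Π L f = trans (sum-combine (size (L zero)) _) (S.sum-cong-≋ λ i → S.sum-cong-≋ λ j →
      reflexive (≡.cong (λ (i , j) → f (cons (at (L zero) i) (at (Π (L ∘ suc)) j))) (Fin.remQuot-combine i j)))

    -- `to` and `from` need to be inverse only up to the two relations; conjugated with the indices
    -- they form a genuine permutation.
    ∑-reindex : {L : Listing A} {M : Listing B} {_~_ : Rel A p} {_~′_ : Rel B q} →
      Enumerates L _~_ → Enumerates M _~′_ → (to : A → B) (from : B → A) →
      (∀ {x y} → x ~ y → to x ~′ to y) → (∀ {x y} → x ~′ y → from x ~ from y) →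
      (∀ x → from (to x) ~ x) → (∀ y → to (from y) ~′ y) →
      {f : A → Carrier} {g : B → Carrier} → (∀ {x y} → x ~′ y → g x ≈ g y) → (∀ x → f x ≈ g (to x)) →
      ∑ L f ≈ ∑ M g
    ∑-reindex {L = L} {M} eL eM to from to-cong from-cong from-to to-from {f} {g} g-cong f≈g = begin
      S.sum (f ∘ at L)                        ≈⟨ S.sum-cong-≋ (λ i → f≈g (at L i)) ⟩
      S.sum (g ∘ to ∘ at L)                   ≈⟨ S.sum-cong-≋ (λ i → g-cong (at-index eM (to (at L i)))) ⟨
      S.sum (g ∘ at M ∘ index eM ∘ to ∘ at L) ≈⟨ S.sum-permute (g ∘ at M) π ⟨
      S.sum (g ∘ at M)                        ∎
      where
      π : Permutation (size L) (size M)
      π = permutation (index eM ∘ to ∘ at L) (index eL ∘ from ∘ at M)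
        (λ j → ≡.trans (index-cong eM (to-cong (at-index eL (from (at M j)))))
          (≡.trans (index-cong eM (to-from (at M j))) (index-at eM j)))
        (λ i → ≡.trans (index-cong eL (from-cong (at-index eM (to (at L i)))))
          (≡.trans (index-cong eL (from-to (at L i))) (index-at eL i)))

    foldr-∑ : ∀ (w : A → Carrier) (L : Listing A) →
      foldr _+_ 0# (map w (map (at L) (allFin (size L)))) ≈ ∑ L w
    foldr-∑ w L = trans (reflexive (≡.cong (foldr _+_ 0# ∘ map w) (map-tabulate id (at L)))) (tabulated (at L))
      where
      tabulated : ∀ {n} (g : Fin n → _) → foldr _+_ 0# (map w (tabulate g)) ≈ S.sum (w ∘ g)
      tabulated {zero}  g = refl
      tabulated {suc n} g = +-congˡ (tabulated (g ∘ suc))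

  ∑-δ : ∀ {n} (i : Fin n) (f : Fin n → Carrier) → ∑ (fins n) (λ j → ⟦ i Fin.≟ j ⟧ * f j) ≈ f i
  ∑-δ zero f = trans (∑-fins-suc _) (trans (+-cong (*-identityˡ _) (∑-zero (λ j → zeroˡ _))) (+-identityʳ _))
  ∑-δ (suc i) f = trans (∑-fins-suc _) (trans (+-cong (zeroˡ _)
    (∑-cong λ j → *-congʳ (⟦⟧-cong (suc i Fin.≟ suc j) (i Fin.≟ j) Fin.suc-injective (≡.cong suc))))
    (trans (+-identityˡ _) (∑-δ i (f ∘ suc))))

  ∑-Π-∏ : ∀ {m} {A : Fin m → Set a} (L : ∀ i → Listing (A i)) (f : ∀ i → A i → Carrier) →
    ∑ (Π L) (λ g → ∏ (λ i → f i (g i))) ≈ ∏ (λ i → ∑ (L i) (f i))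
  ∑-Π-∏ {m = zero}  L f = trans (∑-Π-zero L _) (trans (∏-zero _) (sym (∏-zero _)))
  ∑-Π-∏ {m = suc m} {A} L f = begin
    ∑ (Π L) (λ g → ∏ (λ i → f i (g i)))
      ≈⟨ ∑-Π L _ ⟩
    ∑ (L zero) (λ x → ∑ (Π (L ∘ suc)) (λ g → ∏ (λ i → f i (cons {A = A} x g i))))
      ≈⟨ (∑-cong λ x → ∑-cong λ g → ∏-suc _) ⟩
    ∑ (L zero) (λ x → ∑ (Π (L ∘ suc)) (λ g → f zero x * ∏ (λ i → f (suc i) (g i))))
      ≈⟨ (∑-cong λ x → ∑-distribˡ (f zero x) _) ⟨
    ∑ (L zero) (λ x → f zero x * ∑ (Π (L ∘ suc)) (λ g → ∏ (λ i → f (suc i) (g i))))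
      ≈⟨ ∑-distribʳ _ _ ⟨
    ∑ (L zero) (f zero) * ∑ (Π (L ∘ suc)) (λ g → ∏ (λ i → f (suc i) (g i)))
      ≈⟨ *-congˡ (∑-Π-∏ (L ∘ suc) (f ∘ suc)) ⟩
    ∑ (L zero) (f zero) * ∏ (λ i → ∑ (L (suc i)) (f (suc i)))
      ≈⟨ ∏-suc _ ⟨
    ∏ (λ i → ∑ (L i) (f i)) ∎

  ∑-cancel : ∀ (L : Listing A) (γ f : A → Carrier) → ∑ L γ ≈ 0# → (∀ x y → f x ≈ f y) → ∑ L (λ x → γ x * f x) ≈ 0#
  ∑-cancel L γ f γ≈0 constant = trans (∑-at L _) (go (at L) (trans (sym (∑-at L γ)) γ≈0))
    where
    go : ∀ {n} (g : Fin n → _) → ∑ (fins n) (γ ∘ g) ≈ 0# → ∑ (fins n) (λ i → γ (g i) * f (g i)) ≈ 0#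
    go {zero}  g γ≈0 = ∑-fins-zero _
    go {suc n} g γ≈0 = begin
      ∑ (fins (suc n)) (λ i → γ (g i) * f (g i))    ≈⟨ (∑-cong λ i → *-congˡ (constant (g i) (g zero))) ⟩
      ∑ (fins (suc n)) (λ i → γ (g i) * f (g zero)) ≈⟨ ∑-distribʳ (f (g zero)) (γ ∘ g) ⟨
      ∑ (fins (suc n)) (γ ∘ g) * f (g zero)         ≈⟨ *-congʳ γ≈0 ⟩
      0# * f (g zero)                               ≈⟨ zeroˡ _ ⟩
      0#                                            ∎

  -- Since `F` ignores coordinate `j`, summing over that coordinate first splits off the factor
  -- `∑ (L j) (γ j)`, which vanishes. This is how a sign that nobody reads annihilates a whole term.
  ∑-Π-cancel : ∀ {m} {A : Fin m → Set a} (L : ∀ i → Listing (A i)) (γ : ∀ i → A i → Carrier)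
    (F : (∀ i → A i) → Carrier) j → ∑ (L j) (γ j) ≈ 0# →
    (∀ g g′ → (∀ i → i ≢ j → g i ≡ g′ i) → F g ≈ F g′) →
    ∑ (Π L) (λ g → ∏ (λ i → γ i (g i)) * F g) ≈ 0#
  ∑-Π-cancel {m = suc m} {A} L γ F zero γ≈0 indep = begin
    ∑ (Π L) (λ g → ∏ (λ i → γ i (g i)) * F g)
      ≈⟨ ∑-Π L _ ⟩
    ∑ (L zero) (λ x → ∑ (Π (L ∘ suc)) (λ g → ∏ (λ i → γ i (cons {A = A} x g i)) * F (cons x g)))
      ≈⟨ ∑-comm _ ⟩
    ∑ (Π (L ∘ suc)) (λ g → ∑ (L zero) (λ x → ∏ (λ i → γ i (cons {A = A} x g i)) * F (cons x g)))
      ≈⟨ (∑-cong λ g → ∑-cong λ x → trans (*-congʳ (∏-suc _)) (*-assoc _ _ _)) ⟩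
    ∑ (Π (L ∘ suc)) (λ g → ∑ (L zero) (λ x → γ zero x * (∏ (λ i → γ (suc i) (g i)) * F (cons x g))))
      ≈⟨ (∑-zero λ g → ∑-cancel (L zero) (γ zero) _ γ≈0 λ x y → *-congˡ (indep (cons x g) (cons y g)
          λ { zero i≢i → contradiction ≡.refl i≢i ; (suc _) _ → ≡.refl })) ⟩
    0# ∎
  ∑-Π-cancel {m = suc m} {A} L γ F (suc j) γ≈0 indep = begin
    ∑ (Π L) (λ g → ∏ (λ i → γ i (g i)) * F g)
      ≈⟨ ∑-Π L _ ⟩
    ∑ (L zero) (λ x → ∑ (Π (L ∘ suc)) (λ g → ∏ (λ i → γ i (cons {A = A} x g i)) * F (cons x g)))
      ≈⟨ (∑-cong λ x → ∑-cong λ g → trans (*-congʳ (∏-suc _)) (*-assoc _ _ _)) ⟩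
    ∑ (L zero) (λ x → ∑ (Π (L ∘ suc)) (λ g → γ zero x * (∏ (λ i → γ (suc i) (g i)) * F (cons x g))))
      ≈⟨ (∑-cong λ x → ∑-distribˡ (γ zero x) _) ⟨
    ∑ (L zero) (λ x → γ zero x * ∑ (Π (L ∘ suc)) (λ g → ∏ (λ i → γ (suc i) (g i)) * F (cons x g)))
      ≈⟨ (∑-zero λ x → trans (*-congˡ (∑-Π-cancel (L ∘ suc) (γ ∘ suc) (F ∘ cons x) j γ≈0 λ g g′ g≡g′ →
          indep (cons x g) (cons x g′) λ { zero _ → ≡.refl ; (suc i) i≢j → g≡g′ i (i≢j ∘ ≡.cong suc) })) (zeroʳ _)) ⟩
    0# ∎

  foldr-filter : ∀ {P : A → Set p} (P? : ∀ x → Dec (P x)) (w : A → Carrier) xs →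
    foldr _+_ 0# (map w (filter P? xs)) ≈ foldr _+_ 0# (map (λ x → ⟦ P? x ⟧ * w x) xs)
  foldr-filter P? w []       = refl
  foldr-filter P? w (x ∷ xs) with P? x
  ... | yes _ = +-cong (sym (*-identityˡ _)) (foldr-filter P? w xs)
  ... | no  _ = trans (foldr-filter P? w xs) (sym (trans (+-congʳ (zeroˡ _)) (+-identityˡ _)))

  sum-filter : ∀ {P : A → Set p} (P? : ∀ x → Dec (P x)) (w : A → Carrier) (L : Listing A) →
    foldr _+_ 0# (map w (filter P? (map (at L) (allFin (size L))))) ≈ ∑ L (λ x → ⟦ P? x ⟧ * w x)
  sum-filter P? w L = trans (foldr-filter P? w (map (at L) (allFin (size L)))) (foldr-∑ _ L)

  length-as-sum : ∀ (xs : List A) → length xs · 1# ≈ foldr _+_ 0# (map (λ _ → 1#) xs)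
  length-as-sum []       = refl
  length-as-sum (x ∷ xs) = +-congˡ (length-as-sum xs)

  count-filter : ∀ {P : A → Set p} (P? : ∀ x → Dec (P x)) (L : Listing A) →
    length (filter P? (map (at L) (allFin (size L)))) · 1# ≈ ∑ L (λ x → ⟦ P? x ⟧)
  count-filter P? L = trans (length-as-sum (filter P? (map (at L) (allFin (size L)))))
    (trans (sum-filter P? (λ _ → 1#) L) (∑-cong λ x → *-identityʳ _))

-- Walks and homomorphisms from subdivisions

unique⇒lookup-injective : ∀ {xs : List A} → Unique xs → ∀ i j → lookup xs i ≡ lookup xs j → i ≡ j
unique⇒lookup-injective (_ ∷ _)      zero    zero    _  = ≡.refl
unique⇒lookup-injective (x∉xs ∷ _)   zero    (suc j) eq = contradiction eq (All.lookup x∉xs (∈-lookup j))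
unique⇒lookup-injective (x∉xs ∷ _)   (suc i) zero    eq = contradiction (≡.sym eq) (All.lookup x∉xs (∈-lookup i))
unique⇒lookup-injective (_ ∷ unique) (suc i) (suc j) eq = ≡.cong suc (unique⇒lookup-injective unique i j eq)

module _ (G : Digraph) where

  edge⇒∈edges : ∀ {u v} → Edge G u v → (u , v) ∈ edges G
  edge⇒∈edges {u} uv = ∈-concatMap⁺ (λ u → map (u ,_) (adj G u)) (lose (∈-allFin u) (∈-map⁺ (u ,_) uv))

  ∈edges⇒edge : ∀ {u v} → (u , v) ∈ edges G → Edge G u v
  ∈edges⇒edge uv∈ with find (∈-concatMap⁻ (λ u → map (u ,_) (adj G u)) {xs = allFin (order G)} uv∈)
  ... | u , _ , uv∈′ with ∈-map⁻ (u ,_) uv∈′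
  ... | _ , v∈ , ≡.refl = v∈

  edgeIndex : ∀ {u v} → Edge G u v → ∃[ i ] lookup (edges G) i ≡ (u , v)
  edgeIndex uv = Any.index (edge⇒∈edges uv) , ≡.sym (Any.lookup-index (edge⇒∈edges uv))

  edge-at : ∀ i → Edge G (tailOf G i) (headOf G i)
  edge-at i = ∈edges⇒edge (∈-lookup i)

  edges-unique : Unique (edges G)
  edges-unique = Unique.concat⁺
    (All.map⁺ (All.tabulate λ {u} _ → Unique.map⁺ (λ { ≡.refl → ≡.refl }) (adj-unique G u)))
    (AllPairs.map⁺ (AllPairs.map disjoint (Unique.allFin⁺ (order G))))
    where
    disjoint : ∀ {u u′} → u ≢ u′ → ∀ {e} → ¬ (e ∈ map (u ,_) (adj G u) × e ∈ map (u′ ,_) (adj G u′))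
    disjoint {u} {u′} u≢u′ (e∈ , e∈′) with ∈-map⁻ (u ,_) e∈ | ∈-map⁻ (u′ ,_) e∈′
    ... | _ , _ , ≡.refl | _ , _ , eq = u≢u′ (≡.cong proj₁ eq)

  edge-≡ : ∀ {i j} → tailOf G i ≡ tailOf G j → headOf G i ≡ headOf G j → i ≡ j
  edge-≡ {i} {j} t h = unique⇒lookup-injective edges-unique i j (≡.cong₂ _,_ t h)

isHom⇔ : ∀ H G φ → IsHom H G φ ⇔ (∀ i → Edge G (φ (tailOf H i)) (φ (headOf H i)))
isHom⇔ H G φ = mk⇔ (λ hom i → hom _ _ (edge-at H i)) λ hom u v uv →
  let i , eq = edgeIndex H uv in ≡.subst (λ (u , v) → Edge G (φ u) (φ v)) eq (hom i)

-- Walks are traced in Fin (1 + n): zero is the outcome of a step along a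
-- missing out-edge, and suc v stands for the vertex v.

pick : ∀ {n} → List (Fin n) → ℕ → Fin (suc n)
pick []       _       = zero
pick (x ∷ xs) zero    = suc x
pick (x ∷ xs) (suc c) = pick xs c

step : ∀ G → ℕ → Fin (suc (order G)) → Fin (suc (order G))
step G c zero    = zero
step G c (suc u) = pick (adj G u) c

follow : ∀ G {κ k} → (Fin k → Fin κ) → Fin (suc (order G)) → Fin (suc (order G))
follow G {k = zero}  w x = x
follow G {k = suc k} w x = follow G (w ∘ suc) (step G (toℕ (w zero)) x)

follow-zero : ∀ G {κ k} (w : Fin k → Fin κ) → follow G w zero ≡ zero
follow-zero G {k = zero}  w = ≡.refl
follow-zero G {k = suc k} w = follow-zero G (w ∘ suc)

-- The label (false , w) forbids all walks; w is kept so that it cancels (true , w).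
Label : ℕ → ℕ → Set
Label κ k = Bool × (Fin (suc k) → Fin κ)

walkEnd : ∀ G {κ k} → Label κ k → Fin (suc (order G)) → Fin (suc (order G))
walkEnd G (true  , w) = follow G w
walkEnd G (false , w) = λ _ → zero

bools : Listing Bool
bools = record { size = 2 ; at = cons true (λ _ → false) }

tuples : ∀ κ k → Listing (Fin k → Fin κ)
tuples κ k = Π (λ _ → fins κ)

labels : ∀ κ k → Listing (Label κ k)
labels κ k = bools ⊗ tuples κ (suc k)

-- `k` counts the internal vertices, so a chain has `suc k` edges, as many as the words in
-- `Label κ k` have letters. The recursion consumes the first edge, in step with `follow`.
Chain : ∀ G {k} → Vertex G → (Fin k → Vertex G) → Vertex G → Set
Chain G {zero}  u y v = Edge G u v
Chain G {suc k} u y v = Edge G u (y zero) × Chain G (y zero) (y ∘ suc) v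

chain? : ∀ G {k} u (y : Fin k → Vertex G) v → Dec (Chain G u y v)
chain? G {zero}  u y v = edge? G u v
chain? G {suc k} u y v = edge? G u (y zero) ×-dec chain? G (y zero) (y ∘ suc) v

Chain-cong : ∀ G {k u u′ v v′} {y y′ : Fin k → Vertex G} → u ≡ u′ → y ≗ y′ → v ≡ v′ → Chain G u y v → Chain G u′ y′ v′
Chain-cong G {zero}  ≡.refl y≗y′ ≡.refl e = e
Chain-cong G {suc k} ≡.refl y≗y′ ≡.refl (e , c) =
  ≡.subst (Edge G _) (y≗y′ zero) e , Chain-cong G (y≗y′ zero) (y≗y′ ∘ suc) ≡.refl c

chain⇔ : ∀ G {A : Set} (φ : A → Vertex G) {k} a (y : Fin k → A) b →
  Chain G (φ a) (φ ∘ y) (φ b) ⇔ (∀ p q → (p , q) ∈ consecutive (a ∷ tabulate y ++ b ∷ []) → Edge G (φ p) (φ q))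
chain⇔ G φ {k} a y b = mk⇔ (to a y) (from a y)
  where
  to : ∀ {k} a (y : Fin k → _) → Chain G (φ a) (φ ∘ y) (φ b) →
    ∀ p q → (p , q) ∈ consecutive (a ∷ tabulate y ++ b ∷ []) → Edge G (φ p) (φ q)
  to {zero}  a y e       p q (here ≡.refl) = e
  to {suc k} a y (e , c) p q (here ≡.refl) = e
  to {suc k} a y (e , c) p q (there pq∈)   = to (y zero) (y ∘ suc) c p q pq∈

  from : ∀ {k} a (y : Fin k → _) →
    (∀ p q → (p , q) ∈ consecutive (a ∷ tabulate y ++ b ∷ []) → Edge G (φ p) (φ q)) → Chain G (φ a) (φ ∘ y) (φ b)
  from {zero}  a y es = es _ _ (here ≡.refl)
  from {suc k} a y es = es _ _ (here ≡.refl) , from (y zero) (y ∘ suc) (λ p q → es p q ∘ there)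

module Walks {c ℓ} (ℝ : Reals c ℓ) where

  open Reals ℝ hiding (zero)
  open Sums commutativeRing
  open import Relation.Binary.Reasoning.Setoid setoid

  sign : Bool → Carrier
  sign true  = 1#
  sign false = - 1#

  ∑-bools : ∀ f → ∑ bools f ≈ f true + f false
  ∑-bools f = trans (∑-at bools f) (trans (∑-fins-suc _) (+-congˡ
    (trans (∑-fins-suc _) (trans (+-congˡ (∑-fins-zero _)) (+-identityʳ _)))))

  ∑-sign : ∀ κ k → ∑ (labels κ k) (sign ∘ proj₁) ≈ 0#
  ∑-sign κ k = begin
    ∑ (labels κ k) (sign ∘ proj₁)                            ≈⟨ ∑-⊗ bools (tuples κ (suc k)) _ ⟩
    ∑ bools (λ b → ∑ (tuples κ (suc k)) (λ _ → sign b))       ≈⟨ ∑-comm _ ⟩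
    ∑ (tuples κ (suc k)) (λ _ → ∑ bools sign)                 ≈⟨ (∑-zero λ _ → trans (∑-bools sign) (-‿inverseʳ 1#)) ⟩
    0#                                                       ∎

  -- Each out-neighbour stands at exactly one position because the list is duplicate-free, and all
  -- positions fit below `κ`. The positions past the end of the list contribute `F zero`, that is,
  -- nothing.
  ∑-pick : ∀ {n κ} (xs : List (Fin n)) → Unique xs → length xs ℕ.≤ κ → (mem? : ∀ v → Dec (v ∈ xs)) →
    (F : Fin (suc n) → Carrier) → F zero ≈ 0# →
    ∑ (fins κ) (λ c → F (pick xs (toℕ c))) ≈ ∑ (fins n) (λ v → ⟦ mem? v ⟧ * F (suc v))
  ∑-pick [] _ _ mem? F F0≈0 = trans (∑-zero λ _ → F0≈0)
    (sym (∑-zero λ v → trans (*-congʳ (⟦⟧-false (mem? v) λ ())) (zeroˡ _)))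
  ∑-pick {n} {suc κ} (x ∷ xs) (x∉xs ∷ unique) (s≤s len) mem? F F0≈0 = begin
    ∑ (fins (suc κ)) (λ c → F (pick (x ∷ xs) (toℕ c)))
      ≈⟨ ∑-fins-suc _ ⟩
    F (suc x) + ∑ (fins κ) (λ c → F (pick xs (toℕ c)))
      ≈⟨ +-cong (sym (∑-δ x (F ∘ suc))) (∑-pick xs unique len (λ v → v ∈? xs) F F0≈0) ⟩
    ∑ (fins n) (λ v → ⟦ x Fin.≟ v ⟧ * F (suc v)) + ∑ (fins n) (λ v → ⟦ v ∈? xs ⟧ * F (suc v))
      ≈⟨ ∑-distrib-+ _ _ ⟨
    ∑ (fins n) (λ v → ⟦ x Fin.≟ v ⟧ * F (suc v) + ⟦ v ∈? xs ⟧ * F (suc v))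
      ≈⟨ (∑-cong λ v → trans (sym (distribʳ _ _ _)) (*-congʳ (disjoint v))) ⟩
    ∑ (fins n) (λ v → ⟦ mem? v ⟧ * F (suc v)) ∎
    where
    open DecMembership (Fin._≟_ {n}) using (_∈?_)
    disjoint : ∀ v → ⟦ x Fin.≟ v ⟧ + ⟦ v ∈? xs ⟧ ≈ ⟦ mem? v ⟧
    disjoint v with x Fin.≟ v
    ... | yes ≡.refl = trans (+-congˡ (⟦⟧-false (v ∈? xs) λ v∈xs → All.lookup x∉xs v∈xs ≡.refl))
      (trans (+-identityʳ _) (sym (⟦⟧-true (mem? v) (here ≡.refl))))
    ... | no x≢v = trans (+-identityˡ _) (⟦⟧-cong (v ∈? xs) (mem? v) there
      λ { (here v≡x) → contradiction (≡.sym v≡x) x≢v ; (there v∈xs) → v∈xs })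

  module _ (G : Digraph) {κ} (κ-bound : OutDegreesAtMost κ G) where

    private n = order G

    chains : ∀ {k} → Vertex G → Vertex G → Carrier
    chains {k} u v = ∑ (tuples n k) (λ y → ⟦ chain? G u y v ⟧)

    private
      firstStep : ∀ k u v →
        ∑ (tuples κ (suc k)) (λ w → ⟦ follow G w (suc u) Fin.≟ suc v ⟧) ≈
        ∑ (fins n) (λ u′ → ⟦ edge? G u u′ ⟧ * ∑ (tuples κ k) (λ w → ⟦ follow G w (suc u′) Fin.≟ suc v ⟧))
      firstStep k u v = trans (∑-Π (λ _ → fins κ) _)
        (∑-pick (adj G u) (adj-unique G u) (κ-bound u) (edge? G u)
          (λ x → ∑ (tuples κ k) (λ w → ⟦ follow G w x Fin.≟ suc v ⟧))
          -- `zero` is absorbing: a walk that is stuck never ends in `suc v`.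
          (∑-zero λ w → ⟦⟧-false (follow G w zero Fin.≟ suc v)
            λ eq → Fin.0≢1+n (≡.trans (≡.sym (follow-zero G w)) eq)))

    -- Words that lead from `u` to `v` correspond to walks from `u` to `v`, as a position in a
    -- duplicate-free list is the same as an out-neighbour. The induction splits off the first
    -- letter and the first edge.
    ∑-follow : ∀ k u v → ∑ (tuples κ (suc k)) (λ w → ⟦ follow G w (suc u) Fin.≟ suc v ⟧) ≈ chains {k} u v
    ∑-follow zero u v = begin
      ∑ (tuples κ 1) (λ w → ⟦ follow G w (suc u) Fin.≟ suc v ⟧)
        ≈⟨ firstStep zero u v ⟩
      ∑ (fins n) (λ u′ → ⟦ edge? G u u′ ⟧ * ∑ (tuples κ 0) (λ w → ⟦ suc u′ Fin.≟ suc v ⟧))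
        ≈⟨ (∑-cong λ u′ → trans (*-congˡ (trans (∑-Π-zero (λ _ → fins κ) _)
            (⟦⟧-cong (suc u′ Fin.≟ suc v) (v Fin.≟ u′) (≡.sym ∘ Fin.suc-injective) (≡.cong suc ∘ ≡.sym)))) (*-comm _ _)) ⟩
      ∑ (fins n) (λ u′ → ⟦ v Fin.≟ u′ ⟧ * ⟦ edge? G u u′ ⟧)
        ≈⟨ ∑-δ v _ ⟩
      ⟦ edge? G u v ⟧
        ≈⟨ ∑-Π-zero (λ _ → fins n) _ ⟨
      chains {zero} u v ∎
    ∑-follow (suc k) u v = begin
      ∑ (tuples κ (2 ℕ.+ k)) (λ w → ⟦ follow G w (suc u) Fin.≟ suc v ⟧)
        ≈⟨ firstStep (suc k) u v ⟩
      ∑ (fins n) (λ u′ → ⟦ edge? G u u′ ⟧ * ∑ (tuples κ (suc k)) (λ w → ⟦ follow G w (suc u′) Fin.≟ suc v ⟧))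
        ≈⟨ (∑-cong λ u′ → trans (*-congˡ (∑-follow k u′ v)) (∑-distribˡ _ _)) ⟩
      ∑ (fins n) (λ u′ → ∑ (tuples n k) (λ y → ⟦ edge? G u u′ ⟧ * ⟦ chain? G u′ y v ⟧))
        ≈⟨ (∑-cong λ u′ → ∑-cong λ y → ⟦⟧-× (edge? G u u′) (chain? G u′ y v) (chain? G u (cons u′ y) v) id _,_) ⟨
      ∑ (fins n) (λ u′ → ∑ (tuples n k) (λ y → ⟦ chain? G u (cons u′ y) v ⟧))
        ≈⟨ ∑-Π (λ _ → fins n) _ ⟨
      chains {suc k} u v ∎

    -- A negative label ends in `zero` and never in `suc v`. So the labels whose signs add up to 0
    -- count exactly the positive words as soon as their walks are looked at.
    ∑-labels : ∀ k u v → ∑ (labels κ k) (λ l → sign (proj₁ l) * ⟦ walkEnd G l (suc u) Fin.≟ suc v ⟧) ≈ chains {k} u v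
    ∑-labels k u v = begin
      ∑ (labels κ k) (λ l → sign (proj₁ l) * ⟦ walkEnd G l (suc u) Fin.≟ suc v ⟧)
        ≈⟨ ∑-⊗ bools (tuples κ (suc k)) _ ⟩
      ∑ bools (λ b → ∑ (tuples κ (suc k)) (λ w → sign b * ⟦ walkEnd G (b , w) (suc u) Fin.≟ suc v ⟧))
        ≈⟨ ∑-bools _ ⟩
      ∑ (tuples κ (suc k)) (λ w → 1# * ⟦ follow G w (suc u) Fin.≟ suc v ⟧) + ∑ (tuples κ (suc k)) (λ w → - 1# * 0#)
        ≈⟨ +-cong (∑-cong λ w → *-identityˡ _) (∑-zero λ w → zeroʳ _) ⟩
      ∑ (tuples κ (suc k)) (λ w → ⟦ follow G w (suc u) Fin.≟ suc v ⟧) + 0#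
        ≈⟨ trans (+-identityʳ _) (∑-follow k u v) ⟩
      chains {k} u v ∎

  module _ {H H′ : Digraph} {x : Fin (length (edges H)) → ℕ} (S : IsSubdivision H x H′) (G : Digraph) where

    open IsSubdivision S

    private
      h = order H
      n = order G
      k : Fin (length (edges H)) → ℕ
      k i = x i ℕ.∸ 1

    isHom-subdivision⇔ : ∀ φ → IsHom H′ G φ ⇔
      (∀ i → Chain G (φ (original (tailOf H i))) (φ ∘ internal i) (φ (original (headOf H i))))
    isHom-subdivision⇔ φ = mk⇔
      (λ hom i → Equivalence.from (chain⇔ G φ _ (internal i) _) λ p q pq∈ →
        hom p q (Equivalence.from (edges⇔ p q) (i , pq∈)))
      (λ chains p q pq → let i , pq∈ = Equivalence.to (edges⇔ p q) pq in
        Equivalence.to (chain⇔ G φ _ (internal i) _) (chains i) p q pq∈)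

    -- A map on the vertices of H′ consists of a map `f` on the original vertices and a choice of
    -- internal vertices for each edge of H. For fixed `f` these choices are independent, so the sum
    -- over them becomes a product over the edges.
    hom-subdivision : fromℕ (hom H′ G) ≈
      ∑ (functions h n) (λ f → ∏ (λ i → ∑ (tuples n (k i)) (λ y → ⟦ chain? G (f (tailOf H i)) y (f (headOf H i)) ⟧)))
    hom-subdivision = begin
      fromℕ (hom H′ G)
        ≈⟨ count-filter (isHom? H′ G) (functions (order H′) n) ⟩
      ∑ (functions (order H′) n) (λ φ → ⟦ isHom? H′ G φ ⟧)
        ≈⟨ ∑-reindex (functions-enumerates (order H′) n)
            (⊗-enumerates (functions-enumerates h n) (Π-enumerates λ i → Π-enumerates {_~_ = _≡_} λ _ → fins-enumerates n))
            (λ φ → φ ∘ original , λ i → φ ∘ internal i)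
            extend
            (λ φ≗ψ → φ≗ψ ∘ original , λ i → φ≗ψ ∘ internal i)
            (λ { {f , y} {g , z} (f≗g , y≗z) v → extend-cong f≗g y≗z (Inverse.from vertices v) })
            restrict-extend
            (λ (f , y) → (λ v → ≡.cong ([ f , _ ]) (Inverse.strictlyInverseʳ vertices (inj₁ v)))
                       , (λ i j → ≡.cong ([ f , _ ]) (Inverse.strictlyInverseʳ vertices (inj₂ (i , j)))))
            (λ { {f , y} {g , z} (f≗g , y≗z) → ⟦⟧-cong (chains? (f , y)) (chains? (g , z))
                (λ cs i → Chain-cong G (f≗g _) (y≗z i) (f≗g _) (cs i))
                (λ cs i → Chain-cong G (≡.sym (f≗g _)) (≡.sym ∘ y≗z i) (≡.sym (f≗g _)) (cs i)) })
            (λ φ → ⟦⟧-cong (isHom? H′ G φ) (chains? (φ ∘ original , λ i → φ ∘ internal i))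
              (Equivalence.to (isHom-subdivision⇔ φ)) (Equivalence.from (isHom-subdivision⇔ φ))) ⟩
      ∑ (functions h n ⊗ Π (λ i → tuples n (k i))) (λ fy → ⟦ chains? fy ⟧)
        ≈⟨ ∑-⊗ (functions h n) (Π (λ i → tuples n (k i))) _ ⟩
      ∑ (functions h n) (λ f → ∑ (Π (λ i → tuples n (k i))) (λ y → ⟦ chains? (f , y) ⟧))
        ≈⟨ (∑-cong λ f → ∑-cong λ y → ⟦⟧-∀ (λ i → chain? G _ (y i) _) (chains? (f , y)) id id) ⟩
      ∑ (functions h n) (λ f → ∑ (Π (λ i → tuples n (k i))) (λ y →
        ∏ (λ i → ⟦ chain? G (f (tailOf H i)) (y i) (f (headOf H i)) ⟧)))
        ≈⟨ (∑-cong λ f → ∑-Π-∏ (λ i → tuples n (k i)) (λ i y → ⟦ chain? G (f (tailOf H i)) y (f (headOf H i)) ⟧)) ⟩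
      ∑ (functions h n) (λ f → ∏ (λ i → ∑ (tuples n (k i)) (λ y → ⟦ chain? G (f (tailOf H i)) y (f (headOf H i)) ⟧))) ∎
      where
      Pieces : Set
      Pieces = (Vertex H → Vertex G) × (∀ i → Fin (k i) → Vertex G)

      chains? : ∀ (fy : Pieces) → Dec (∀ i → Chain G (proj₁ fy (tailOf H i)) (proj₂ fy i) (proj₁ fy (headOf H i)))
      chains? (f , y) = Fin.all? λ i → chain? G _ (y i) _

      extend : Pieces → Vertex H′ → Vertex G
      extend (f , y) v = [ f , (λ (i , j) → y i j) ] (Inverse.from vertices v)

      extend-cong : ∀ {f g : Vertex H → Vertex G} {y z : ∀ i → Fin (k i) → Vertex G} → f ≗ g → (∀ i j → y i j ≡ z i j) →
        ∀ p → [ f , (λ (i , j) → y i j) ] p ≡ [ g , (λ (i , j) → z i j) ] p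
      extend-cong f≗g y≗z (inj₁ v)       = f≗g v
      extend-cong f≗g y≗z (inj₂ (i , j)) = y≗z i j

      restrict-extend : ∀ φ → extend (φ ∘ original , λ i → φ ∘ internal i) ≗ φ
      restrict-extend φ v = ≡.trans (split (Inverse.from vertices v)) (≡.cong φ (Inverse.strictlyInverseˡ vertices v))
        where
        split : ∀ p → [ φ ∘ original , (λ (i , j) → φ (internal i j)) ] p ≡ φ (Inverse.to vertices p)
        split (inj₁ v)       = ≡.refl
        split (inj₂ (i , j)) = ≡.refl

-- Layered digraphs

-- A section is injective, hence bijective on a finite set, and therefore a two-sided inverse.
section⇒inverse : ∀ {n} (r s : Fin n → Fin n) → (∀ y → r (s y) ≡ y) → ∀ x → s (r x) ≡ x
section⇒inverse r s rs x =
  let π , π≡s = injective⇒permutation s (λ {y} {y′} eq → ≡.trans (≡.sym (rs y)) (≡.trans (≡.cong r eq) (rs y′)))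
      eq      = ≡.trans (≡.sym (π≡s (π ⟨$⟩ˡ x))) (inverseʳ π)
  in ≡.subst (λ x → s (r x) ≡ x) eq (≡.cong s (rs (π ⟨$⟩ˡ x)))

-- The value on zero only matters as the head of an edge of weight 0.
target : ∀ {n} → Fin n → Fin (suc n) → Fin n
target {suc n} u zero    = zero
target {suc n} u (suc v) = v

-- The default chosen in `target` matches truncated subtraction, so the program can compute heads by
-- one formula, without testing whether the walk exists.
toℕ-target : ∀ {n} (u : Fin n) x → toℕ (target u x) ≡ toℕ x ℕ.∸ 1
toℕ-target {suc n} u zero    = ≡.refl
toℕ-target {suc n} u (suc v) = ≡.refl

module _ (H : Digraph) where

  Selection : ℕ → (Fin (length (edges H)) → ℕ) → Set
  Selection κ k = ∀ i → Label κ (k i)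

  selections : ∀ κ k → Listing (Selection κ k)
  selections κ k = Π (λ i → labels κ (k i))

  edgeAt? : ∀ a b → Dec (∃[ i ] lookup (edges H) i ≡ (a , b))
  edgeAt? a b = Fin.any? λ i → Product.≡-dec Fin._≟_ Fin._≟_ (lookup (edges H) i) (a , b)

  jump : ∀ G {κ k} → Selection κ k → Vertex H → Vertex H → Fin (suc (order G)) → Fin (suc (order G))
  jump G o a b with edgeAt? a b
  ... | yes (i , _) = walkEnd G (o i)
  ... | no _        = λ _ → zero

  jump-edge : ∀ G {κ k} (o : Selection κ k) i → jump G o (tailOf H i) (headOf H i) ≡ walkEnd G (o i)
  jump-edge G o i with edgeAt? (tailOf H i) (headOf H i)
  ... | yes (j , eq) with ≡.refl ← unique⇒lookup-injective (edges-unique H) j i eq = ≡.refl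
  ... | no none = contradiction (i , ≡.refl) none

  -- A layered edge above (a , b) reads only the label of the edge (a , b) of H. The cancellation
  -- for maps that miss the edge `j` rests on this.
  jump-cong : ∀ G {κ k} (o o′ : Selection κ k) {a b} j → lookup (edges H) j ≢ (a , b) →
    (∀ i → i ≢ j → o i ≡ o′ i) → jump G o a b ≡ jump G o′ a b
  jump-cong G o o′ {a} {b} j j≢ab o≡o′ with edgeAt? a b
  ... | yes (i , eq) = ≡.cong (walkEnd G) (o≡o′ i λ { ≡.refl → j≢ab eq })
  ... | no _ = ≡.refl

  -- The out-neighbours of (u , a) follow the order of `adj H a` and carry pairwise different second
  -- components, which makes them distinct wherever the walks end. A missing walk keeps its place in
  -- the list, so that all copies of `a` have the same out-degree.
  layered : ∀ G {κ k} → Selection κ k → Digraph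
  layered G o = record
    { order      = order G ℕ.* order H
    ; adj        = λ x → neighbours (remQuot {order G} (order H) x)
    ; adj-unique = λ x → let u , a = remQuot {order G} (order H) x in
        Unique.map⁺ (λ {b} {b′} → Fin.combine-injectiveʳ (target u (jump G o a b (suc u))) b (target u (jump G o a b′ (suc u))) b′) (adj-unique H a)
    }
    module Layered where
      neighbours : Vertex G × Vertex H → List (Fin (order G ℕ.* order H))
      neighbours (u , a) = map (λ b → combine (target u (jump G o a b (suc u))) b) (adj H a)

  module _ (G : Digraph) {κ : ℕ} {k : Fin (length (edges H)) → ℕ} (o : Selection κ k) where

    layered-adj : ∀ u a → adj (layered G o) (combine u a) ≡
      map (λ b → combine (target u (jump G o a b (suc u))) b) (adj H a)
    layered-adj u a = ≡.cong (Layered.neighbours G o) (Fin.remQuot-combine u a)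

    layered-outDegree : ∀ u a → outDegree (layered G o) (combine u a) ≡ outDegree H a
    layered-outDegree u a = ≡.trans (≡.cong length (layered-adj u a)) (length-map _ (adj H a))

    layered-bound : ∀ {d} → OutDegreesAtMost d H → OutDegreesAtMost d (layered G o)
    layered-bound bound x = ℕ.≤-trans
      (ℕ.≤-reflexive (length-map _ (adj H (remainder {order G} (order H) x)))) (bound (remainder {order G} (order H) x))

    layered-edge⇔ : ∀ u a v b → Edge (layered G o) (combine u a) (combine v b) ⇔
      (Edge H a b × target u (jump G o a b (suc u)) ≡ v)
    layered-edge⇔ u a v b = mk⇔ to from
      where
      to : Edge (layered G o) (combine u a) (combine v b) → _
      to e with ∈-map⁻ _ (≡.subst (combine v b ∈_) (layered-adj u a) e)
      ... | b′ , b′∈ , eq with Fin.combine-injective v b _ b′ eq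
      ... | v≡ , ≡.refl = b′∈ , ≡.sym v≡

      from : _ → Edge (layered G o) (combine u a) (combine v b)
      from (b∈ , ≡.refl) = ≡.subst (combine v b ∈_) (≡.sym (layered-adj u a)) (∈-map⁺ _ b∈)

  -- Such a map permutes the edges of H: with finitely many of them, an
  -- assignment of preimages is injective, hence bijective.
  EdgeSurjective : (Vertex H → Vertex H) → Set
  EdgeSurjective σ = ∀ j → ∃[ i ] (σ (tailOf H i) ≡ tailOf H j × σ (headOf H i) ≡ headOf H j)

  edgeSurjective? : ∀ σ → Dec (EdgeSurjective σ)
  edgeSurjective? σ = Fin.all? λ j → Fin.any? λ i → (_ Fin.≟ _) ×-dec (_ Fin.≟ _)

  -- In general larger than the number of automorphisms of H, because isolated vertices may be sent
  -- anywhere.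
  symmetries : ℕ
  symmetries = length (filter edgeSurjective? (map (at (functions (order H) (order H))) (allFin (size (functions (order H) (order H))))))

  -- The identity is counted, in the form in which the listing contains it: equal to `id` at every
  -- vertex. This makes the final division possible.
  symmetries>0 : 1 ℕ.≤ symmetries
  symmetries>0 = filter-some edgeSurjective? (Any.map⁺ (Any.map (λ { ≡.refl → identity }) (∈-allFin (Enumerates.index listing id))))
    where
    listing = functions-enumerates (order H) (order H)

    identity : EdgeSurjective (at (functions (order H) (order H)) (Enumerates.index listing id))
    identity j = j , Enumerates.at-index listing id (tailOf H j) , Enumerates.at-index listing id (headOf H j)

  module Preimages (σ : Vertex H → Vertex H) (surjective : EdgeSurjective σ) where

    private
      s : Fin (length (edges H)) → Fin (length (edges H))
      s = proj₁ ∘ surjective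

    σ-tail : ∀ j → σ (tailOf H (s j)) ≡ tailOf H j
    σ-tail = proj₁ ∘ proj₂ ∘ surjective

    σ-head : ∀ j → σ (headOf H (s j)) ≡ headOf H j
    σ-head = proj₂ ∘ proj₂ ∘ surjective

    private
      s-permutation : ∃[ π ] (∀ j → π ⟨$⟩ʳ j ≡ s j)
      s-permutation = injective⇒permutation s λ {j} {j′} eq → edge-≡ H
        (≡.trans (≡.sym (σ-tail j)) (≡.trans (≡.cong (σ ∘ tailOf H) eq) (σ-tail j′)))
        (≡.trans (≡.sym (σ-head j)) (≡.trans (≡.cong (σ ∘ headOf H) eq) (σ-head j′)))

    edgePermutation : Permutation (length (edges H)) (length (edges H))
    edgePermutation = proj₁ s-permutation

    edgePermutation-tail : ∀ j → σ (tailOf H (edgePermutation ⟨$⟩ʳ j)) ≡ tailOf H j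
    edgePermutation-tail j = ≡.trans (≡.cong (σ ∘ tailOf H) (proj₂ s-permutation j)) (σ-tail j)

    edgePermutation-head : ∀ j → σ (headOf H (edgePermutation ⟨$⟩ʳ j)) ≡ headOf H j
    edgePermutation-head j = ≡.trans (≡.cong (σ ∘ headOf H) (proj₂ s-permutation j)) (σ-head j)

    Incident : Vertex H → Set
    Incident v = ∃[ i ] (tailOf H i ≡ v ⊎ headOf H i ≡ v)

    incident? : ∀ v → Dec (Incident v)
    incident? v = Fin.any? λ i → (tailOf H i Fin.≟ v) ⊎-dec (headOf H i Fin.≟ v)

    -- σ need not be injective on isolated vertices.
    ρ : Vertex H → Vertex H
    ρ v with incident? v
    ... | yes _ = σ v
    ... | no _  = v

    ρ-incident : ∀ v → Incident v → ρ v ≡ σ v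
    ρ-incident v inc with incident? v
    ... | yes _ = ≡.refl
    ... | no ¬inc = contradiction inc ¬inc

    ρ-isolated : ∀ v → ¬ Incident v → ρ v ≡ v
    ρ-isolated v ¬inc with incident? v
    ... | yes inc = contradiction inc ¬inc
    ... | no _ = ≡.refl

    -- An end of the edge `j` is the image of the corresponding end of the edge that σ sends to `j`;
    -- an isolated vertex is fixed. By finiteness this surjectivity already makes `ρ` a bijection.
    ρ-preimage : ∀ v → ∃[ u ] ρ u ≡ v
    ρ-preimage v with incident? v
    ... | no ¬inc = v , ρ-isolated v ¬inc
    ... | yes (j , inj₁ ≡.refl) = tailOf H (s j) , ≡.trans (ρ-incident _ (s j , inj₁ ≡.refl)) (σ-tail j)
    ... | yes (j , inj₂ ≡.refl) = headOf H (s j) , ≡.trans (ρ-incident _ (s j , inj₂ ≡.refl)) (σ-head j)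

    ρ⁻¹ : Vertex H → Vertex H
    ρ⁻¹ = proj₁ ∘ ρ-preimage

    ρ-ρ⁻¹ : ∀ v → ρ (ρ⁻¹ v) ≡ v
    ρ-ρ⁻¹ = proj₂ ∘ ρ-preimage

    ρ⁻¹-ρ : ∀ v → ρ⁻¹ (ρ v) ≡ v
    ρ⁻¹-ρ = section⇒inverse ρ ρ⁻¹ ρ-ρ⁻¹

-- Weighted homomorphisms into layered digraphs and their signed sum

module LayeredSums {c ℓ} (ℝ : Reals c ℓ) (H : Digraph) where

  open Reals ℝ hiding (zero)
  open Over ℝ
  open Sums commutativeRing
  open Walks ℝ
  open IsStrictPartialOrder isStrictPartialOrder using (irrefl; <-respʳ-≈) renaming (trans to <-trans)
  open import Relation.Binary.Reasoning.Setoid setoid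

  private
    h = order H
    m = length (edges H)

  0<fromℕ-suc : ∀ n → 0# < fromℕ (suc n)
  0<fromℕ-suc zero    = <-respʳ-≈ (sym (+-identityʳ 1#)) 0<1
  0<fromℕ-suc (suc n) = <-trans (0<fromℕ-suc n)
    (IsStrictPartialOrder.<-respˡ-≈ isStrictPartialOrder (+-identityˡ _) (+-monoˡ-< (fromℕ (suc n)) 0<1))

  0≤fromℕ : ∀ n → 0# ≤ fromℕ n
  0≤fromℕ zero    n<0 = irrefl refl n<0
  0≤fromℕ (suc n) n<0 = irrefl refl (<-trans n<0 (0<fromℕ-suc n))

  module _ (G : Digraph) {κ k} (o : Selection H κ k) where

    -- The minimum of 1 and `toℕ` of the walk's outcome, hence the indicator that the walk exists,
    -- written with truncated subtraction so that a word expression can evaluate it.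
    validity : Vertex G × Vertex H → Vertex G × Vertex H → ℕ
    validity (u , a) (_ , b) = 1 ℕ.∸ (1 ℕ.∸ toℕ (jump H G o a b (suc u)))

    layeredW : WeightedDigraph
    layeredW = record
      { digraph  = layered H G o
      ; weight   = λ x y → fromℕ (validity (remQuot {order G} h x) (remQuot {order G} h y))
      ; weight≥0 = λ x y _ → 0≤fromℕ (validity (remQuot {order G} h x) (remQuot {order G} h y))
      }

    open WeightedDigraph layeredW using (weight)

    weight-combine : ∀ u a v b → weight (combine u a) (combine v b) ≡ fromℕ (1 ℕ.∸ (1 ℕ.∸ toℕ (jump H G o a b (suc u))))
    weight-combine u a v b = ≡.cong₂ (λ x y → fromℕ (validity x y)) (Fin.remQuot-combine u a) (Fin.remQuot-combine v b)

    transfer : Vertex G → Vertex H → Vertex G → Vertex H → Carrier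
    transfer u a v b = ⟦ edge? H a b ⟧ * ⟦ jump H G o a b (suc u) Fin.≟ suc v ⟧

    -- An edge standing for a missing walk may happen to point at `v` through the default of
    -- `target`; its weight 0 removes it.
    edge*weight : ∀ u a v b →
      ⟦ edge? (layered H G o) (combine u a) (combine v b) ⟧ * weight (combine u a) (combine v b) ≈ transfer u a v b
    edge*weight u a v b = trans (*-congˡ (reflexive (weight-combine u a v b)))
      (reach (jump H G o a b (suc u)) (layered-edge⇔ H G o u a v b))
      where
      e? = edge? (layered H G o) (combine u a) (combine v b)
      reach : ∀ x → Edge (layered H G o) (combine u a) (combine v b) ⇔ (Edge H a b × target u x ≡ v) →
        ⟦ e? ⟧ * fromℕ (1 ℕ.∸ (1 ℕ.∸ toℕ x)) ≈ ⟦ edge? H a b ⟧ * ⟦ x Fin.≟ suc v ⟧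
      reach zero e⇔ = trans (zeroʳ _) (sym (zeroʳ _))
      reach (suc w) e⇔ = trans (*-congˡ (trans (reflexive (≡.cong (λ i → fromℕ (1 ℕ.∸ i)) (ℕ.0∸n≡0 (toℕ w)))) (+-identityʳ 1#))) (trans (*-identityʳ _)
        (⟦⟧-× (edge? H a b) (suc w Fin.≟ suc v) e?
          (λ e → let ab , eq = Equivalence.to e⇔ e in ab , ≡.cong suc (≡.trans (≡.sym (target-suc u w)) eq))
          (λ ab eq → Equivalence.from e⇔ (ab , ≡.trans (target-suc u w) (Fin.suc-injective eq)))))
        where
        target-suc : ∀ {n} (u w : Fin n) → target u (suc w) ≡ w
        target-suc {suc n} u w = ≡.refl

    -- A map into V(G) × V(H) is a pair of maps `f` and `σ`. Both the indicator of being a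
    -- homomorphism and the weight are products over the edges of H, and edge by edge they combine
    -- to `transfer`.
    weightedHom-layered : weightedHom H layeredW ≈
      ∑ (functions h (order G)) (λ f → ∑ (functions h h) (λ σ →
        ∏ (λ i → transfer (f (tailOf H i)) (σ (tailOf H i)) (f (headOf H i)) (σ (headOf H i)))))
    weightedHom-layered = begin
      weightedHom H layeredW
        ≈⟨ sum-filter (isHom? H (layered H G o)) (homWeight H layeredW) (functions h (order G ℕ.* h)) ⟩
      ∑ (functions h (order G ℕ.* h)) (λ φ → ⟦ isHom? H (layered H G o) φ ⟧ * homWeight H layeredW φ)
        ≈⟨ (∑-cong λ φ → trans (*-cong
            (⟦⟧-∀ (λ i → edge? (layered H G o) (φ (tailOf H i)) (φ (headOf H i))) (isHom? H (layered H G o) φ)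
              (Equivalence.to (isHom⇔ H (layered H G o) φ)) (Equivalence.from (isHom⇔ H (layered H G o) φ)))
            (foldr-∏ (edges H) _)) (sym (∏-distrib-* _ _))) ⟩
      ∑ (functions h (order G ℕ.* h)) F
        ≈⟨ ∑-reindex (⊗-enumerates (functions-enumerates h (order G)) (functions-enumerates h h))
            (functions-enumerates h (order G ℕ.* h))
            (λ (f , σ) v → combine (f v) (σ v))
            (λ φ → quotient h ∘ φ , remainder {order G} h ∘ φ)
            (λ (f≗g , σ≗τ) v → ≡.cong₂ combine (f≗g v) (σ≗τ v))
            (λ φ≗ψ → ≡.cong (quotient h) ∘ φ≗ψ , ≡.cong (remainder {order G} h) ∘ φ≗ψ)
            (λ (f , σ) → (λ v → ≡.cong proj₁ (Fin.remQuot-combine (f v) (σ v)))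
                       , (λ v → ≡.cong proj₂ (Fin.remQuot-combine (f v) (σ v))))
            (λ φ v → Fin.combine-remQuot {order G} h (φ v))
            (λ φ≗ψ → ∏-cong λ i → reflexive (≡.cong₂ (λ x y → ⟦ edge? (layered H G o) x y ⟧ * weight x y) (φ≗ψ _) (φ≗ψ _)))
            (λ (f , σ) → ∏-cong λ i → sym (edge*weight _ _ _ _)) ⟨
      ∑ (functions h (order G) ⊗ functions h h) (λ (f , σ) →
        ∏ (λ i → transfer (f (tailOf H i)) (σ (tailOf H i)) (f (headOf H i)) (σ (headOf H i))))
        ≈⟨ ∑-⊗ (functions h (order G)) (functions h h) _ ⟩
      ∑ (functions h (order G)) (λ f → ∑ (functions h h) (λ σ →
        ∏ (λ i → transfer (f (tailOf H i)) (σ (tailOf H i)) (f (headOf H i)) (σ (headOf H i))))) ∎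
      where
      F : (Vertex H → Fin (order G ℕ.* h)) → Carrier
      F φ = ∏ (λ i → ⟦ edge? (layered H G o) (φ (tailOf H i)) (φ (headOf H i)) ⟧ * weight (φ (tailOf H i)) (φ (headOf H i)))

  coefficient : ∀ {κ k} → Selection H κ k → Carrier
  coefficient o = ∏ (λ i → sign (proj₁ (o i)))

  module _ (G : Digraph) {κ} (κ-bound : OutDegreesAtMost κ G) (k : Fin m → ℕ) where

    private n = order G

    private
      value : (Vertex H → Vertex G) → (Vertex H → Vertex H) → Selection H κ k → Carrier
      value f σ o = ∏ (λ i → transfer G o (f (tailOf H i)) (σ (tailOf H i)) (f (headOf H i)) (σ (headOf H i)))

      W : ∀ i → Vertex G → Vertex G → Carrier
      W i = chains G κ-bound {k i}

    -- By `hom-subdivision` this is the number of homomorphisms from H′ to G when `k i` is the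
    -- number of internal vertices on the path of the edge `i`.
    walkSum : Carrier
    walkSum = ∑ (functions h n) (λ f → ∏ (λ i → W i (f (tailOf H i)) (f (headOf H i))))

    private
      -- If σ sends no edge to `j`, no factor of `value` consults the label of `j`, and the signs of
      -- these labels add up to 0.
      non-surjective : ∀ f σ → ¬ EdgeSurjective H σ → ∑ (selections H κ k) (λ o → coefficient o * value f σ o) ≈ 0#
      non-surjective f σ ¬surj with Fin.¬∀⟶∃¬ m _ (λ j → Fin.any? λ i → (σ (tailOf H i) Fin.≟ tailOf H j) ×-dec (σ (headOf H i) Fin.≟ headOf H j)) ¬surj
      ... | j , missed = ∑-Π-cancel (λ i → labels κ (k i)) (λ i l → sign (proj₁ l)) (value f σ) j (∑-sign κ (k j))
        λ o o′ o≡o′ → ∏-cong λ i → reflexive (≡.cong (λ φ → ⟦ edge? H _ _ ⟧ * ⟦ φ (suc (f (tailOf H i))) Fin.≟ suc (f (headOf H i)) ⟧)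
          (jump-cong H G o o′ j (λ eq → missed (i , ≡.sym (≡.cong proj₁ eq) , ≡.sym (≡.cong proj₂ eq))) o≡o′))

      -- After `edgePermutation` reorders the factors, factor `j` reads the label of `j` only, so
      -- the sum over selections splits into a product of walk counts. In it `f` is still evaluated
      -- at the ends of the permuted edges; the substitution of `f ∘ ρ` for `f` turns these back
      -- into the ends of `j`.
      surjective : ∀ σ → EdgeSurjective H σ →
        ∑ (functions h n) (λ f → ∑ (selections H κ k) (λ o → coefficient o * value f σ o)) ≈ walkSum
      surjective σ surj = begin
        ∑ (functions h n) (λ f → ∑ (selections H κ k) (λ o → coefficient o * value f σ o))
          ≈⟨ (∑-cong λ f → ∑-cong λ o → *-congˡ (permuted f o)) ⟩
        ∑ (functions h n) (λ f → ∑ (selections H κ k) (λ o → coefficient o * ∏ (λ j → ⟦ walkEnd G (o j) (suc (f (t j))) Fin.≟ suc (f (u j)) ⟧)))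
          ≈⟨ (∑-cong λ f → trans (∑-cong λ o → sym (∏-distrib-* _ _))
              (∑-Π-∏ (λ i → labels κ (k i)) (λ j l → sign (proj₁ l) * ⟦ walkEnd G l (suc (f (t j))) Fin.≟ suc (f (u j)) ⟧))) ⟩
        ∑ (functions h n) (λ f → ∏ (λ j → ∑ (labels κ (k j)) (λ l → sign (proj₁ l) * ⟦ walkEnd G l (suc (f (t j))) Fin.≟ suc (f (u j)) ⟧)))
          ≈⟨ (∑-cong λ f → ∏-cong λ j → ∑-labels G κ-bound (k j) (f (t j)) (f (u j))) ⟩
        ∑ (functions h n) (λ f → ∏ (λ j → W j (f (t j)) (f (u j))))
          ≈⟨ ∑-reindex (functions-enumerates h n) (functions-enumerates h n) (_∘ ρ) (_∘ ρ⁻¹)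
              (_∘ ρ) (_∘ ρ⁻¹) (λ f v → ≡.cong f (ρ-ρ⁻¹ v)) (λ f v → ≡.cong f (ρ⁻¹-ρ v))
              (λ f≗g → ∏-cong λ j → reflexive (≡.cong₂ (W j) (f≗g (t j)) (f≗g (u j))))
              (λ f → ∏-cong λ j → reflexive (≡.cong₂ (λ x y → W j (f x) (f y)) (ρ-t j) (ρ-u j))) ⟨
        walkSum ∎
        where
        open Preimages H σ surj
        t u : Fin m → Vertex H
        t j = tailOf H (edgePermutation ⟨$⟩ʳ j)
        u j = headOf H (edgePermutation ⟨$⟩ʳ j)

        ρ-t : ∀ j → tailOf H j ≡ ρ (t j)
        ρ-t j = ≡.sym (≡.trans (ρ-incident _ (_ , inj₁ ≡.refl)) (edgePermutation-tail j))

        ρ-u : ∀ j → headOf H j ≡ ρ (u j)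
        ρ-u j = ≡.sym (≡.trans (ρ-incident _ (_ , inj₂ ≡.refl)) (edgePermutation-head j))

        permuted : ∀ f o → value f σ o ≈ ∏ (λ j → ⟦ walkEnd G (o j) (suc (f (t j))) Fin.≟ suc (f (u j)) ⟧)
        permuted f o = trans (∏-permute _ edgePermutation) (∏-cong λ j → begin
          transfer G o (f (t j)) (σ (t j)) (f (u j)) (σ (u j))
            ≡⟨ ≡.cong₂ (λ a b → transfer G o (f (t j)) a (f (u j)) b) (edgePermutation-tail j) (edgePermutation-head j) ⟩
          ⟦ edge? H (tailOf H j) (headOf H j) ⟧ * ⟦ jump H G o (tailOf H j) (headOf H j) (suc (f (t j))) Fin.≟ suc (f (u j)) ⟧
            ≈⟨ *-cong (⟦⟧-true (edge? H _ _) (edge-at H j))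
                (reflexive (≡.cong (λ φ → ⟦ φ (suc (f (t j))) Fin.≟ suc (f (u j)) ⟧) (jump-edge H G o j))) ⟩
          1# * ⟦ walkEnd G (o j) (suc (f (t j))) Fin.≟ suc (f (u j)) ⟧
            ≈⟨ *-identityˡ _ ⟩
          ⟦ walkEnd G (o j) (suc (f (t j))) Fin.≟ suc (f (u j)) ⟧ ∎)

    weightedHom-combination :
      ∑ (selections H κ k) (λ o → coefficient o * weightedHom H (layeredW G o)) ≈ fromℕ (symmetries H) * walkSum
    weightedHom-combination = begin
      ∑ (selections H κ k) (λ o → coefficient o * weightedHom H (layeredW G o))
        ≈⟨ (∑-cong λ o → trans (*-congˡ (trans (weightedHom-layered G o) (∑-comm _))) (trans (∑-distribˡ _ _)
            (∑-cong λ σ → ∑-distribˡ _ _))) ⟩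
      ∑ (selections H κ k) (λ o → ∑ (functions h h) (λ σ → ∑ (functions h n) (λ f → coefficient o * value f σ o)))
        ≈⟨ trans (∑-comm _) (∑-cong λ σ → ∑-comm _) ⟩
      ∑ (functions h h) (λ σ → ∑ (functions h n) (λ f → ∑ (selections H κ k) (λ o → coefficient o * value f σ o)))
        ≈⟨ (∑-cong λ σ → bySurjectivity σ (edgeSurjective? H σ)) ⟩
      ∑ (functions h h) (λ σ → ⟦ edgeSurjective? H σ ⟧ * walkSum)
        ≈⟨ ∑-distribʳ walkSum _ ⟨
      ∑ (functions h h) (λ σ → ⟦ edgeSurjective? H σ ⟧) * walkSum
        ≈⟨ *-congʳ (count-filter (edgeSurjective? H) (functions h h)) ⟨
      fromℕ (symmetries H) * walkSum ∎
      where
      bySurjectivity : ∀ σ (s? : Dec (EdgeSurjective H σ)) →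
        ∑ (functions h n) (λ f → ∑ (selections H κ k) (λ o → coefficient o * value f σ o)) ≈ ⟦ s? ⟧ * walkSum
      bySurjectivity σ (yes s) = trans (surjective σ s) (sym (*-identityˡ _))
      bySurjectivity σ (no ¬s) = trans (∑-zero λ f → non-surjective f σ ¬s) (sym (zeroˡ _))

-- Memory layout of digraphs

module _ {A : Set a} (d : A) where

  fromList-++ˡ : ∀ xs {ys c} → c ℕ.< length xs → fromList d (xs ++ ys) c ≡ fromList d xs c
  fromList-++ˡ (x ∷ xs) {c = zero}  _       = ≡.refl
  fromList-++ˡ (x ∷ xs) {c = suc c} (s≤s c<) = fromList-++ˡ xs c<

  fromList-++ʳ : ∀ xs {ys c} → fromList d (xs ++ ys) (length xs ℕ.+ c) ≡ fromList d ys c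
  fromList-++ʳ []       = ≡.refl
  fromList-++ʳ (x ∷ xs) = fromList-++ʳ xs

  fromList-beyond : ∀ xs {c} → length xs ℕ.≤ c → fromList d xs c ≡ d
  fromList-beyond []       _        = ≡.refl
  fromList-beyond (x ∷ xs) (s≤s ≤c) = fromList-beyond xs ≤c

  fromList-tabulate : ∀ {n} (f : Fin n → A) i → fromList d (tabulate f) (toℕ i) ≡ f i
  fromList-tabulate f zero    = ≡.refl
  fromList-tabulate f (suc i) = fromList-tabulate (f ∘ suc) i

  fromList-map-lookup : ∀ (f : B → A) xs i → fromList d (map f xs) (toℕ i) ≡ f (lookup xs i)
  fromList-map-lookup f (x ∷ xs) zero    = ≡.refl
  fromList-map-lookup f (x ∷ xs) (suc i) = fromList-map-lookup f xs i

offset : ∀ {n} → (Fin n → List A) → ℕ → ℕ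
offset {n = zero}  g k       = 0
offset {n = suc n} g zero    = 0
offset {n = suc n} g (suc k) = length (g zero) ℕ.+ offset (g ∘ suc) k

offset-zero : ∀ {n} (g : Fin n → List A) → offset g 0 ≡ 0
offset-zero {n = zero}  g = ≡.refl
offset-zero {n = suc n} g = ≡.refl

offset-suc : ∀ {n} (g : Fin n → List A) u → offset g (suc (toℕ u)) ≡ offset g (toℕ u) ℕ.+ length (g u)
offset-suc {n = suc n} g zero    = ≡.trans (≡.cong (length (g zero) ℕ.+_) (offset-zero (g ∘ suc))) (ℕ.+-identityʳ _)
offset-suc {n = suc n} g (suc u) = ≡.trans (≡.cong (length (g zero) ℕ.+_) (offset-suc (g ∘ suc) u)) (≡.sym (ℕ.+-assoc (length (g zero)) _ _))

offset-const : ∀ {n m} (g : Fin n → List A) → (∀ u → length (g u) ≡ m) → ∀ (u : Fin n) → offset g (toℕ u) ≡ toℕ u ℕ.* m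
offset-const g len zero    = ≡.refl
offset-const g len (suc u) = ≡.cong₂ ℕ._+_ (len zero) (offset-const (g ∘ suc) (len ∘ suc) u)

offset-≤ : ∀ {n κ} (g : Fin n → List A) → (∀ u → length (g u) ℕ.≤ κ) → ∀ k → offset g k ℕ.≤ n ℕ.* κ
offset-≤ {n = zero}  g len k       = z≤n
offset-≤ {n = suc n} g len zero    = z≤n
offset-≤ {n = suc n} g len (suc k) = ℕ.+-mono-≤ (len zero) (offset-≤ (g ∘ suc) (len ∘ suc) k)

fromList-concat : ∀ (d : A) {n} (g : Fin n → List A) u {c} → c ℕ.< length (g u) →
  fromList d (concat (tabulate g)) (offset g (toℕ u) ℕ.+ c) ≡ fromList d (g u) c
fromList-concat d g zero    c< = fromList-++ˡ d (g zero) c<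
fromList-concat d g (suc u) {c} c< = ≡.trans
  (≡.cong (fromList d (concat (tabulate g))) (ℕ.+-assoc (length (g zero)) _ c))
  (≡.trans (fromList-++ʳ d (g zero)) (fromList-concat d (g ∘ suc) u c<))

length-concat-≤ : ∀ {n κ} (g : Fin n → List A) → (∀ u → length (g u) ℕ.≤ κ) → length (concat (tabulate g)) ℕ.≤ n ℕ.* κ
length-concat-≤ {n = zero}  g len = z≤n
length-concat-≤ {n = suc n} g len = ℕ.≤-trans (ℕ.≤-reflexive (length-++ (g zero)))
  (ℕ.+-mono-≤ (len zero) (length-concat-≤ (g ∘ suc) (len ∘ suc)))

length-concat-const : ∀ {n m} (g : Fin n → List A) → (∀ u → length (g u) ≡ m) → length (concat (tabulate g)) ≡ n ℕ.* m
length-concat-const {n = zero}  g len = ≡.refl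
length-concat-const {n = suc n} g len = ≡.trans (length-++ (g zero))
  (≡.cong₂ ℕ._+_ (len zero) (length-concat-const (g ∘ suc) (len ∘ suc)))

tabulate-+ : ∀ m {n} (f : Fin (m ℕ.+ n) → A) → tabulate f ≡ tabulate (f ∘ (_↑ˡ n)) ++ tabulate (f ∘ (m ↑ʳ_))
tabulate-+ zero    f = ≡.refl
tabulate-+ (suc m) f = ≡.cong (f zero ∷_) (tabulate-+ m (f ∘ suc))

concat-combine : ∀ m {n} (g : Fin (m ℕ.* n) → List A) →
  concat (tabulate g) ≡ concat (tabulate (λ i → concat (tabulate (λ j → g (combine {m} i j)))))
concat-combine zero        g = ≡.refl
concat-combine (suc m) {n} g = ≡.trans (≡.cong concat (tabulate-+ n g))
  (≡.trans (≡.sym (concat-++ (tabulate (g ∘ (_↑ˡ (m ℕ.* n)))) _)) (≡.cong (concat (tabulate (g ∘ (_↑ˡ (m ℕ.* n)))) ++_) (concat-combine m (g ∘ (n ↑ʳ_)))))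

map-edges : ∀ G (φ : Vertex G × Vertex G → B) → map φ (edges G) ≡ concat (tabulate (λ u → map (λ v → φ (u , v)) (adj G u)))
map-edges G φ = ≡.trans (≡.sym (concat-map (map (λ u → map (u ,_) (adj G u)) (allFin (order G)))))
  (≡.cong concat (≡.trans (≡.sym (map-∘ (allFin (order G)))) (≡.trans (map-tabulate id _) (tabulate-cong λ u → ≡.sym (map-∘ (adj G u))))))

toℕ-pick : ∀ {n} (xs : List (Fin n)) c → c ℕ.< length xs → toℕ (pick xs c) ≡ suc (fromList 0 (map toℕ xs) c)
toℕ-pick (x ∷ xs) zero    _        = ≡.refl
toℕ-pick (x ∷ xs) (suc c) (s≤s c<) = toℕ-pick xs c c<

pick-beyond : ∀ {n} (xs : List (Fin n)) c → length xs ℕ.≤ c → pick xs c ≡ zero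
pick-beyond []       c       _        = ≡.refl
pick-beyond (x ∷ xs) (suc c) (s≤s ≤c) = pick-beyond xs c ≤c

module _ (G : Digraph) where

  adjOffset : ℕ → ℕ
  adjOffset = offset (λ u → map toℕ (adj G u))

  adjOffset-suc : ∀ u → adjOffset (suc (toℕ u)) ≡ adjOffset (toℕ u) ℕ.+ outDegree G u
  adjOffset-suc u = ≡.trans (offset-suc _ u) (≡.cong (adjOffset (toℕ u) ℕ.+_) (length-map toℕ (adj G u)))

  adjOffset-≤ : ∀ {κ} → OutDegreesAtMost κ G → ∀ k → adjOffset k ℕ.≤ order G ℕ.* κ
  adjOffset-≤ bound = offset-≤ _ (λ u → ℕ.≤-trans (ℕ.≤-reflexive (length-map toℕ (adj G u))) (bound u))

  edges-≤ : ∀ {κ} → OutDegreesAtMost κ G → length (edges G) ℕ.≤ order G ℕ.* κ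
  edges-≤ bound = ℕ.≤-trans (ℕ.≤-reflexive (≡.trans (≡.sym (length-map proj₂ (edges G))) (≡.cong length (map-edges G proj₂))))
    (length-concat-≤ _ λ u → ℕ.≤-trans (ℕ.≤-reflexive (length-map _ (adj G u))) (bound u))

  outDegreeArray : ∀ u → fromList 0 (map (outDegree G) (allFin (order G))) (toℕ u) ≡ outDegree G u
  outDegreeArray u = ≡.trans (≡.cong (λ xs → fromList 0 xs (toℕ u)) (map-tabulate id (outDegree G))) (fromList-tabulate 0 (outDegree G) u)

  adjArray : ℕ → ℕ
  adjArray = fromList 0 (map (toℕ ∘ proj₂) (edges G))

  -- The last factor is 1 if `c` is below the out-degree and 0 otherwise. It erases what the
  -- adjacency array holds past the out-neighbours of `u`, which may be those of later vertices.
  toℕ-step : ∀ u c →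
    suc (adjArray (adjOffset (toℕ u) ℕ.+ c)) ℕ.* (1 ℕ.∸ (suc c ℕ.∸ outDegree G u)) ≡ toℕ (step G c (suc u))
  toℕ-step u c with ℕ.<-≤-connex c (outDegree G u)
  ... | inj₁ c<d = begin
    suc (adjArray (adjOffset (toℕ u) ℕ.+ c)) ℕ.* (1 ℕ.∸ (suc c ℕ.∸ outDegree G u))
      ≡⟨ ≡.cong (λ x → suc (adjArray (adjOffset (toℕ u) ℕ.+ c)) ℕ.* (1 ℕ.∸ x)) (ℕ.m≤n⇒m∸n≡0 c<d) ⟩
    suc (adjArray (adjOffset (toℕ u) ℕ.+ c)) ℕ.* 1
      ≡⟨ ℕ.*-identityʳ _ ⟩
    suc (adjArray (adjOffset (toℕ u) ℕ.+ c))
      ≡⟨ ≡.cong (λ xs → suc (fromList 0 xs (adjOffset (toℕ u) ℕ.+ c))) (map-edges G (toℕ ∘ proj₂)) ⟩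
    suc (fromList 0 (concat (tabulate (λ u → map toℕ (adj G u)))) (adjOffset (toℕ u) ℕ.+ c))
      ≡⟨ ≡.cong suc (fromList-concat 0 _ u (≡.subst (c ℕ.<_) (≡.sym (length-map toℕ (adj G u))) c<d)) ⟩
    suc (fromList 0 (map toℕ (adj G u)) c)
      ≡⟨ toℕ-pick (adj G u) c c<d ⟨
    toℕ (pick (adj G u) c) ∎
    where open ≡.≡-Reasoning
  ... | inj₂ d≤c = ≡.trans
    (≡.cong (suc (adjArray (adjOffset (toℕ u) ℕ.+ c)) ℕ.*_) (≡.trans (≡.cong (1 ℕ.∸_) (ℕ.+-∸-assoc 1 d≤c)) (ℕ.0∸n≡0 (c ℕ.∸ outDegree G u))))
    (≡.trans (ℕ.*-zeroʳ (suc (adjArray (adjOffset (toℕ u) ℕ.+ c)))) (≡.cong toℕ (≡.sym (pick-beyond (adj G u) c d≤c))))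

module _ (H G : Digraph) {κ k} (o : Selection H κ k) where

  private
    L = layered H G o
    m = length (edges H)

    row : (Vertex L × Vertex L → B) → Vertex G → List B
    row φ u = map (λ (a , b) → φ (combine u a , combine (target u (jump H G o a b (suc u))) b)) (edges H)

    length-row : ∀ (φ : Vertex L × Vertex L → B) u → length (row φ u) ≡ m
    length-row φ u = length-map _ (edges H)

    -- `combine` is row-major, and the out-neighbour lists copy those of H. So the edge list
    -- consists of one row for each vertex `u` of G, and every row runs through `edges H`: edge `i`
    -- of row `u` has the address `u * m + i`.
    layered-edges : ∀ (φ : Vertex L × Vertex L → B) → map φ (edges L) ≡ concat (tabulate (row φ))
    layered-edges φ = ≡.trans (map-edges L φ) (≡.trans (concat-combine (order G) _) (≡.cong concat (tabulate-cong λ u →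
      ≡.sym (≡.trans (map-edges H _) (≡.cong concat (tabulate-cong λ a →
        ≡.trans (map-∘ (adj H a)) (≡.cong (map (λ y → φ (combine u a , y))) (≡.sym (layered-adj H G o u a)))))))))

  layered-length : ∀ (φ : Vertex L × Vertex L → B) → length (map φ (edges L)) ≡ order G ℕ.* m
  layered-length φ = ≡.trans (≡.cong length (layered-edges φ)) (length-concat-const _ (length-row φ))

  layered-edgeArray : ∀ (d : B) φ u i → fromList d (map φ (edges L)) (toℕ u ℕ.* m ℕ.+ toℕ i) ≡
    φ (combine u (tailOf H i) , combine (target u (walkEnd G (o i) (suc u))) (headOf H i))
  layered-edgeArray d φ u i = begin
    fromList d (map φ (edges L)) (toℕ u ℕ.* m ℕ.+ toℕ i)
      ≡⟨ ≡.cong₂ (fromList d) (layered-edges φ) (≡.cong (ℕ._+ toℕ i) (≡.sym (offset-const (row φ) (length-row φ) u))) ⟩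
    fromList d (concat (tabulate (row φ))) (offset (row φ) (toℕ u) ℕ.+ toℕ i)
      ≡⟨ fromList-concat d (row φ) u (≡.subst (toℕ i ℕ.<_) (≡.sym (length-row φ u)) (Fin.toℕ<n i)) ⟩
    fromList d (row φ u) (toℕ i)
      ≡⟨ fromList-map-lookup d _ (edges H) i ⟩
    φ (combine u (tailOf H i) , combine (target u (jump H G o (tailOf H i) (headOf H i) (suc u))) (headOf H i))
      ≡⟨ ≡.cong (λ ψ → φ (combine u (tailOf H i) , combine (target u (ψ (suc u))) (headOf H i))) (jump-edge H G o i) ⟩
    φ (combine u (tailOf H i) , combine (target u (walkEnd G (o i) (suc u))) (headOf H i)) ∎
    where open ≡.≡-Reasoning

-- Execution of programs

block : ∀ {L} → (Fin L → Program) → Program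
block {zero}  p = skip
block {suc L} p = p zero ∙ block (p ∘ suc)

-- Cell 0 of word array 3 is the loop counter; the bound is the order of the input.
counter vertexCount : WordExpr
counter     = cell 3 (lit 0)
vertexCount = cell 0 (lit 0)

forVertices : Program → Program
forVertices body = while (wordLess counter vertexCount) (body ∙ assignWord 3 (lit 0) (op add (lit 1) counter))

-- The state of an array that is being filled from left to right. `beyond` is part of it because the
-- input expected by the solver is prescribed at all addresses, with the default past the end.
record Prefix {A : Set a} (d : A) (X : ℕ → A) (k : ℕ) (f : ℕ → A) : Set a where
  constructor mk
  field
    below  : ∀ {j} → j ℕ.< k → f j ≡ X j
    beyond : ∀ {j} → k ℕ.≤ j → f j ≡ d

open Prefix public

prefix-empty : ∀ {d : A} {X f} → (∀ j → f j ≡ d) → Prefix d X 0 f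
prefix-empty f≡d = mk (λ ()) (λ {j} _ → f≡d j)

prefix-length : ∀ {d : A} {X k k′ f} → k ≡ k′ → Prefix d X k f → Prefix d X k′ f
prefix-length ≡.refl p = p

prefix-write : ∀ {d : A} {X : ℕ → A} {k} M b → Prefix d X k (M b) → Prefix d X (suc k) (update M b k (X k) b)
prefix-write {X = X} {k} M b p = mk below′ (λ {j} k<j → ≡.trans (update-index M b (ℕ.<⇒≢ k<j)) (beyond p (ℕ.<⇒≤ k<j)))
  where
  below′ : ∀ {j} → j ℕ.< suc k → update M b k (X k) b j ≡ X j
  below′ {j} j≤k with k ℕ.≟ j
  ... | yes ≡.refl = update-here M b k
  ... | no k≢j = ≡.trans (update-index M b k≢j) (below p (ℕ.≤∧≢⇒< (ℕ.s≤s⁻¹ j≤k) (k≢j ∘ ≡.sym)))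

module Execution {c ℓ} (ℝ : Reals c ℓ) (B : ℕ) where

  open Over ℝ
  open Store

  -- A Hoare triple for total correctness, with `T` as an upper bound on the running time.
  Exec : Program → Store → ℕ → (Store → Set q) → Set (c ⊔ ℓ ⊔ q)
  Exec P σ T Q = ∃[ t ] ∃[ τ ] Run B P σ t τ × t ℕ.≤ T × Q τ

  exec-map : ∀ {P σ S T} {Q : Store → Set q} {R : Store → Set r} → S ℕ.≤ T → (∀ {τ} → Q τ → R τ) → Exec P σ S Q → Exec P σ T R
  exec-map S≤T f (t , τ , run , t≤ , x) = t , τ , run , ℕ.≤-trans t≤ S≤T , f x

  exec-seq : ∀ {P P′ σ S T} {Q : Store → Set q} {R : Store → Set r} →
    Exec P σ S Q → (∀ {τ} → Q τ → Exec P′ τ T R) → Exec (P ∙ P′) σ (S ℕ.+ T) R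
  exec-seq (s , τ , run , s≤ , x) f with f x
  ... | t , υ , run′ , t≤ , y = s ℕ.+ t , υ , seq run run′ , ℕ.+-mono-≤ s≤ t≤ , y

  exec-assignWord : ∀ {a d e σ i x} {Q : Store → Set q} → evalWord d σ ≡ i → evalWord e σ ≡ x → i ℕ.≤ B → x ℕ.≤ B →
    Q (store (update (words σ) a i x) (reals σ)) → Exec (assignWord a d e) σ 1 Q
  exec-assignWord ≡.refl ≡.refl i≤B x≤B y = 1 , _ , assignWord i≤B x≤B , ℕ.≤-refl , y

  exec-assignReal : ∀ {a d e σ i x} {Q : Store → Set q} → evalWord d σ ≡ i → evalReal e σ ≡ x → i ℕ.≤ B →
    Q (store (words σ) (update (reals σ) a i x)) → Exec (assignReal a d e) σ 1 Q
  exec-assignReal ≡.refl ≡.refl i≤B y = 1 , _ , assignReal i≤B , ℕ.≤-refl , y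

  exec-block : ∀ {L} (p : Fin L → Program) (J : ℕ → Store → Set q) T →
    (∀ i {σ} → J (toℕ i) σ → Exec (p i) σ T (J (suc (toℕ i)))) →
    ∀ {σ} → J 0 σ → Exec (block p) σ (L ℕ.* T ℕ.+ 1) (J L)
  exec-block {L = zero}  p J T body x = 1 , _ , skip , ℕ.≤-refl , x
  exec-block {L = suc L} p J T body x = exec-map (ℕ.≤-reflexive (≡.sym (ℕ.+-assoc T (L ℕ.* T) 1))) id
    (exec-seq (body zero x) (exec-block (p ∘ suc) (J ∘ suc) T (body ∘ suc)))

  -- `J u` holds at the head of the loop when the counter is `u`, and `K u` after the body, before
  -- the counter is increased. The induction in `go` is on the number `r` of remaining rounds.
  exec-forVertices : ∀ {n} {body} (J K : ℕ → Store → Set q) T → n ℕ.≤ B →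
    (∀ {u σ} → J u σ → words σ 3 0 ≡ u × words σ 0 0 ≡ n) →
    (∀ (u : Fin n) {σ} → J (toℕ u) σ → Exec body σ T (K (toℕ u))) →
    (∀ {u σ} → K u σ → words σ 3 0 ≡ u × J (suc u) (store (update (words σ) 3 0 (suc u)) (reals σ))) →
    ∀ {σ} → J 0 σ → Exec (forVertices body) σ (n ℕ.* suc (T ℕ.+ 1) ℕ.+ 1) (J n)
  exec-forVertices {n = n} {body} J K T n≤B counted run next x = go n 0 ≡.refl x
    where
    iterate : ∀ u → u ℕ.< n → ∀ {σ} → J u σ →
      Exec (body ∙ assignWord 3 (lit 0) (op add (lit 1) counter)) σ (T ℕ.+ 1) (J (suc u))
    iterate u u<n x = exec-seq
      (≡.subst (λ u → ∀ {σ} → J u σ → Exec body σ T (K u)) (Fin.toℕ-fromℕ< u<n) (run (fromℕ< u<n)) x)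
      (λ y → let eq , z = next y in exec-assignWord ≡.refl (≡.cong suc eq) z≤n (ℕ.≤-trans u<n n≤B) z)

    go : ∀ r u → u ℕ.+ r ≡ n → ∀ {σ} → J u σ → Exec (forVertices body) σ (r ℕ.* suc (T ℕ.+ 1) ℕ.+ 1) (J n)
    go zero u u+0≡n {σ} x with counted x
    ... | counter≡u , order≡n = 1 , σ , while-false stop , ℕ.≤-refl , ≡.subst (λ u → J u σ) u≡n x
      where
      u≡n = ≡.trans (≡.sym (ℕ.+-identityʳ u)) u+0≡n
      stop : _
      stop (lift u<n) = ℕ.<-irrefl u≡n (≡.subst₂ ℕ._<_ counter≡u order≡n u<n)
    go (suc r) u u+r≡n {σ} x with counted x | iterate u u<n x
      where
      u<n = ℕ.≤-trans (s≤s (ℕ.m≤m+n u r)) (ℕ.≤-reflexive (≡.trans (≡.sym (ℕ.+-suc u r)) u+r≡n))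
    ... | counter≡u , order≡n | s , τ , run₁ , s≤ , y with go r (suc u) (≡.trans (≡.sym (ℕ.+-suc u r)) u+r≡n) y
    ... | t , υ , run₂ , t≤ , z =
      suc (s ℕ.+ t) , υ , while-true (lift (≡.subst₂ ℕ._<_ (≡.sym counter≡u) (≡.sym order≡n) u<n)) run₁ run₂
        , ℕ.≤-trans (s≤s (ℕ.+-mono-≤ s≤ t≤)) (ℕ.≤-reflexive (≡.cong suc (≡.sym (ℕ.+-assoc (T ℕ.+ 1) (r ℕ.* suc (T ℕ.+ 1)) 1))))
        , z
      where
      u<n : u ℕ.< n
      u<n = ℕ.≤-trans (s≤s (ℕ.m≤m+n u r)) (ℕ.≤-reflexive (≡.trans (≡.sym (ℕ.+-suc u r)) u+r≡n))

  module _ (σ₀ : Store) (b : ℕ) where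

    WordsOff : Store → Set c
    WordsOff τ = (∀ a → a ≢ b → ∀ j → words τ a j ≡ words σ₀ a j) × reals τ ≡ reals σ₀

    RealsOff : Store → Set c
    RealsOff τ = (∀ a → a ≢ b → ∀ j → reals τ a j ≡ reals σ₀ a j) × words τ ≡ words σ₀

    -- Index and value expressions may rely only on what lies outside array `b`, so cells that are
    -- already written cannot influence later ones.
    exec-fillWords : ∀ {L} (ix val : Fin L → WordExpr) X base →
      (∀ i {σ} → WordsOff σ → evalWord (ix i) σ ≡ base ℕ.+ toℕ i × evalWord (val i) σ ≡ X (base ℕ.+ toℕ i)) →
      (∀ (i : Fin L) → base ℕ.+ toℕ i ℕ.≤ B × X (base ℕ.+ toℕ i) ℕ.≤ B) →
      Prefix 0 X base (words σ₀ b) →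
      Exec (block (λ i → assignWord b (ix i) (val i))) σ₀ (L ℕ.* 1 ℕ.+ 1)
        (λ τ → WordsOff τ × Prefix 0 X (base ℕ.+ L) (words τ b))
    exec-fillWords ix val X base evals bounds p = exec-block _
      (λ i τ → WordsOff τ × Prefix 0 X (base ℕ.+ i) (words τ b)) 1
      (λ i {σ} (off , p) → exec-assignWord (proj₁ (evals i off)) (proj₂ (evals i off)) (proj₁ (bounds i)) (proj₂ (bounds i))
        (((λ a a≢b j → ≡.trans (update-array (words σ) (base ℕ.+ toℕ i) j (a≢b ∘ ≡.sym)) (proj₁ off a a≢b j)) , proj₂ off)
        , prefix-length (≡.sym (ℕ.+-suc base (toℕ i))) (prefix-write (words σ) b p)))
      (((λ _ _ _ → ≡.refl) , ≡.refl) , prefix-length (≡.sym (ℕ.+-identityʳ base)) p)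

    exec-fillReals : ∀ {L} (ix : Fin L → WordExpr) (val : Fin L → RealExpr) X base {d} →
      (∀ i {σ} → RealsOff σ → evalWord (ix i) σ ≡ base ℕ.+ toℕ i × evalReal (val i) σ ≡ X (base ℕ.+ toℕ i)) →
      (∀ (i : Fin L) → base ℕ.+ toℕ i ℕ.≤ B) →
      Prefix d X base (reals σ₀ b) →
      Exec (block (λ i → assignReal b (ix i) (val i))) σ₀ (L ℕ.* 1 ℕ.+ 1)
        (λ τ → RealsOff τ × Prefix d X (base ℕ.+ L) (reals τ b))
    exec-fillReals ix val X base {d} evals bounds p = exec-block _
      (λ i τ → RealsOff τ × Prefix d X (base ℕ.+ i) (reals τ b)) 1
      (λ i {σ} (off , p) → exec-assignReal (proj₁ (evals i off)) (proj₂ (evals i off)) (bounds i)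
        (((λ a a≢b j → ≡.trans (update-array (reals σ) (base ℕ.+ toℕ i) j (a≢b ∘ ≡.sym)) (proj₁ off a a≢b j)) , proj₂ off)
        , prefix-length (≡.sym (ℕ.+-suc base (toℕ i))) (prefix-write (reals σ) b p)))
      (((λ _ _ _ → ≡.refl) , ≡.refl) , prefix-length (≡.sym (ℕ.+-identityʳ base)) p)

-- Word array 4 + c tabulates step G c; cell 1 of array 3 holds the position in
-- the adjacency array of the out-neighbours of the current vertex.

entry : ℕ → WordExpr
entry c = op mul (op add (lit 1) (cell 2 (op add (cell 3 (lit 1)) (lit c)))) (op sub (lit 1) (op sub (lit (suc c)) (cell 1 counter)))

tabulateSteps : ℕ → Program
tabulateSteps κ = forVertices
  (block {κ} (λ c → assignWord (4 ℕ.+ toℕ c) (op add (lit 1) counter) (entry (toℕ c)))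
    ∙ assignWord 3 (lit 1) (op add (cell 3 (lit 1)) (cell 1 counter)))

module Tables {c₀ ℓ} (ℝ : Reals c₀ ℓ) (G : Digraph) (κ : ℕ) where

  open Reals ℝ using (0#)
  open Over ℝ
  open Store

  private n = order G

  record Tabulated (σ : Store) : Set where
    field
      vertices : words σ 0 0 ≡ n
      steps    : ∀ (c : Fin κ) j → words σ (4 ℕ.+ toℕ c) (toℕ j) ≡ toℕ (step G (toℕ c) j)

  module _ {B} (κ-bound : OutDegreesAtMost κ G) (n≤B : n ℕ.≤ B) (nκ≤B : n ℕ.* κ ℕ.≤ B) where

    open Execution ℝ B

    private
      record Partial (u c position : ℕ) (σ : Store) : Set c₀ where
        field
          count : words σ 3 0 ≡ u
          pos   : words σ 3 1 ≡ position
          low   : ∀ b → b ℕ.< 3 → ∀ j → words σ b j ≡ digraphWords G b j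
          high  : ∀ b → 4 ℕ.+ κ ℕ.≤ b → ∀ j → words σ b j ≡ 0
          real  : reals σ ≡ λ _ _ → 0#
          -- Row `suc v` belongs to the vertex `v` and row 0 to the failed walk. While the loop is
          -- at `u`, the rows up to `u` are complete, and row `suc u` is filled in the first `c`
          -- tables.
          steps : ∀ (d : Fin κ) j → toℕ j ℕ.≤ u ⊎ (toℕ j ≡ suc u × toℕ d ℕ.< c) →
                  words σ (4 ℕ.+ toℕ d) (toℕ j) ≡ toℕ (step G (toℕ d) j)

      open Partial

      tableArray<free : ∀ (d : Fin κ) → 4 ℕ.+ toℕ d ℕ.< 4 ℕ.+ κ
      tableArray<free d = ℕ.+-monoʳ-< 4 (Fin.toℕ<n d)

      setControl : ∀ {u c position u′ c′ position′} i x {σ} → Partial u c position σ →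
        update (words σ) 3 i x 3 0 ≡ u′ → update (words σ) 3 i x 3 1 ≡ position′ →
        (∀ (d : Fin κ) (j : Fin (suc n)) → toℕ j ℕ.≤ u′ ⊎ (toℕ j ≡ suc u′ × toℕ d ℕ.< c′) → toℕ j ℕ.≤ u ⊎ (toℕ j ≡ suc u × toℕ d ℕ.< c)) →
        Partial u′ c′ position′ (store (update (words σ) 3 i x) (reals σ))
      setControl i x {σ} p count′ pos′ weaken = record
        { count = count′
        ; pos   = pos′
        ; low   = λ b b<3 j → ≡.trans (update-array (words σ) i j (ℕ.<⇒≢ b<3 ∘ ≡.sym)) (low p b b<3 j)
        ; high  = λ b b≥ j → ≡.trans (update-array (words σ) i j (ℕ.<⇒≢ (ℕ.≤-trans (s≤s (s≤s (s≤s (s≤s z≤n)))) b≥))) (high p b b≥ j)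
        ; real  = real p
        ; steps = λ d j known → steps p d j (weaken d j known)
        }

      writeStep : ∀ (u : Vertex G) (d : Fin κ) {position σ} → Partial (toℕ u) (toℕ d) position σ →
        Partial (toℕ u) (suc (toℕ d)) position
          (store (update (words σ) (4 ℕ.+ toℕ d) (suc (toℕ u)) (toℕ (step G (toℕ d) (suc u)))) (reals σ))
      writeStep u d {σ = σ} p = record
        { count = count p
        ; pos   = pos p
        ; low   = λ b b<3 j → ≡.trans (update-array (words σ) (suc (toℕ u)) j
            (ℕ.<⇒≢ (ℕ.<-≤-trans b<3 (ℕ.≤-trans (ℕ.n≤1+n 3) (ℕ.m≤m+n 4 (toℕ d)))) ∘ ≡.sym)) (low p b b<3 j)
        ; high  = λ b b≥ j → ≡.trans (update-array (words σ) (suc (toℕ u)) j (ℕ.<⇒≢ (ℕ.<-≤-trans (tableArray<free d) b≥))) (high p b b≥ j)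
        ; real  = real p
        ; steps = steps′
        }
        where
        steps′ : ∀ (e : Fin κ) j → toℕ j ℕ.≤ toℕ u ⊎ (toℕ j ≡ suc (toℕ u) × toℕ e ℕ.< suc (toℕ d)) →
          update (words σ) (4 ℕ.+ toℕ d) (suc (toℕ u)) (toℕ (step G (toℕ d) (suc u))) (4 ℕ.+ toℕ e) (toℕ j) ≡ toℕ (step G (toℕ e) j)
        steps′ e j (inj₁ j≤u) = ≡.trans (update-index′ (ℕ.<⇒≢ (s≤s j≤u) ∘ ≡.sym)) (steps p e j (inj₁ j≤u))
          where
          update-index′ : suc (toℕ u) ≢ toℕ j →
            update (words σ) (4 ℕ.+ toℕ d) (suc (toℕ u)) (toℕ (step G (toℕ d) (suc u))) (4 ℕ.+ toℕ e) (toℕ j) ≡ words σ (4 ℕ.+ toℕ e) (toℕ j)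
          update-index′ u≢j with d Fin.≟ e
          ... | yes ≡.refl = update-index (words σ) (4 ℕ.+ toℕ d) u≢j
          ... | no d≢e = update-array (words σ) (suc (toℕ u)) (toℕ j) (d≢e ∘ Fin.toℕ-injective ∘ ℕ.+-cancelˡ-≡ 4 _ _)
        steps′ e j (inj₂ (j≡ , e≤d)) with d Fin.≟ e
        ... | yes ≡.refl with ≡.refl ← Fin.toℕ-injective {i = j} {j = suc u} j≡ = update-here (words σ) (4 ℕ.+ toℕ d) (suc (toℕ u))
        ... | no d≢e = ≡.trans (update-array (words σ) (suc (toℕ u)) (toℕ j) (d≢e ∘ Fin.toℕ-injective ∘ ℕ.+-cancelˡ-≡ 4 _ _))
          (steps p e j (inj₂ (j≡ , ℕ.≤∧≢⇒< (ℕ.s≤s⁻¹ e≤d) (d≢e ∘ ≡.sym ∘ Fin.toℕ-injective))))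

    exec-tabulateSteps : Exec (tabulateSteps κ) (store (digraphWords G) (λ _ _ → 0#))
      (n ℕ.* suc ((κ ℕ.* 1 ℕ.+ 1) ℕ.+ 1 ℕ.+ 1) ℕ.+ 1)
      (λ τ → Tabulated τ × (∀ b → 4 ℕ.+ κ ℕ.≤ b → ∀ j → words τ b j ≡ 0) × reals τ ≡ λ _ _ → 0#)
    exec-tabulateSteps = exec-map ℕ.≤-refl finish (exec-forVertices
      (λ u → Partial u 0 (adjOffset G u)) (λ u → Partial u κ (adjOffset G (suc u))) ((κ ℕ.* 1 ℕ.+ 1) ℕ.+ 1) n≤B
      (λ p → count p , low p 0 (s≤s z≤n) 0)
      (λ u p → exec-seq
        (exec-block _ (λ c → Partial (toℕ u) c (adjOffset G (toℕ u))) 1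
          (λ d q → exec-assignWord (≡.cong suc (count q)) (entry-value u d q) (ℕ.≤-trans (Fin.toℕ<n u) n≤B)
            (ℕ.≤-trans (Fin.toℕ≤pred[n] (step G (toℕ d) (suc u))) n≤B) (writeStep u d q)) p)
        (λ {σ} q → exec-assignWord ≡.refl (advance u q) (1≤B u) (ℕ.≤-trans (adjOffset-≤ G κ-bound (suc (toℕ u))) nκ≤B)
          (setControl 1 _ q (count q) ≡.refl λ _ _ → id)))
      (λ {u} p → count p , setControl 0 (suc u) p ≡.refl (pos p)
        λ { _ j (inj₁ j≤) → byCases j j≤ ; _ _ (inj₂ (_ , ())) })
      (record
        { count = ≡.refl
        ; pos   = ≡.sym (offset-zero (λ u → map toℕ (adj G u)))
        ; low   = λ _ _ _ → ≡.refl
        ; high  = λ { (suc (suc (suc _))) (s≤s (s≤s (s≤s _))) j → ≡.refl }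
        ; real  = ≡.refl
        -- Row 0 is never written: a failed walk stays at `zero`, which is what blank memory holds.
        ; steps = λ { d zero _ → ≡.refl ; d (suc j) (inj₁ ()) ; d (suc j) (inj₂ (_ , ())) }
        }))
      where
      finish : ∀ {σ} → Partial n 0 (adjOffset G n) σ → _
      finish p = record { vertices = low p 0 (s≤s z≤n) 0 ; steps = λ d j → steps p d j (inj₁ (Fin.toℕ≤pred[n] j)) }
        , high p , real p

      1≤B : Vertex G → 1 ℕ.≤ B
      1≤B u = ℕ.≤-trans (ℕ.≤-trans (s≤s z≤n) (Fin.toℕ<n u)) n≤B

      byCases : ∀ {u} {d : Fin κ} (j : Fin (suc n)) → toℕ j ℕ.≤ suc u → toℕ j ℕ.≤ u ⊎ (toℕ j ≡ suc u × toℕ d ℕ.< κ)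
      byCases {u} {d = d} j j≤ with ℕ.m≤n⇒m<n∨m≡n j≤
      ... | inj₁ j<  = inj₁ (ℕ.s≤s⁻¹ j<)
      ... | inj₂ j≡ = inj₂ (j≡ , Fin.toℕ<n d)

      degree : ∀ u {c i σ} → Partial (toℕ u) c i σ → words σ 1 (words σ 3 0) ≡ outDegree G u
      degree u {σ = σ} q = ≡.trans (≡.cong (words σ 1) (count q))
        (≡.trans (low q 1 (s≤s (s≤s z≤n)) (toℕ u)) (outDegreeArray G u))

      entry-value : ∀ u d {σ} → Partial (toℕ u) (toℕ d) (adjOffset G (toℕ u)) σ →
        evalWord (entry (toℕ d)) σ ≡ toℕ (step G (toℕ d) (suc u))
      entry-value u d {σ} q = ≡.trans
        (≡.cong₂ (λ x y → suc x ℕ.* (1 ℕ.∸ (suc (toℕ d) ℕ.∸ y)))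
          (≡.trans (low q 2 (s≤s (s≤s (s≤s z≤n))) _) (≡.cong (λ i → adjArray G (i ℕ.+ toℕ d)) (pos q)))
          (degree u q))
        (toℕ-step G u (toℕ d))

      advance : ∀ u {c σ} → Partial (toℕ u) c (adjOffset G (toℕ u)) σ →
        words σ 3 1 ℕ.+ words σ 1 (words σ 3 0) ≡ adjOffset G (suc (toℕ u))
      advance u q = ≡.trans (≡.cong₂ ℕ._+_ (pos q) (degree u q)) (≡.sym (adjOffset-suc G u))

-- The program that writes a layered digraph and runs the solver on it

followExpr : ∀ {κ k} → (Fin k → Fin κ) → WordExpr → WordExpr
followExpr {k = zero}  w e = e
followExpr {k = suc k} w e = followExpr (w ∘ suc) (cell (4 ℕ.+ toℕ (w zero)) e)

-- The label is fixed in the program text, so a whole walk is a nested table lookup of constant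
-- size, evaluated at unit cost.
walkExpr : ∀ {κ k} → Label κ k → WordExpr
walkExpr (true  , w) = followExpr w (op add (lit 1) counter)
walkExpr (false , _) = lit 0

productExpr : ∀ {m} → (Fin m → RealExpr) → RealExpr
productExpr {zero}  e = cast (lit 1)
productExpr {suc m} e = op mul (e zero) (productExpr (e ∘ suc))

signExpr : Bool → RealExpr
signExpr true  = cast (lit 1)
signExpr false = op sub (cast (lit 0)) (cast (lit 1))

module _ (H : Digraph) {κ k} (ι : ℕ → ℕ) (o : Selection H κ k) where

  private
    h = order H
    m = length (edges H)

  vertexIx : Fin h → WordExpr
  vertexIx a = op add (op mul (lit h) counter) (lit (toℕ a))

  edgeIx : Fin m → WordExpr
  edgeIx i = op add (op mul counter (lit m)) (lit (toℕ i))

  headExpr : Fin m → WordExpr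
  headExpr i = op add (op mul (lit h) (op sub (walkExpr (o i)) (lit 1))) (lit (toℕ (headOf H i)))

  validityExpr : Fin m → WordExpr
  validityExpr i = op sub (lit 1) (op sub (lit 1) (walkExpr (o i)))

  buildVertex : Program
  buildVertex =
      block (λ a → assignWord (ι 1) (vertexIx a) (lit (outDegree H a)))
    ∙ block (λ i → assignWord (ι 2) (edgeIx i) (headExpr i))
    ∙ block (λ i → assignReal (ι 0) (edgeIx i) (cast (validityExpr i)))

  buildLayered : Program
  buildLayered =
      assignWord (ι 0) (lit 0) (op mul vertexCount (lit h))
    ∙ assignWord 3 (lit 0) (lit 0)
    ∙ forVertices buildVertex

  accumulate : Program → Program
  accumulate P = buildLayered ∙ rename ι P ∙
    assignReal 1 (lit 0) (op add (cell 1 (lit 0)) (op mul (productExpr (λ i → signExpr (proj₁ (o i)))) (cell (ι 1) (lit 0))))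

vertexTime : Digraph → ℕ
vertexTime H = (order H ℕ.* 1 ℕ.+ 1) ℕ.+ ((length (edges H) ℕ.* 1 ℕ.+ 1) ℕ.+ (length (edges H) ℕ.* 1 ℕ.+ 1))

buildTime : Digraph → ℕ → ℕ
buildTime H n = 1 ℕ.+ (1 ℕ.+ (n ℕ.* suc (vertexTime H ℕ.+ 1) ℕ.+ 1))

module Building {c₀ ℓ} (ℝ : Reals c₀ ℓ) (H G : Digraph) {κ k} (o : Selection H κ k)
  (ι : ℕ → ℕ) (ι-inj : Injective _≡_ _≡_ ι) (ι-free : ∀ a → 4 ℕ.+ κ ℕ.≤ ι a) where

  open Reals ℝ hiding (zero)
  open Over ℝ
  open Store
  open Tables ℝ G κ
  open Tabulated
  open LayeredSums ℝ H
  open Sums commutativeRing using (∏; ∏-zero; ∏-suc)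
  open Walks ℝ using (sign)
  open Renaming ℝ ι ι-inj
  open _≲_

  private
    n = order G
    h = order H
    m = length (edges H)
    L = layered H G o

    reserved : ∀ {b} → b ℕ.< 4 ℕ.+ κ → ∀ a → b ≢ ι a
    reserved b< a = ℕ.<⇒≢ (ℕ.<-≤-trans b< (ι-free a))

    step< : ∀ (d : Fin κ) → 4 ℕ.+ toℕ d ℕ.< 4 ℕ.+ κ
    step< d = ℕ.+-monoʳ-< 4 (Fin.toℕ<n d)

    ι≢ : ∀ {a b} → a ≢ b → ι a ≢ ι b
    ι≢ a≢b = a≢b ∘ ι-inj

  module _ {σ} (steps : ∀ (d : Fin κ) j → words σ (4 ℕ.+ toℕ d) (toℕ j) ≡ toℕ (step G (toℕ d) j)) where

    evalWord-follow : ∀ {k} (w : Fin k → Fin κ) e x → evalWord e σ ≡ toℕ x → evalWord (followExpr w e) σ ≡ toℕ (follow G w x)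
    evalWord-follow {zero}  w e x eq = eq
    evalWord-follow {suc k} w e x eq = evalWord-follow (w ∘ suc) (cell (4 ℕ.+ toℕ (w zero)) e) (step G (toℕ (w zero)) x)
      (≡.trans (≡.cong (words σ (4 ℕ.+ toℕ (w zero))) eq) (steps (w zero) x))

    evalWord-walk : ∀ {k} (l : Label κ k) (u : Vertex G) → words σ 3 0 ≡ toℕ u → evalWord (walkExpr l) σ ≡ toℕ (walkEnd G l (suc u))
    evalWord-walk (true  , w) u eq = evalWord-follow w _ (suc u) (≡.cong suc eq)
    evalWord-walk (false , w) u eq = ≡.refl

  evalReal-product : ∀ {m} (e : Fin m → RealExpr) (f : Fin m → Carrier) σ → (∀ i → evalReal (e i) σ ≈ f i) → evalReal (productExpr e) σ ≈ ∏ f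
  evalReal-product {zero}  e f σ e≈f = trans (+-identityʳ 1#) (sym (∏-zero f))
  evalReal-product {suc m} e f σ e≈f = trans (*-cong (e≈f zero) (evalReal-product (e ∘ suc) (f ∘ suc) σ (e≈f ∘ suc))) (sym (∏-suc f))

  evalReal-sign : ∀ b σ → evalReal (signExpr b) σ ≈ sign b
  evalReal-sign true  σ = +-identityʳ 1#
  evalReal-sign false σ = trans (+-identityˡ _) (-‿cong (+-identityʳ 1#))

  private
    weight = WeightedDigraph.weight (layeredW G o)

    degreeList headList : List ℕ
    degreeList = map (outDegree L) (allFin (order L))
    headList   = map (toℕ ∘ proj₂) (edges L)

    weightList : List Carrier
    weightList = map (λ (x , y) → weight x y) (edges L)

    degrees heads : ℕ → ℕ
    degrees = fromList 0 degreeList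
    heads   = fromList 0 headList

    weights : ℕ → Carrier
    weights = fromList 0# weightList

    degrees-at : ∀ u a → degrees (h ℕ.* toℕ u ℕ.+ toℕ a) ≡ outDegree H a
    degrees-at u a = ≡.trans (≡.cong degrees (≡.sym (Fin.toℕ-combine u a)))
      (≡.trans (outDegreeArray L (combine u a)) (layered-outDegree H G o u a))

    heads-at : ∀ u i → heads (toℕ u ℕ.* m ℕ.+ toℕ i) ≡ h ℕ.* (toℕ (walkEnd G (o i) (suc u)) ℕ.∸ 1) ℕ.+ toℕ (headOf H i)
    heads-at u i = ≡.trans (layered-edgeArray H G o 0 (toℕ ∘ proj₂) u i)
      (≡.trans (Fin.toℕ-combine (target u (walkEnd G (o i) (suc u))) (headOf H i))
        (≡.cong (λ x → h ℕ.* x ℕ.+ toℕ (headOf H i)) (toℕ-target u (walkEnd G (o i) (suc u)))))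

    weights-at : ∀ u i → weights (toℕ u ℕ.* m ℕ.+ toℕ i) ≡ fromℕ (1 ℕ.∸ (1 ℕ.∸ toℕ (walkEnd G (o i) (suc u))))
    weights-at u i = ≡.trans (layered-edgeArray H G o 0# (λ (x , y) → weight x y) u i)
      (≡.trans (weight-combine G o u (tailOf H i) (target u (walkEnd G (o i) (suc u))) (headOf H i))
        (≡.cong (λ f → fromℕ (1 ℕ.∸ (1 ℕ.∸ toℕ (f (suc u))))) (jump-edge H G o i)))

  module _ {B} (n≤B : n ℕ.≤ B) (nh≤B : n ℕ.* h ℕ.≤ B) (nm≤B : n ℕ.* m ℕ.≤ B) (degree≤B : OutDegreesAtMost B H) where

    open Execution ℝ B

    module _ (σ₀ : Store) where

      private
        record Partial (u p q r : ℕ) (τ : Store) : Set c₀ where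
          field
            count   : words τ 3 0 ≡ u
            order₀  : ∀ j → words τ (ι 0) j ≡ digraphWords L 0 j
            degrees₁ : Prefix 0 degrees p (words τ (ι 1))
            heads₂  : Prefix 0 heads q (words τ (ι 2))
            weights₀ : Prefix 0# weights r (reals τ (ι 0))
            keepsW  : ∀ b → b ≢ 3 → b ≢ ι 0 → b ≢ ι 1 → b ≢ ι 2 → ∀ j → words τ b j ≡ words σ₀ b j
            keepsR  : ∀ b → b ≢ ι 0 → ∀ j → reals τ b j ≡ reals σ₀ b j

        open Partial

        prefix-cong : ∀ {a} {A : Set a} {d : A} {X k f g} → (∀ j → g j ≡ f j) → Prefix d X k f → Prefix d X k g
        prefix-cong g≡f p = mk (λ j<k → ≡.trans (g≡f _) (below p j<k)) (λ k≤j → ≡.trans (g≡f _) (beyond p k≤j))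

        wroteDegrees : ∀ {u p q r p′ τ υ} → Partial u p q r τ → WordsOff τ (ι 1) υ →
          Prefix 0 degrees p′ (words υ (ι 1)) → Partial u p′ q r υ
        wroteDegrees x (off , same) new = record
          { count    = ≡.trans (off 3 (reserved (s≤s (s≤s (s≤s (s≤s z≤n)))) 1) 0) (count x)
          ; order₀   = λ j → ≡.trans (off (ι 0) (ι≢ λ ()) j) (order₀ x j)
          ; degrees₁ = new
          ; heads₂   = prefix-cong (off (ι 2) (ι≢ λ ())) (heads₂ x)
          ; weights₀ = ≡.subst (λ M → Prefix 0# weights _ (M (ι 0))) (≡.sym same) (weights₀ x)
          ; keepsW   = λ b b≢3 b≢ι0 b≢ι1 b≢ι2 j → ≡.trans (off b b≢ι1 j) (keepsW x b b≢3 b≢ι0 b≢ι1 b≢ι2 j)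
          ; keepsR   = λ b b≢ι0 j → ≡.trans (≡.cong (λ M → M b j) same) (keepsR x b b≢ι0 j)
          }

        wroteHeads : ∀ {u p q r q′ τ υ} → Partial u p q r τ → WordsOff τ (ι 2) υ →
          Prefix 0 heads q′ (words υ (ι 2)) → Partial u p q′ r υ
        wroteHeads x (off , same) new = record
          { count    = ≡.trans (off 3 (reserved (s≤s (s≤s (s≤s (s≤s z≤n)))) 2) 0) (count x)
          ; order₀   = λ j → ≡.trans (off (ι 0) (ι≢ λ ()) j) (order₀ x j)
          ; degrees₁ = prefix-cong (off (ι 1) (ι≢ λ ())) (degrees₁ x)
          ; heads₂   = new
          ; weights₀ = ≡.subst (λ M → Prefix 0# weights _ (M (ι 0))) (≡.sym same) (weights₀ x)
          ; keepsW   = λ b b≢3 b≢ι0 b≢ι1 b≢ι2 j → ≡.trans (off b b≢ι2 j) (keepsW x b b≢3 b≢ι0 b≢ι1 b≢ι2 j)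
          ; keepsR   = λ b b≢ι0 j → ≡.trans (≡.cong (λ M → M b j) same) (keepsR x b b≢ι0 j)
          }

        wroteWeights : ∀ {u p q r r′ τ υ} → Partial u p q r τ → RealsOff τ (ι 0) υ →
          Prefix 0# weights r′ (reals υ (ι 0)) → Partial u p q r′ υ
        wroteWeights {υ = store w ρ} x (off , ≡.refl) new = record
          { count    = count x
          ; order₀   = order₀ x
          ; degrees₁ = degrees₁ x
          ; heads₂   = heads₂ x
          ; weights₀ = new
          ; keepsW   = keepsW x
          ; keepsR   = λ b b≢ι0 j → ≡.trans (off b b≢ι0 j) (keepsR x b b≢ι0 j)
          }

        setCounter : ∀ {u p q r u′ τ} → Partial u p q r τ → Partial u′ p q r (store (update (words τ) 3 0 u′) (reals τ))
        setCounter {u′ = u′} {τ = τ} x = record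
          { count    = ≡.refl
          ; order₀   = λ j → ≡.trans (update-array (words τ) 0 j (ι≢3 0)) (order₀ x j)
          ; degrees₁ = prefix-cong (λ j → update-array (words τ) 0 j (ι≢3 1)) (degrees₁ x)
          ; heads₂   = prefix-cong (λ j → update-array (words τ) 0 j (ι≢3 2)) (heads₂ x)
          ; weights₀ = weights₀ x
          ; keepsW   = λ b b≢3 b≢ι0 b≢ι1 b≢ι2 j → ≡.trans (update-array (words τ) 0 j (b≢3 ∘ ≡.sym)) (keepsW x b b≢3 b≢ι0 b≢ι1 b≢ι2 j)
          ; keepsR   = keepsR x
          }
          where
          ι≢3 : ∀ a → 3 ≢ ι a
          ι≢3 = reserved (s≤s (s≤s (s≤s (s≤s z≤n))))

        Done : ℕ → Store → Set c₀
        Done u = Partial u (h ℕ.* u) (u ℕ.* m) (u ℕ.* m)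

      module _ (tab : Tabulated σ₀) where

        private
          keepsSteps : ∀ {u p q r τ} → Partial u p q r τ →
            ∀ (d : Fin κ) j → words τ (4 ℕ.+ toℕ d) (toℕ j) ≡ toℕ (step G (toℕ d) j)
          keepsSteps x d j = ≡.trans
            (keepsW x (4 ℕ.+ toℕ d) (λ ()) (reserved (step< d) 0) (reserved (step< d) 1) (reserved (step< d) 2) (toℕ j))
            (steps tab d j)

          edgeIx≤B : ∀ (u : Vertex G) (i : Fin m) → toℕ u ℕ.* m ℕ.+ toℕ i ℕ.≤ B
          edgeIx≤B u i = ℕ.≤-trans (ℕ.≤-reflexive (≡.trans (≡.cong (ℕ._+ toℕ i) (ℕ.*-comm (toℕ u) m)) (≡.sym (Fin.toℕ-combine u i))))
            (ℕ.≤-trans (ℕ.<⇒≤ (Fin.toℕ<n (combine u i))) nm≤B)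

          head≤B : ∀ (u : Vertex G) (i : Fin m) → heads (toℕ u ℕ.* m ℕ.+ toℕ i) ℕ.≤ B
          head≤B u i = ℕ.≤-trans (ℕ.≤-reflexive (layered-edgeArray H G o 0 (toℕ ∘ proj₂) u i))
            (ℕ.≤-trans (ℕ.<⇒≤ (Fin.toℕ<n _)) nh≤B)

          vertexIx≤B : ∀ (u : Vertex G) (a : Vertex H) → h ℕ.* toℕ u ℕ.+ toℕ a ℕ.≤ B
          vertexIx≤B u a = ℕ.≤-trans (ℕ.≤-reflexive (≡.sym (Fin.toℕ-combine u a)))
            (ℕ.≤-trans (ℕ.<⇒≤ (Fin.toℕ<n (combine u a))) nh≤B)

          context : ∀ {u p q r τ υ} a → Partial u p q r τ → (∀ b → b ≢ ι a → ∀ j → words υ b j ≡ words τ b j) →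
            words υ 3 0 ≡ u × (∀ (d : Fin κ) j → words υ (4 ℕ.+ toℕ d) (toℕ j) ≡ toℕ (step G (toℕ d) j))
          context a x off = ≡.trans (off 3 (reserved (s≤s (s≤s (s≤s (s≤s z≤n)))) a) 0) (count x)
            , λ d j → ≡.trans (off (4 ℕ.+ toℕ d) (reserved (step< d) a) (toℕ j)) (keepsSteps x d j)

          exec-vertex : ∀ (u : Vertex G) {τ} → Done (toℕ u) τ →
            Exec (buildVertex H ι o) τ (vertexTime H)
              (Partial (toℕ u) (h ℕ.* toℕ u ℕ.+ h) (toℕ u ℕ.* m ℕ.+ m) (toℕ u ℕ.* m ℕ.+ m))
          exec-vertex u {τ} x = exec-seq
            (exec-fillWords τ (ι 1) (vertexIx H ι o) _ degrees (h ℕ.* toℕ u)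
              (λ a {σ} (off , _) → ≡.cong (λ v → h ℕ.* v ℕ.+ toℕ a) (proj₁ (context {υ = σ} 1 x off)) , ≡.sym (degrees-at u a))
              (λ a → vertexIx≤B u a , ℕ.≤-trans (ℕ.≤-reflexive (degrees-at u a)) (degree≤B a))
              (degrees₁ x))
            λ {τ₁} (off , new) → let x₁ = wroteDegrees x off new in exec-seq
              (exec-fillWords τ₁ (ι 2) (edgeIx H ι o) (headExpr H ι o) heads (toℕ u ℕ.* m)
                (λ i {σ} (off , _) → let counted , stepped = context {υ = σ} 2 x₁ off in
                    ≡.cong (λ v → v ℕ.* m ℕ.+ toℕ i) counted
                  , ≡.trans (≡.cong (λ v → h ℕ.* (v ℕ.∸ 1) ℕ.+ toℕ (headOf H i)) (evalWord-walk stepped (o i) u counted)) (≡.sym (heads-at u i)))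
                (λ i → edgeIx≤B u i , head≤B u i)
                (heads₂ x₁))
              λ {τ₂} (off , new) → let x₂ = wroteHeads x₁ off new in exec-map ℕ.≤-refl
                (λ (off , new) → wroteWeights x₂ off new)
                (exec-fillReals τ₂ (ι 0) (edgeIx H ι o) (λ i → cast (validityExpr H ι o i)) weights (toℕ u ℕ.* m)
                  (λ i {σ} (_ , same) → let counted , stepped = context {υ = σ} 0 x₂ (λ b _ j → ≡.cong (λ M → M b j) same) in
                      ≡.cong (λ v → v ℕ.* m ℕ.+ toℕ i) counted
                    , ≡.trans (≡.cong (λ v → fromℕ (1 ℕ.∸ (1 ℕ.∸ v))) (evalWord-walk stepped (o i) u counted)) (≡.sym (weights-at u i)))
                  (edgeIx≤B u)
                  (weights₀ x₂))

        exec-build : (∀ a j → words σ₀ (ι a) j ≡ 0 × reals σ₀ (ι a) j ≡ 0#) →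
          Exec (buildLayered H ι o) σ₀ (buildTime H n) λ τ →
            τ ≲ store (digraphWords L) (weightReals (layeredW G o)) ×
            (∀ b → b ≢ 3 → (∀ a → b ≢ ι a) → ∀ j → words τ b j ≡ words σ₀ b j) ×
            (∀ b → (∀ a → b ≢ ι a) → ∀ j → reals τ b j ≡ reals σ₀ b j)
        -- The counter still holds what an earlier loop has left in it; the first index of `Partial`
        -- records that value until the reset that follows.
        exec-build blank = exec-seq {Q = Partial (update (words σ₀) (ι 0) 0 (n ℕ.* h) 3 0) 0 0 0}
          (exec-assignWord ≡.refl (≡.cong (ℕ._* h) (vertices tab)) z≤n nh≤B start)
          λ x → exec-seq (exec-assignWord ≡.refl ≡.refl z≤n z≤n (resize (≡.sym (ℕ.*-zeroʳ h)) ≡.refl (setCounter x)))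
          λ x → exec-map ℕ.≤-refl finish (exec-forVertices Done
            (λ u → Partial u (h ℕ.* u ℕ.+ h) (u ℕ.* m ℕ.+ m) (u ℕ.* m ℕ.+ m)) _ n≤B
            (λ x → count x , ≡.trans (keepsW x 0 (λ ()) (reserved (s≤s z≤n) 0) (reserved (s≤s z≤n) 1) (reserved (s≤s z≤n) 2) 0) (vertices tab))
            exec-vertex
            (λ {u} x → count x , resize (≡.trans (ℕ.+-comm (h ℕ.* u) h) (≡.sym (ℕ.*-suc h u))) (ℕ.+-comm (u ℕ.* m) m) (setCounter x))
            x)
          where
          resize : ∀ {u p p′ q q′ τ} → p ≡ p′ → q ≡ q′ → Partial u p q q τ → Partial u p′ q′ q′ τ
          resize ≡.refl ≡.refl x = x

          start : Partial (update (words σ₀) (ι 0) 0 (n ℕ.* h) 3 0) 0 0 0 (store (update (words σ₀) (ι 0) 0 (n ℕ.* h)) (reals σ₀))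
          start = record
            { count    = ≡.refl
            ; order₀   = λ { zero → update-here (words σ₀) (ι 0) 0
                           ; (suc j) → ≡.trans (update-index (words σ₀) (ι 0) {0} {n ℕ.* h} λ ()) (proj₁ (blank 0 (suc j))) }
            ; degrees₁ = prefix-empty λ j → ≡.trans (update-array (words σ₀) 0 j (ι≢ λ ())) (proj₁ (blank 1 j))
            ; heads₂   = prefix-empty λ j → ≡.trans (update-array (words σ₀) 0 j (ι≢ λ ())) (proj₁ (blank 2 j))
            ; weights₀ = prefix-empty λ j → proj₂ (blank 0 j)
            ; keepsW   = λ b _ b≢ι0 _ _ j → update-array (words σ₀) 0 j (b≢ι0 ∘ ≡.sym)
            ; keepsR   = λ _ _ _ → ≡.refl
            }

          full : ∀ {a} {A : Set a} {d : A} (xs : List A) {k f} → length xs ≡ k → Prefix d (fromList d xs) k f → ∀ j → f j ≡ fromList d xs j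
          full {d = d} xs {k} len p j with ℕ.<-≤-connex j k
          ... | inj₁ j<k = below p j<k
          ... | inj₂ k≤j = ≡.trans (beyond p k≤j) (≡.sym (fromList-beyond d xs (ℕ.≤-trans (ℕ.≤-reflexive len) k≤j)))

          finish : ∀ {τ} → Done n τ → _
          finish {τ} x = mk wordsL realsL
            , (λ b b≢3 b≢ι → keepsW x b b≢3 (b≢ι 0) (b≢ι 1) (b≢ι 2))
            , (λ b b≢ι → keepsR x b (b≢ι 0))
            where
            wordsL : ∀ a j → words τ (ι a) j ≡ digraphWords L a j
            wordsL 0 = order₀ x
            wordsL 1 = full degreeList (≡.trans (length-map (outDegree L) (allFin (n ℕ.* h))) (≡.trans (length-tabulate {n = n ℕ.* h} id) (ℕ.*-comm n h))) (degrees₁ x)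
            wordsL 2 = full headList (layered-length H G o (toℕ ∘ proj₂)) (heads₂ x)
            wordsL (suc (suc (suc a))) j = ≡.trans
              (keepsW x (ι (3 ℕ.+ a)) (reserved (s≤s (s≤s (s≤s (s≤s z≤n)))) (3 ℕ.+ a) ∘ ≡.sym) (ι≢ λ ()) (ι≢ λ ()) (ι≢ λ ()) j)
              (proj₁ (blank (3 ℕ.+ a) j))

            realsL : ∀ a j → reals τ (ι a) j ≈ weightReals (layeredW G o) a j
            realsL 0 j = reflexive (full weightList (layered-length H G o (λ (x , y) → weight x y)) (weights₀ x) j)
            realsL (suc a) j = reflexive (≡.trans (keepsR x (ι (suc a)) (ι≢ λ ()) j) (proj₂ (blank (suc a) j)))

        -- The solver runs on fresh arrays, so the memory it leaves behind never has to be erased.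
        exec-accumulate : ∀ {P B₀ t υ} → B₀ ℕ.≤ B → (∀ a j → words σ₀ (ι a) j ≡ 0 × reals σ₀ (ι a) j ≡ 0#) →
          Run B₀ P (store (digraphWords L) (weightReals (layeredW G o))) t υ →
          Exec (accumulate H ι o P) σ₀ (buildTime H n ℕ.+ (t ℕ.+ 1)) λ τ →
            Tabulated τ ×
            (∀ b → 4 ℕ.+ κ ℕ.≤ b → (∀ a → b ≢ ι a) → ∀ j → words τ b j ≡ words σ₀ b j × reals τ b j ≡ reals σ₀ b j) ×
            reals τ 1 0 ≈ reals σ₀ 1 0 + ∏ (λ i → sign (proj₁ (o i))) * reals υ 1 0
        exec-accumulate {υ = υ} B₀≤B blank run = exec-seq (exec-build blank) after
          where
          after : ∀ {τ} → τ ≲ store (digraphWords L) (weightReals (layeredW G o)) ×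
            (∀ b → b ≢ 3 → (∀ a → b ≢ ι a) → ∀ j → words τ b j ≡ words σ₀ b j) ×
            (∀ b → (∀ a → b ≢ ι a) → ∀ j → reals τ b j ≡ reals σ₀ b j) → Exec _ τ _ _
          after {τ} (input , keepsW , keepsR) with run-rename B₀≤B input run
          ... | τ′ , run′ , output , frame = exec-seq {Q = τ′ ≡_} (_ , τ′ , run′ , ℕ.≤-refl , ≡.refl) λ
            { ≡.refl → exec-assignReal ≡.refl ≡.refl z≤n
              ( record
                { vertices = ≡.trans (keptW 0 (λ ()) (reserved (s≤s z≤n)) 0) (vertices tab)
                ; steps    = λ d j → ≡.trans (keptW (4 ℕ.+ toℕ d) (λ ()) (reserved (step< d)) (toℕ j)) (steps tab d j)
                }
              , (λ b b≥ b≢ι j → keptW b (ℕ.<⇒≢ (ℕ.≤-trans (s≤s (s≤s (s≤s (s≤s z≤n)))) b≥) ∘ ≡.sym) b≢ι j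
                  , ≡.trans (update-array (reals τ′) 0 j (ℕ.<⇒≢ (ℕ.≤-trans (s≤s (s≤s z≤n)) b≥))) (keptR b b≢ι j))
              , +-cong (reflexive (keptR 1 (reserved (s≤s (s≤s z≤n))) 0))
                  (*-cong (evalReal-product (λ i → signExpr (proj₁ (o i))) _ τ′ (λ i → evalReal-sign (proj₁ (o i)) τ′)) (reals≲ output 1 0))
              ) }
            where
            keptW : ∀ b → b ≢ 3 → (∀ a → b ≢ ι a) → ∀ j → words τ′ b j ≡ words σ₀ b j
            keptW b b≢3 b≢ι j = ≡.trans (words≐ frame b (λ a → b≢ι a ∘ ≡.sym) j) (keepsW b b≢3 b≢ι j)

            keptR : ∀ b → (∀ a → b ≢ ι a) → ∀ j → reals τ′ b j ≡ reals σ₀ b j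
            keptR b b≢ι j = ≡.trans (reals≐ frame b (λ a → b≢ι a ∘ ≡.sym) j) (keepsR b b≢ι j)

-- Running time

^-distribʳ-* : ∀ q m n → (m ℕ.* n) ℕ.^ q ≡ m ℕ.^ q ℕ.* n ℕ.^ q
^-distribʳ-* zero    m n = ≡.refl
^-distribʳ-* (suc q) m n = ≡.trans (≡.cong (m ℕ.* n ℕ.*_) (^-distribʳ-* q m n))
  (solve 4 (λ m n x y → m :* n :* (x :* y) := m :* x :* (n :* y)) ≡.refl m n (m ℕ.^ q) (n ℕ.^ q))
  where open +-*-Solver

module PowerBounds {c ℓ} (ℝ : Reals c ℓ) (α : Reals.Carrier ℝ) where

  open Over ℝ using (_≤_·_^_)
  open ℕ.≤-Reasoning

  -- The wrapper keeps `C`, `n` and `T` visible as indices; in the unfolded bound they occur only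
  -- inside powers.
  record Within (C n T : ℕ) : Set ℓ where
    constructor within
    field
      bound : T ≤ C · n ^ α

  open Within public

  within-≤ : ∀ {S T C n} → S ℕ.≤ T → Within C n T → Within C n S
  within-≤ {n = n} S≤T (within T≤) = within λ a b q 1≤q α<r → ℕ.≤-trans (ℕ.*-monoˡ-≤ (n ℕ.^ b) (ℕ.^-monoˡ-≤ q S≤T)) (T≤ a b q 1≤q α<r)

  within-monoˡ : ∀ {T C D n} → C ℕ.≤ D → Within C n T → Within D n T
  within-monoˡ {n = n} C≤D (within T≤) = within λ a b q 1≤q α<r → ℕ.≤-trans (T≤ a b q 1≤q α<r) (ℕ.*-monoˡ-≤ (n ℕ.^ a) (ℕ.^-monoˡ-≤ q C≤D))

  within-* : ∀ {T C n} d → Within C n T → Within (d ℕ.* C) n (d ℕ.* T)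
  within-* {T} {C} {n} d (within T≤) = within λ a b q 1≤q α<r → begin
    (d ℕ.* T) ℕ.^ q ℕ.* n ℕ.^ b          ≡⟨ ≡.cong (ℕ._* n ℕ.^ b) (^-distribʳ-* q d T) ⟩
    d ℕ.^ q ℕ.* T ℕ.^ q ℕ.* n ℕ.^ b      ≡⟨ ℕ.*-assoc (d ℕ.^ q) _ _ ⟩
    d ℕ.^ q ℕ.* (T ℕ.^ q ℕ.* n ℕ.^ b)    ≤⟨ ℕ.*-monoʳ-≤ (d ℕ.^ q) (T≤ a b q 1≤q α<r) ⟩
    d ℕ.^ q ℕ.* (C ℕ.^ q ℕ.* n ℕ.^ a)    ≡⟨ ℕ.*-assoc (d ℕ.^ q) _ _ ⟨
    d ℕ.^ q ℕ.* C ℕ.^ q ℕ.* n ℕ.^ a      ≡⟨ ≡.cong (ℕ._* n ℕ.^ a) (^-distribʳ-* q d C) ⟨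
    (d ℕ.* C) ℕ.^ q ℕ.* n ℕ.^ a          ∎

  -- `S + T` is at most twice the larger summand, so no power of a sum has to be expanded; hence the
  -- factor 2.
  within-+ : ∀ {S T C D n} → Within C n S → Within D n T → Within (2 ℕ.* (C ℕ.+ D)) n (S ℕ.+ T)
  within-+ {S} {T} {C} {D} S≤ T≤ with ℕ.≤-total S T
  ... | inj₁ S≤T = within-≤ (ℕ.+-mono-≤ S≤T (ℕ.m≤m+n T 0)) (within-* 2 (within-monoˡ (ℕ.m≤n+m D C) T≤))
  ... | inj₂ T≤S = within-≤ (ℕ.+-monoʳ-≤ S (ℕ.≤-trans T≤S (ℕ.m≤m+n S 0))) (within-* 2 (within-monoˡ (ℕ.m≤m+n C D) S≤))

  module _ where
    open Reals ℝ hiding (zero)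

    -- A natural exponent above α. It is an admissible instance of the time bound, with a =
    -- `ceiling`, b = 0 and q = 1, and it replaces α where a natural power is wanted.
    ceiling : ℕ
    ceiling = proj₁ (archimedean α)

    α<ceiling : fromℕ 0 + fromℕ 1 * α < fromℕ ceiling
    α<ceiling = IsStrictPartialOrder.<-respˡ-≈ isStrictPartialOrder
      (sym (trans (+-identityˡ _) (trans (*-congʳ (+-identityʳ 1#)) (*-identityˡ α)))) (proj₂ (archimedean α))

  -- For an exponent r = (a - b) / q below ceiling the factor h ^ r is at most
  -- h ^ ceiling; for a larger one the bound with exponent ceiling is stronger.
  within-shrink : ∀ {T C n} h → 1 ℕ.≤ h → 1 ℕ.≤ n → Within C (n ℕ.* h) T → Within (C ℕ.* h ℕ.^ ceiling) n T
  bound (within-shrink {T} {C} {n} h 1≤h 1≤n (within T≤)) a b q 1≤q α<r with ℕ.≤-total (b ℕ.+ ceiling ℕ.* q) a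
  ... | inj₁ b+Aq≤a = begin
    T ℕ.^ q ℕ.* n ℕ.^ b
      ≤⟨ ℕ.*-monoˡ-≤ (n ℕ.^ b) (ℕ.^-monoˡ-≤ q T≤′) ⟩
    (C ℕ.* h ℕ.^ ceiling ℕ.* n ℕ.^ ceiling) ℕ.^ q ℕ.* n ℕ.^ b
      ≡⟨ ≡.cong (ℕ._* n ℕ.^ b) (^-distribʳ-* q (C ℕ.* h ℕ.^ ceiling) _) ⟩
    (C ℕ.* h ℕ.^ ceiling) ℕ.^ q ℕ.* (n ℕ.^ ceiling) ℕ.^ q ℕ.* n ℕ.^ b
      ≡⟨ ≡.cong (λ x → (C ℕ.* h ℕ.^ ceiling) ℕ.^ q ℕ.* x ℕ.* n ℕ.^ b) (ℕ.^-*-assoc n ceiling q) ⟩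
    (C ℕ.* h ℕ.^ ceiling) ℕ.^ q ℕ.* n ℕ.^ (ceiling ℕ.* q) ℕ.* n ℕ.^ b
      ≡⟨ ℕ.*-assoc ((C ℕ.* h ℕ.^ ceiling) ℕ.^ q) _ _ ⟩
    (C ℕ.* h ℕ.^ ceiling) ℕ.^ q ℕ.* (n ℕ.^ (ceiling ℕ.* q) ℕ.* n ℕ.^ b)
      ≡⟨ ≡.cong ((C ℕ.* h ℕ.^ ceiling) ℕ.^ q ℕ.*_) (≡.trans (ℕ.*-comm (n ℕ.^ (ceiling ℕ.* q)) _) (≡.sym (ℕ.^-distribˡ-+-* n b (ceiling ℕ.* q)))) ⟩
    (C ℕ.* h ℕ.^ ceiling) ℕ.^ q ℕ.* n ℕ.^ (b ℕ.+ ceiling ℕ.* q)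
      ≤⟨ ℕ.*-monoʳ-≤ ((C ℕ.* h ℕ.^ ceiling) ℕ.^ q) (ℕ.^-monoʳ-≤ n b+Aq≤a) ⟩
    (C ℕ.* h ℕ.^ ceiling) ℕ.^ q ℕ.* n ℕ.^ a ∎
    where
    instance
      n≢0 : NonZero n
      n≢0 = ℕ.>-nonZero 1≤n

    T≤′ : T ℕ.≤ C ℕ.* h ℕ.^ ceiling ℕ.* n ℕ.^ ceiling
    T≤′ = begin
      T                                      ≡⟨ ℕ.*-identityʳ T ⟨
      T ℕ.* 1                                ≡⟨ ℕ.*-identityʳ _ ⟨
      T ℕ.* 1 ℕ.* 1                          ≤⟨ T≤ ceiling 0 1 (s≤s z≤n) α<ceiling ⟩
      C ℕ.* 1 ℕ.* (n ℕ.* h) ℕ.^ ceiling            ≡⟨ ≡.cong₂ ℕ._*_ (ℕ.*-identityʳ C) (≡.trans (^-distribʳ-* ceiling n h) (ℕ.*-comm (n ℕ.^ ceiling) _)) ⟩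
      C ℕ.* (h ℕ.^ ceiling ℕ.* n ℕ.^ ceiling)            ≡⟨ ℕ.*-assoc C _ _ ⟨
      C ℕ.* h ℕ.^ ceiling ℕ.* n ℕ.^ ceiling              ∎
  -- The factor `h ^ b` completes `n ^ b` to `(n * h) ^ b`, so that the hypothesis applies; it is
  -- cancelled again in the end.
  ... | inj₂ a≤b+Aq = ℕ.*-cancelʳ-≤ _ _ (h ℕ.^ b) (begin
    T ℕ.^ q ℕ.* n ℕ.^ b ℕ.* h ℕ.^ b
      ≡⟨ ≡.trans (ℕ.*-assoc (T ℕ.^ q) _ _) (≡.cong (T ℕ.^ q ℕ.*_) (≡.sym (^-distribʳ-* b n h))) ⟩
    T ℕ.^ q ℕ.* (n ℕ.* h) ℕ.^ b
      ≤⟨ T≤ a b q 1≤q α<r ⟩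
    C ℕ.^ q ℕ.* (n ℕ.* h) ℕ.^ a
      ≡⟨ ≡.cong (C ℕ.^ q ℕ.*_) (^-distribʳ-* a n h) ⟩
    C ℕ.^ q ℕ.* (n ℕ.^ a ℕ.* h ℕ.^ a)
      ≤⟨ ℕ.*-monoʳ-≤ (C ℕ.^ q) (ℕ.*-monoʳ-≤ (n ℕ.^ a) (ℕ.^-monoʳ-≤ h a≤b+Aq)) ⟩
    C ℕ.^ q ℕ.* (n ℕ.^ a ℕ.* h ℕ.^ (b ℕ.+ ceiling ℕ.* q))
      ≡⟨ ≡.cong (λ x → C ℕ.^ q ℕ.* (n ℕ.^ a ℕ.* x)) (≡.trans (ℕ.^-distribˡ-+-* h b (ceiling ℕ.* q)) (≡.cong (h ℕ.^ b ℕ.*_) (≡.sym (ℕ.^-*-assoc h ceiling q)))) ⟩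
    C ℕ.^ q ℕ.* (n ℕ.^ a ℕ.* (h ℕ.^ b ℕ.* (h ℕ.^ ceiling) ℕ.^ q))
      ≡⟨ solve 4 (λ x y z w → x :* (y :* (z :* w)) := x :* w :* y :* z) ≡.refl (C ℕ.^ q) (n ℕ.^ a) (h ℕ.^ b) ((h ℕ.^ ceiling) ℕ.^ q) ⟩
    C ℕ.^ q ℕ.* (h ℕ.^ ceiling) ℕ.^ q ℕ.* n ℕ.^ a ℕ.* h ℕ.^ b
      ≡⟨ ≡.cong (λ x → x ℕ.* n ℕ.^ a ℕ.* h ℕ.^ b) (^-distribʳ-* q C (h ℕ.^ ceiling)) ⟨
    (C ℕ.* h ℕ.^ ceiling) ℕ.^ q ℕ.* n ℕ.^ a ℕ.* h ℕ.^ b ∎)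
    where
    open +-*-Solver
    instance
      h≢0 : NonZero h
      h≢0 = ℕ.>-nonZero 1≤h
      h^b≢0 : NonZero (h ℕ.^ b)
      h^b≢0 = ℕ.m^n≢0 h b

outDegree≤order : ∀ H → OutDegreesAtMost (order H) H
outDegree≤order H a = Fin.injective⇒≤ {f = lookup (adj H a)} (λ {i} {j} → unique⇒lookup-injective (adj-unique H a) i j)

edgeless : ℕ → Digraph
edgeless n = record { order = n ; adj = λ _ → [] ; adj-unique = λ _ → [] }

-- The word bound is a pure power of `2 + n`, so a constant factor has to move into the exponent: c
-- is at most 2 ^ c, which is at most (2 + n) ^ c.
linear≤power : ∀ c n → c ℕ.* (2 ℕ.+ n) ℕ.≤ (2 ℕ.+ n) ℕ.^ suc c
linear≤power c n = ℕ.≤-trans (ℕ.≤-reflexive (ℕ.*-comm c (2 ℕ.+ n)))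
  (ℕ.*-monoʳ-≤ (2 ℕ.+ n) (ℕ.≤-trans (c≤2^c c) (ℕ.^-monoˡ-≤ c (s≤s (s≤s z≤n)))))
  where
  c≤2^c : ∀ c → c ℕ.≤ 2 ℕ.^ c
  c≤2^c zero    = z≤n
  c≤2^c (suc c) = ℕ.+-mono-≤ (ℕ.m^n>0 2 c) (ℕ.≤-trans (c≤2^c c) (ℕ.m≤m+n (2 ℕ.^ c) 0))

-- Running the solver on all selections

double odd : ℕ → ℕ
double a = 2 ℕ.* a
odd    a = suc (2 ℕ.* a)

-- `s` is an infinite supply of blank arrays. The current run receives the even positions and the
-- later runs share the odd ones, so nothing has to be known about how many arrays `P` uses.
collect : ∀ H {κ k K} → Program → (Fin K → Selection H κ k) → (ℕ → ℕ) → Program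
collect H {K = zero}  P os s = skip
collect H {K = suc K} P os s = accumulate H (s ∘ double) (os zero) P ∙ collect H P (os ∘ suc) (s ∘ odd)

module _ where
  open +-*-Solver

  +1-shift : ∀ b t → b ℕ.+ (t ℕ.+ 1) ≡ (b ℕ.+ 1) ℕ.+ t
  +1-shift = solve 2 (λ b t → b :+ (t :+ con 1) := (b :+ con 1) :+ t) ≡.refl

  buildRate : Digraph → ℕ
  buildRate H = 5 ℕ.+ vertexTime H ℕ.+ 1

  buildTime≤ : ∀ H n → buildTime H n ℕ.+ 1 ℕ.≤ buildRate H ℕ.* suc n
  -- The added term is the exact difference of the two sides, so only a ring equation is left.
  -- `overhead≤` proceeds alike.
  buildTime≤ H n = ℕ.≤-trans (ℕ.m≤m+n _ (4 ℕ.* n ℕ.+ (2 ℕ.+ vertexTime H)))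
    (ℕ.≤-reflexive (solve 2 (λ n r → con 1 :+ (con 1 :+ (n :* (con 1 :+ (r :+ con 1)) :+ con 1)) :+ con 1 :+ (con 4 :* n :+ (con 2 :+ r))
      := (con 5 :+ r :+ con 1) :* (con 1 :+ n)) ≡.refl n (vertexTime H)))

module Reduction {c₀ ℓ} (ℝ : Reals c₀ ℓ) (α : Reals.Carrier ℝ) (H : Digraph) where

  open Reals ℝ hiding (zero; _≤_)
  open Over ℝ
  open Store
  open LayeredSums ℝ H
  open Sums commutativeRing
  open PowerBounds ℝ α

  private
    h = order H
    m = length (edges H)

  ∑-extend : ∀ {K} (f : Fin (suc K) → Carrier) {a b c y} → b ≈ a + y → y ≈ f zero → c ≈ b + ∑ (fins K) (f ∘ suc) →
    c ≈ a + ∑ (fins (suc K)) f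
  ∑-extend f {a} b≈ y≈ c≈ = trans c≈ (trans (+-congʳ (trans b≈ (+-congˡ y≈)))
    (trans (+-assoc a (f zero) _) (+-congˡ (sym (∑-fins-suc f)))))

  collectTime : ∀ {K} → ℕ → (Fin K → ℕ) → ℕ
  collectTime {zero}  n t = 1
  collectTime {suc K} n t = (buildTime H n ℕ.+ (t zero ℕ.+ 1)) ℕ.+ collectTime n (t ∘ suc)

  module Solver (P : Program) (w C : ℕ)
    (solve : ∀ (I : Problem.Instance (WHomCnt H h)) → ∃[ t ] ∃[ σ ]
        Run ((2 ℕ.+ Problem.size (WHomCnt H h) I) ℕ.^ w) P (Problem.input (WHomCnt H h) I) t σ
      × reals σ 1 0 ≈ Problem.answer (WHomCnt H h) I
      × (1 ℕ.≤ Problem.size (WHomCnt H h) I → (Problem.inputLength (WHomCnt H h) I ℕ.+ t) ≤ C · Problem.size (WHomCnt H h) I ^ α))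
    where

    -- Reading the edgeless digraph on n vertices already takes time n.
    linear : ∀ {n} c {T} → T ℕ.≤ c ℕ.* suc n → 1 ℕ.≤ n → Within (c ℕ.* C) n T
    linear {n} c {T} T≤ 1≤n with solve (record { digraph = edgeless n ; weight = λ _ _ → 0# ; weight≥0 = λ _ _ () } , λ _ → z≤n)
    ... | t , _ , _ , _ , len+t≤ = within-≤ T≤ (within-* c (within-≤
      (ℕ.≤-trans (ℕ.≤-trans (ℕ.m≤m+n (suc n) _) (ℕ.m≤m+n _ _)) (ℕ.m≤m+n _ t)) (within (len+t≤ 1≤n))))

    -- The constants come from `within-+`: the inner 2 adds the building time to the solver's time
    -- on `n * h` vertices, where `within-shrink` contributes `h ^ ceiling`, and the outer 2 adds
    -- the remaining runs.
    collectRate : ℕ → ℕ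
    collectRate zero    = 1 ℕ.* C
    collectRate (suc K) = 2 ℕ.* (2 ℕ.* (buildRate H ℕ.* C ℕ.+ C ℕ.* h ℕ.^ ceiling) ℕ.+ collectRate K)

    module _ (G : Digraph) {κ : ℕ} {k : Fin m → ℕ} where

      private n = order G

      Solved : Selection H κ k → Carrier → Set (c₀ ⊔ ℓ)
      Solved o x = ∃[ t ] ∃[ υ ]
          Run ((2 ℕ.+ n ℕ.* h) ℕ.^ w) P (store (digraphWords (layered H G o)) (weightReals (layeredW G o))) t υ
        × reals υ 1 0 ≈ x
        × (1 ℕ.≤ n ℕ.* h → Within C (n ℕ.* h) t)

      solved : ∀ o → Solved o (weightedHom H (layeredW G o))
      solved o = let t , υ , run , answer , len+t≤ = solve (layeredW G o , layered-bound H G o (outDegree≤order H))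
        in t , υ , run , answer , λ 1≤nh → within-≤ (ℕ.m≤n+m t _) (within (len+t≤ 1≤nh))

      open Tables ℝ G κ

      module _ {B} (n≤B : n ℕ.≤ B) (nh≤B : n ℕ.* h ℕ.≤ B) (nm≤B : n ℕ.* m ℕ.≤ B) (h≤B : h ℕ.≤ B)
        (w≤B : (2 ℕ.+ n ℕ.* h) ℕ.^ w ℕ.≤ B) (1≤h : 1 ℕ.≤ h) where

        open Execution ℝ B

        exec-collect : ∀ {K} (os : Fin K → Selection H κ k) (x : Fin K → Carrier) (runs : ∀ i → Solved (os i) (x i)) →
          ∀ s → Injective _≡_ _≡_ s → (∀ a → 4 ℕ.+ κ ℕ.≤ s a) →
          ∀ {σ} → Tabulated σ → (∀ a j → words σ (s a) j ≡ 0 × reals σ (s a) j ≡ 0#) →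
          Exec (collect H P os s) σ (collectTime n (proj₁ ∘ runs))
            (λ τ → reals τ 1 0 ≈ reals σ 1 0 + ∑ (fins K) (λ i → coefficient (os i) * x i))
        exec-collect {zero} os x runs s s-inj s-free tab blank =
          1 , _ , skip , ℕ.≤-refl , sym (trans (+-congˡ (∑-fins-zero _)) (+-identityʳ _))
        exec-collect {suc K} os x runs s s-inj s-free {σ} tab blank =
          let t , υ , run , answer , _ = runs zero in
          exec-seq
            (Building.exec-accumulate ℝ H G (os zero) (s ∘ double) (ℕ.*-cancelˡ-≡ _ _ 2 ∘ s-inj) (s-free ∘ double)
              n≤B nh≤B nm≤B (λ a → ℕ.≤-trans (outDegree≤order H a) h≤B) σ tab w≤B (blank ∘ double) run)
            λ (tab′ , kept , sum₁) → exec-map ℕ.≤-refl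
              (∑-extend (λ i → coefficient (os i) * x i) sum₁ (*-congˡ answer))
              (exec-collect (os ∘ suc) (x ∘ suc) (runs ∘ suc) (s ∘ odd)
                (ℕ.*-cancelˡ-≡ _ _ 2 ∘ ℕ.suc-injective ∘ s-inj) (s-free ∘ odd) tab′
                -- An odd position is never an even one, so the run that has just finished left
                -- these arrays blank.
                (λ a j → let w≡ , r≡ = kept (s (odd a)) (s-free (odd a)) (λ b eq → ℕ.even≢odd b a (≡.sym (s-inj eq))) j
                             w≡0 , r≡0 = blank (odd a) j
                         in ≡.trans w≡ w≡0 , ≡.trans r≡ r≡0))

      collect-within : 1 ℕ.≤ n → 1 ℕ.≤ h → ∀ {K} (os : Fin K → Selection H κ k) (x : Fin K → Carrier) (runs : ∀ i → Solved (os i) (x i)) →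
        Within (collectRate K) n (collectTime n (proj₁ ∘ runs))
      collect-within 1≤n 1≤h {zero}  os x runs = linear 1 (s≤s z≤n) 1≤n
      collect-within 1≤n 1≤h {suc K} os x runs = let t , _ , _ , _ , t≤ = runs zero in within-+
        (within-≤ (ℕ.≤-reflexive (+1-shift (buildTime H n) t))
          (within-+ (linear (buildRate H) (buildTime≤ H n) 1≤n) (within-shrink h 1≤h 1≤n (t≤ (ℕ.*-mono-≤ 1≤n 1≤h)))))
        (collect-within 1≤n 1≤h (os ∘ suc) (x ∘ suc) (runs ∘ suc))

digraphLength≤ : ∀ G {κ} → OutDegreesAtMost κ G → 1 ℕ.+ order G ℕ.+ length (edges G) ℕ.≤ suc κ ℕ.* suc (order G)
digraphLength≤ G {κ} bound = ℕ.+-monoʳ-≤ (suc (order G)) (ℕ.≤-trans (edges-≤ G bound)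
  (ℕ.≤-trans (ℕ.≤-reflexive (ℕ.*-comm (order G) κ)) (ℕ.*-monoʳ-≤ κ (ℕ.n≤1+n (order G)))))

module _ where
  open +-*-Solver

  overhead : ℕ → ℕ
  overhead κ = suc κ ℕ.+ (2 ℕ.+ suc ((κ ℕ.* 1 ℕ.+ 1) ℕ.+ 1 ℕ.+ 1))

  overhead≤ : ∀ {κ n l} t → l ℕ.≤ suc κ ℕ.* suc n →
    l ℕ.+ ((n ℕ.* suc ((κ ℕ.* 1 ℕ.+ 1) ℕ.+ 1 ℕ.+ 1) ℕ.+ 1) ℕ.+ (t ℕ.+ 1)) ℕ.≤ overhead κ ℕ.* suc n ℕ.+ t
  overhead≤ {κ} {n} t l≤ = ℕ.≤-trans (ℕ.+-monoˡ-≤ _ l≤) (ℕ.≤-trans (ℕ.m≤m+n _ (2 ℕ.* n ℕ.+ rate)) (ℕ.≤-reflexive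
    (solve 4 (λ k n r t → (con 1 :+ k) :* (con 1 :+ n) :+ ((n :* r :+ con 1) :+ (t :+ con 1)) :+ (con 2 :* n :+ r) :=
      ((con 1 :+ k) :+ (con 2 :+ r)) :* (con 1 :+ n) :+ t) ≡.refl κ n rate t)))
    where
    rate : ℕ
    rate = suc ((κ ℕ.* 1 ℕ.+ 1) ℕ.+ 1 ℕ.+ 1)

-- The first summand bounds every quantity of the reduction itself: all are at most 1 + h + m + κ
-- times 2 + n, and `linear≤power` costs one more. The second covers the solver's own words, since 2
-- + n h is at most (2 + n) ^ (2 + h).
wordExponent : ℕ → ℕ → ℕ → ℕ → ℕ
wordExponent h m κ w = suc (suc (h ℕ.+ m ℕ.+ κ)) ℕ.+ (2 ℕ.+ h) ℕ.* w

module WordBound (h m κ w n : ℕ) where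

  private
    exponent = wordExponent h m κ w
    wordMax = (2 ℕ.+ n) ℕ.^ exponent
    open ℕ.≤-Reasoning

    power≤B : ∀ {e} → e ℕ.≤ exponent → (2 ℕ.+ n) ℕ.^ e ℕ.≤ wordMax
    power≤B = ℕ.^-monoʳ-≤ (2 ℕ.+ n)

  linear≤B : ∀ {x} → x ℕ.≤ suc (h ℕ.+ m ℕ.+ κ) ℕ.* (2 ℕ.+ n) → x ℕ.≤ wordMax
  linear≤B {x} x≤ = begin
    x                                    ≤⟨ x≤ ⟩
    suc (h ℕ.+ m ℕ.+ κ) ℕ.* (2 ℕ.+ n)    ≤⟨ linear≤power (suc (h ℕ.+ m ℕ.+ κ)) n ⟩
    (2 ℕ.+ n) ℕ.^ suc (suc (h ℕ.+ m ℕ.+ κ)) ≤⟨ power≤B (ℕ.m≤m+n (suc (suc (h ℕ.+ m ℕ.+ κ))) ((2 ℕ.+ h) ℕ.* w)) ⟩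
    wordMax ∎

  product≤B : ∀ {x} → x ℕ.≤ suc (h ℕ.+ m ℕ.+ κ) → n ℕ.* x ℕ.≤ wordMax
  product≤B x≤ = linear≤B (ℕ.≤-trans (ℕ.≤-reflexive (ℕ.*-comm n _)) (ℕ.*-mono-≤ x≤ (ℕ.m≤n+m n 2)))

  h≤ : h ℕ.≤ suc (h ℕ.+ m ℕ.+ κ)
  h≤ = ℕ.m≤n⇒m≤1+n (ℕ.≤-trans (ℕ.m≤m+n h m) (ℕ.m≤m+n _ κ))

  n≤B : n ℕ.≤ wordMax
  n≤B = ℕ.≤-trans (ℕ.≤-reflexive (≡.sym (ℕ.*-identityʳ n))) (product≤B (s≤s z≤n))

  nh≤B : n ℕ.* h ℕ.≤ wordMax
  nh≤B = product≤B h≤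

  nm≤B : n ℕ.* m ℕ.≤ wordMax
  nm≤B = product≤B (ℕ.m≤n⇒m≤1+n (ℕ.≤-trans (ℕ.m≤n+m m h) (ℕ.m≤m+n _ κ)))

  nκ≤B : n ℕ.* κ ℕ.≤ wordMax
  nκ≤B = product≤B (ℕ.m≤n⇒m≤1+n (ℕ.m≤n+m κ (h ℕ.+ m)))

  h≤B : h ℕ.≤ wordMax
  h≤B = linear≤B (ℕ.≤-trans h≤ (ℕ.m≤m*n _ (2 ℕ.+ n)))

  solver≤B : (2 ℕ.+ n ℕ.* h) ℕ.^ w ℕ.≤ wordMax
  solver≤B = begin
    (2 ℕ.+ n ℕ.* h) ℕ.^ w                ≤⟨ ℕ.^-monoˡ-≤ w size≤ ⟩
    ((2 ℕ.+ n) ℕ.^ (2 ℕ.+ h)) ℕ.^ w      ≡⟨ ℕ.^-*-assoc (2 ℕ.+ n) (2 ℕ.+ h) w ⟩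
    (2 ℕ.+ n) ℕ.^ ((2 ℕ.+ h) ℕ.* w)      ≤⟨ power≤B (ℕ.m≤n+m ((2 ℕ.+ h) ℕ.* w) (suc (suc (h ℕ.+ m ℕ.+ κ)))) ⟩
    wordMax ∎
    where
    size≤ : 2 ℕ.+ n ℕ.* h ℕ.≤ (2 ℕ.+ n) ℕ.^ (2 ℕ.+ h)
    size≤ = begin
      2 ℕ.+ n ℕ.* h                          ≤⟨ ℕ.+-mono-≤ (ℕ.m≤m+n 2 n) (ℕ.*-monoˡ-≤ h (ℕ.m≤n+m n 2)) ⟩
      (2 ℕ.+ n) ℕ.+ (2 ℕ.+ n) ℕ.* h          ≡⟨ ≡.cong ((2 ℕ.+ n) ℕ.+_) (ℕ.*-comm (2 ℕ.+ n) h) ⟩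
      suc h ℕ.* (2 ℕ.+ n)                    ≤⟨ linear≤power (suc h) n ⟩
      (2 ℕ.+ n) ℕ.^ (2 ℕ.+ h)                ∎

-- The complete reduction

module _ {c₀ ℓ} (ℝ : Reals c₀ ℓ) (α : Reals.Carrier ℝ) {H H′ : Digraph} {x : Fin (length (edges H)) → ℕ}
  (S : IsSubdivision H x H′) where

  open Reals ℝ hiding (zero; _≤_)
  open Over ℝ
  open Store
  open LayeredSums ℝ H
  open Sums commutativeRing
  open PowerBounds ℝ α
  open Reduction ℝ α H

  private
    h = order H
    m = length (edges H)

    k : Fin m → ℕ
    k i = x i ℕ.∸ 1

  ∑-selections : ∀ G {κ} → OutDegreesAtMost κ G →
    ∑ (selections H κ k) (λ o → coefficient o * weightedHom H (layeredW G o)) ≈ fromℕ (symmetries H) * fromℕ (hom H′ G)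
  ∑-selections G bound = trans (weightedHom-combination G bound k) (*-congˡ (sym (Walks.hom-subdivision ℝ S G)))

  symmetries#0 : fromℕ (symmetries H) # 0#
  symmetries#0 = inj₂ (positive (symmetries>0 H))
    where
    positive : ∀ {n} → 1 ℕ.≤ n → 0# < fromℕ n
    positive {suc n} _ = 0<fromℕ-suc n

  divide : ∀ {a b} → a ≈ fromℕ (symmetries H) * b → a * recip (fromℕ (symmetries H)) symmetries#0 ≈ b
  divide {a} {b} a≈ = trans (*-congʳ (trans a≈ (*-comm _ b)))
    (trans (*-assoc b _ _) (trans (*-congˡ (recip-inverse _ symmetries#0)) (*-identityʳ b)))

  reduce : 1 ℕ.≤ h → SolvableInTime α (WHomCnt H h) → ∀ κ → SolvableInTime α (HomCnt H′ κ)
  reduce 1≤h (P , w , C , solve) κ = program , exponent , 2 ℕ.* (overhead κ ℕ.* C ℕ.+ collectRate K) , correct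
    where
    open Solver P w C solve

    exponent : ℕ
    exponent = wordExponent h m κ w

    K : ℕ
    K = size (selections H κ k)

    program : Program
    -- Arrays 0 to 2 hold the input, 3 the loop control and the next κ the step tables, so the names
    -- from `4 + κ` on are free. Cell 0 of real array 1 starts at 0 and accumulates the signed sum
    -- until the division.
    program = tabulateSteps κ ∙ collect H P (at (selections H κ k)) (4 ℕ.+ κ ℕ.+_) ∙
      divideReal 1 (lit 0) (cell 1 (lit 0)) (cast (lit (symmetries H)))

    correct : ∀ (I : Problem.Instance (HomCnt H′ κ)) → ∃[ t ] ∃[ σ ]
        Run ((2 ℕ.+ Problem.size (HomCnt H′ κ) I) ℕ.^ exponent) program (Problem.input (HomCnt H′ κ) I) t σ
      × reals σ 1 0 ≈ Problem.answer (HomCnt H′ κ) I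
      × (1 ℕ.≤ Problem.size (HomCnt H′ κ) I →
          (Problem.inputLength (HomCnt H′ κ) I ℕ.+ t) ≤ (2 ℕ.* (overhead κ ℕ.* C ℕ.+ collectRate K)) · Problem.size (HomCnt H′ κ) I ^ α)
    correct (G , bound) = conclude executed
      where
      n = order G
      module W = WordBound h m κ w n
      open Execution ℝ ((2 ℕ.+ n) ℕ.^ exponent)

      runs : ∀ i → Solved G (at (selections H κ k) i) (weightedHom H (layeredW G (at (selections H κ k) i)))
      runs i = solved G (at (selections H κ k) i)

      time : ℕ
      time = (n ℕ.* suc ((κ ℕ.* 1 ℕ.+ 1) ℕ.+ 1 ℕ.+ 1) ℕ.+ 1) ℕ.+ (collectTime n (proj₁ ∘ runs) ℕ.+ 1)

      executed : Exec program (store (digraphWords G) (λ _ _ → 0#)) time (λ τ → reals τ 1 0 ≈ fromℕ (hom H′ G))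
      executed = exec-seq (Tables.exec-tabulateSteps ℝ G κ bound W.n≤B W.nκ≤B) λ {σ} (tab , blank , real) →
        exec-seq (exec-collect G W.n≤B W.nh≤B W.nm≤B W.h≤B W.solver≤B 1≤h (at (selections H κ k)) _ runs
          (4 ℕ.+ κ ℕ.+_) (ℕ.+-cancelˡ-≡ (4 ℕ.+ κ) _ _) (ℕ.m≤m+n (4 ℕ.+ κ)) tab
          (λ a j → blank _ (ℕ.m≤m+n (4 ℕ.+ κ) a) j , ≡.cong (λ M → M (4 ℕ.+ κ ℕ.+ a) j) real))
        λ {τ} total → 1 , _ , divideReal z≤n symmetries#0 , ℕ.≤-refl , divide (trans total
          (trans (+-congʳ (reflexive (≡.cong (λ M → M 1 0) real))) (trans (+-identityˡ _)
            (trans (sym (∑-at (selections H κ k) _)) (∑-selections G bound)))))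

      conclude : Exec program (store (digraphWords G) (λ _ _ → 0#)) time (λ τ → reals τ 1 0 ≈ fromℕ (hom H′ G)) → _
      conclude (t , τ , run , t≤ , answer) = t , τ , run , answer , λ 1≤n → Within.bound (within-≤
        (ℕ.≤-trans (ℕ.+-monoʳ-≤ (digraphLength G) t≤) (overhead≤ {κ} {n} (collectTime n (proj₁ ∘ runs)) (digraphLength≤ G bound)))
        (within-+ (linear (overhead κ) ℕ.≤-refl 1≤n)
          (collect-within G 1≤n 1≤h (at (selections H κ k)) _ runs)))

  -- Only the empty map on the vertices of H exists, and without vertices there is no edge: the sum
  -- has a single term, an empty product.
  hom-empty : h ≡ 0 → ∀ G → fromℕ (hom H′ G) ≈ 1#
  hom-empty h≡0 G = trans (Walks.hom-subdivision ℝ S G) (single h≡0 _ λ f → ∏-one λ i → noVertex h≡0 (tailOf H i))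
    where
    noVertex : ∀ {h} {A : Set ℓ} → h ≡ 0 → Fin h → A
    noVertex ≡.refl ()

    single : ∀ {h n} → h ≡ 0 → (f : (Fin h → Fin n) → Carrier) → (∀ g → f g ≈ 1#) → ∑ (functions h n) f ≈ 1#
    single ≡.refl f f≈1 = trans (∑-at (functions 0 _) f) (trans (∑-fins-suc _)
      (trans (+-cong (f≈1 _) (∑-fins-zero _)) (+-identityʳ 1#)))

  -- If H is empty then so is every layered digraph, and the solver's time bound says nothing.
  reduce-empty : h ≡ 0 → SolvableInTime α (WHomCnt H h) → ∀ κ → SolvableInTime α (HomCnt H′ κ)
  reduce-empty h≡0 (P , w , C , solve) κ = assignReal 1 (lit 0) (cast (lit 1)) , 0 , (2 ℕ.+ κ) ℕ.* C , λ (G , bound) →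
      1 , _ , assignReal z≤n , trans (+-identityʳ 1#) (sym (hom-empty h≡0 G))
    , λ 1≤n → Within.bound (linear (2 ℕ.+ κ)
        (ℕ.≤-trans (ℕ.≤-reflexive (ℕ.+-comm (digraphLength G) 1)) (ℕ.+-mono-≤ (s≤s z≤n) (digraphLength≤ G bound))) 1≤n)
    where open Solver P w C solve

theorem5 : {c ℓ : Level} (ℝ : Reals c ℓ) (α : Reals.Carrier ℝ) (H H′ : Digraph) →
    Acyclic H → IsDirectedSubdivision H H′ →
    Over.SolvableInDegenerate ℝ α (Over.WHomCnt ℝ H) →
    Over.SolvableInDegenerate ℝ α (Over.HomCnt ℝ H′)
theorem5 ℝ α H H′ _ (x , S) solver κ with ℕ.<-≤-connex 0 (order H)
... | inj₁ 1≤h = reduce ℝ α S 1≤h (solver (order H)) κ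
... | inj₂ h≤0 = reduce-empty ℝ α S (ℕ.n≤0⇒n≡0 h≤0) (solver (order H)) κ
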